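{- Let $(W,S)$ be a finite Coxeter system, $c$ a Coxeter element with reduced word $\mathbf{c}$, and $\mathbf{w}_\circ(\mathbf{c})$ the $c$-sorting word of $w_\circ$. Let $s,t\in S$ be neighbors in the Coxeter graph such that $s$ comes before $t$ in $c$. Then $\phi_{\mathbf{w}_\circ(\mathbf{c})}(s)=\phi_{\mathbf{w}_\circ(\mathbf{c})}(t)$ if $\psi(s)$ comes before $\psi(t)$ in $c$, and $\phi_{\mathbf{w}_\circ(\mathbf{c})}(s)=\phi_{\mathbf{w}_\circ(\mathbf{c})}(t)+1$ if $\psi(s)$ comes after $\psi(t)$ in $c$.
   Context: A Coxeter element is the product of all elements of $S$ in some order. $s,t$ are neighbors in the Coxeter graph if they do not commute. For non-commuting $s,t$, "$s$ comes before $t$ in $c$" means $s$ appears before $t$ in any (equivalently every) reduced expression of $c$. $w_\circ$ is the longest element and $\psi(s)=w_\circ^{ -1}sw_\circ$. $\mathbf{w}_\circ(\mathbf{c})$ is the lexicographically first (as a sequence of positions) subword of $\mathbf{c}\mathbf{c}\mathbf{c}\cdots$ which is a reduced expression for $w_\circ$. For a word $\mathbf{w}$ in $S$, $\phi_{\mathbf{w}}(s)$ is the number of occurrences of the letter $s$ in $\mathbf{w}$. -}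

module Defs where

open import Data.Nat using (ℕ; zero; suc; _≤_; _<_)
open import Data.Fin using (Fin; toℕ)
open import Data.Fin.Properties using (_≟_)
open import Data.List using (List; []; _∷_; _++_; length; map; reverse; filter; allFin; lookup)
open import Data.List.Membership.Propositional using (_∈_)
open import Data.List.Relation.Unary.Any using (Any)
open import Data.List.Relation.Binary.Permutation.Propositional using (_↭_)
open import Data.Product using (Σ; ∃; ∃₂; _×_; _,_)
open import Data.Sum using (_⊎_)
open import Relation.Binary.PropositionalEquality using (_≡_; _≢_)
open import Relation.Binary.Construct.Closure.Equivalence using (EqClosure)
open import Relation.Unary using (∁)

-- A Coxeter matrix on the generator set S = Fin n.
-- (Off-diagonal entries are finite naturals ≥ 2; entries ∞ cannot occur
--  in a finite Coxeter system, which is all the theorem concerns.)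
record CoxeterMatrix (n : ℕ) : Set where
  field
    m      : Fin n → Fin n → ℕ
    m-diag : ∀ i → m i i ≡ 1
    m-sym  : ∀ i j → m i j ≡ m j i
    m-off  : ∀ i j → i ≢ j → 2 ≤ m i j
open CoxeterMatrix public

Word : ℕ → Set
Word n = List (Fin n)

alt : ∀ {n} → Fin n → Fin n → ℕ → Word n
alt s t zero    = []
alt s t (suc k) = s ∷ alt t s k

data Step {n} (M : CoxeterMatrix n) : Word n → Word n → Set where
  cancel : ∀ u v s → Step M (u ++ s ∷ s ∷ v) (u ++ v)
  braid  : ∀ u v s t → Step M (u ++ alt s t (m M s t) ++ v) (u ++ alt t s (m M s t) ++ v)

-- two words represent the same element of W
_≈⟨_⟩_ : ∀ {n} → Word n → CoxeterMatrix n → Word n → Set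
u ≈⟨ M ⟩ v = EqClosure (Step M) u v

IsFinite : ∀ {n} → CoxeterMatrix n → Set
IsFinite {n} M = Σ (List (Word n)) λ L → ∀ w → Any (λ v → v ≈⟨ M ⟩ w) L

IsReduced : ∀ {n} → CoxeterMatrix n → Word n → Set
IsReduced M w = ∀ v → v ≈⟨ M ⟩ w → length w ≤ length v

-- w is a reduced word of an element of maximal length (in a finite
-- Coxeter group: a reduced expression for the longest element w∘)
IsLongestWord : ∀ {n} → CoxeterMatrix n → Word n → Set
IsLongestWord M w = IsReduced M w × (∀ v → IsReduced M v → length v ≤ length w)

IsCoxeterWord : ∀ {n} → Word n → Set
IsCoxeterWord {n} c = c ↭ allFin n

Before : ∀ {n} → Word n → Fin n → Fin n → Set
Before c s t = ∃₂ λ u v → c ≡ u ++ s ∷ v × t ∈ v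

-- positions in c c c ⋯ : (copy index k, index i inside c)
Pos : ∀ {n} → Word n → Set
Pos c = ℕ × Fin (length c)

PosLt : ∀ {n} (c : Word n) → Pos c → Pos c → Set
PosLt c (k , i) (k' , i') = k < k' ⊎ (k ≡ k' × toℕ i < toℕ i')

-- strictly increasing list of positions (a subword of c c c ⋯)
data Increasing {n} (c : Word n) : List (Pos c) → Set where
  inc-nil  : Increasing c []
  inc-one  : ∀ p → Increasing c (p ∷ [])
  inc-cons : ∀ {p q ps} → PosLt c p q → Increasing c (q ∷ ps) → Increasing c (p ∷ q ∷ ps)

letters : ∀ {n} (c : Word n) → List (Pos c) → Word n
letters c = map (λ p → lookup c (Data.Product.proj₂ p))

LexLess : ∀ {n} (c : Word n) → List (Pos c) → List (Pos c) → Set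
LexLess c P Q =
  Σ (List (Pos c)) λ u → Σ (Pos c) λ p → Σ (Pos c) λ q →
  Σ (List (Pos c)) λ P' → Σ (List (Pos c)) λ Q' →
  PosLt c p q × P ≡ u ++ p ∷ P' × Q ≡ u ++ q ∷ Q'

-- P is the lexicographically first subword of c c c ⋯ that is a reduced
-- expression for w∘; letters c P is then the c-sorting word w∘(c)
IsSortingWordW₀ : ∀ {n} → CoxeterMatrix n → (c : Word n) → List (Pos c) → Set
IsSortingWordW₀ M c P =
  Increasing c P × IsLongestWord M (letters c P) ×
  (∀ Q → Increasing c Q → IsLongestWord M (letters c Q) → P ≡ Q ⊎ LexLess c P Q)

φ : ∀ {n} → Word n → Fin n → ℕ
φ w s = length (filter (_≟ s) w)

{-# OPTIONS --safe #-}
module Submission where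

-- Call position i of c c c ⋯ taken in window r if the greedy reduced word that starts reading at position r is extended
-- at i. Windows r and r + 1 differ by one exchange: r is dropped and a single later position p r is gained. Since windows
-- only gain later positions and are periodic with period n = length c, each letter is taken in the first φ(s) copies of c
-- and in no others, and p maps the first copy onto the positions (φ(a) , a) just behind the last taken ones.
--
-- The key fact is that the letter at p r commutes with every letter taken behind p r in window r. Let p r < i be a first
-- counterexample. Up to i, the roots of consecutive windows are then related by the simple reflections, so that the Euler
-- form of c, which is invariant under source-to-sink rotation of c, takes the same values on the roots of p r and i in
-- window r + 1, where p r has the simple root of the last letter of the rotated c, as in window p r, where it has that of
-- the first letter. As roots of reduced words are nonnegative, these values have opposite signs, which forces p r and i to
-- be non-adjacent.
--
-- Hence the letter at p r is ψ of the letter at r, and p preserves the order of positions with non-commuting images.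
-- Comparing p at the positions of ψ(s) and ψ(t) gives the theorem.
--
-- The roots live in a representation over ℤ obtained by unfolding: each generator acts by the product of the reflections
-- in ℕ many commuting simple roots, and the simple roots over s and t form disjoint paths with m(s , t) - 1 vertices.
-- Classical reasoning about the word problem is harmless because the conclusion is decidable.

open import Defs

-- The proof needs signs of roots, whose usual coefficients involve 2cos(π/m). This number is the
-- largest eigenvalue of the adjacency operator of a path with m - 1 vertices, and the Chebyshev
-- polynomial behind the braid relation annihilates that operator. Replacing the number by the
-- operator keeps everything in ℤ. All pairs of generators must share one index set, so each path is
-- repeated along ℕ. The exchange condition is obtained from the parity with which a reflection
-- occurs in a word. Counting occurrences compares group elements, which is where a decision
-- procedure for the word problem enters. For the sign argument both orders of the two arguments of
-- the Euler form are evaluated. With a the letter at p r and γ the root of i in window p r, they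
-- show that the coefficients over a of γ and of its reflection in a both pair nonpositively with a
-- test function. Their sum is the contribution of the neighbours of a to the reflection, and it
-- pairs to at least 1 if the letter at i is such a neighbour.

module CoxeterWords where

  open import Data.Bool using (Bool; true; false; not; _xor_)
  open import Data.Bool.Properties using (xor-same; xor-assoc; xor-comm; xor-identityʳ)
  open import Data.Nat using (ℕ; zero; suc; _+_; _≤_; _<_; s≤s; z≤n)
  open import Data.Nat.Properties as ℕₚ using (+-suc; +-comm)
  open import Data.Fin using (Fin)
  open import Data.List using ([]; _∷_; _++_; [_]; length; reverse)
  open import Data.List.Properties using (++-assoc; ++-identityʳ; reverse-++; unfold-reverse; reverse-involutive; length-++)
  open import Data.Product using (∃; _×_; _,_; proj₁; proj₂)
  open import Data.Empty using (⊥; ⊥-elim)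
  open import Function.Bundles using (mk⇔)
  open import Relation.Nullary using (¬_; Dec; yes; no; does)
  open import Relation.Nullary.Decidable using (does-⇔; dec-true; dec-false)
  open import Relation.Binary.Bundles using (Setoid)
  open import Relation.Binary.PropositionalEquality using (_≡_; refl; sym; trans; cong; cong₂; subst; subst₂; module ≡-Reasoning)
  import Relation.Binary.Construct.Closure.Equivalence as Eq

  -- The Coxeter group as words modulo cancellation and braid moves

  module Words {n : ℕ} (M : CoxeterMatrix n) where

    infix 4 _≈_
    _≈_ : Word n → Word n → Set
    u ≈ v = u ≈⟨ M ⟩ v

    ≈-setoid : Setoid _ _
    ≈-setoid = Eq.setoid (Step M)

    open Setoid ≈-setoid public using () renaming (refl to ≈-refl; sym to ≈-sym; trans to ≈-trans; reflexive to ≈-reflexive)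

    module ≈-Reasoning where
      infix 1 begin_
      infixr 2 _∼⟨_⟩_ _∼⟨_⟨_ _≡⟨_⟩_ _≡⟨_⟨_
      infix 3 _∎

      begin_ : ∀ {u v} → u ≈ v → u ≈ v
      begin p = p

      _∼⟨_⟩_ : ∀ u {v x} → u ≈ v → v ≈ x → u ≈ x
      _ ∼⟨ p ⟩ q = ≈-trans p q

      _∼⟨_⟨_ : ∀ u {v x} → v ≈ u → v ≈ x → u ≈ x
      _ ∼⟨ p ⟨ q = ≈-trans (≈-sym p) q

      _≡⟨_⟩_ : ∀ u {v x} → u ≡ v → v ≈ x → u ≈ x
      _ ≡⟨ refl ⟩ q = q

      _≡⟨_⟨_ : ∀ u {v x} → v ≡ u → v ≈ x → u ≈ x
      _ ≡⟨ refl ⟨ q = q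

      _∎ : ∀ u → u ≈ u
      _ ∎ = ≈-refl

    Step-++ˡ : ∀ x {u v} → Step M u v → Step M (x ++ u) (x ++ v)
    Step-++ˡ x (cancel u v s) = subst₂ (Step M) (++-assoc x u _) (++-assoc x u _) (cancel (x ++ u) v s)
    Step-++ˡ x (braid u v s t) = subst₂ (Step M) (++-assoc x u _) (++-assoc x u _) (braid (x ++ u) v s t)

    Step-++ʳ : ∀ y {u v} → Step M u v → Step M (u ++ y) (v ++ y)
    Step-++ʳ y (cancel u v s) = subst₂ (Step M) (sym (++-assoc u _ y)) (sym (++-assoc u v y)) (cancel u (v ++ y) s)
    Step-++ʳ y (braid u v s t) = subst₂ (Step M) (reassoc (alt s t _)) (reassoc (alt t s _)) (braid u (v ++ y) s t)
      where
      reassoc : ∀ z → u ++ z ++ v ++ y ≡ (u ++ z ++ v) ++ y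
      reassoc z = sym (trans (++-assoc u _ y) (cong (u ++_) (++-assoc z v y)))

    ++-congˡ : ∀ x {u v} → u ≈ v → x ++ u ≈ x ++ v
    ++-congˡ x = Eq.gmap (x ++_) (Step-++ˡ x)

    ++-congʳ : ∀ y {u v} → u ≈ v → u ++ y ≈ v ++ y
    ++-congʳ y = Eq.gmap (_++ y) (Step-++ʳ y)

    ++-cong : ∀ {u u' v v'} → u ≈ u' → v ≈ v' → u ++ v ≈ u' ++ v'
    ++-cong {u} {u'} {v} {v'} p q = ≈-trans (++-congʳ v p) (++-congˡ u' q)

    step : ∀ {u v} → Step M u v → u ≈ v
    step p = Eq.map (λ z → z) (inj p)
      where
      open import Relation.Binary.Construct.Closure.ReflexiveTransitive using (ε; _◅_)
      open import Relation.Binary.Construct.Closure.Symmetric using (fwd)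
      inj : ∀ {u v} → Step M u v → Eq.EqClosure (Step M) u v
      inj p = fwd p ◅ ε

    ss≈ : ∀ s v → s ∷ s ∷ v ≈ v
    ss≈ s v = step (cancel [] v s)

    braid≈ : ∀ s t → alt s t (m M s t) ≈ alt t s (m M s t)
    braid≈ s t = subst₂ _≈_ (++-identityʳ _) (++-identityʳ _) (step (braid [] [] s t))

    inverseʳ : ∀ w → w ++ reverse w ≈ []
    inverseʳ [] = ≈-refl
    inverseʳ (s ∷ w) = begin
      s ∷ w ++ reverse (s ∷ w)       ≡⟨ cong (λ z → s ∷ w ++ z) (unfold-reverse s w) ⟩
      s ∷ w ++ reverse w ++ [ s ]    ≡⟨ cong (s ∷_) (sym (++-assoc w (reverse w) [ s ])) ⟩
      s ∷ (w ++ reverse w) ++ [ s ]  ∼⟨ ++-congˡ [ s ] (++-congʳ [ s ] (inverseʳ w)) ⟩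
      s ∷ [ s ]                      ∼⟨ ss≈ s [] ⟩
      []                             ∎
      where open ≈-Reasoning

    inverseˡ : ∀ w → reverse w ++ w ≈ []
    inverseˡ w = subst (λ z → reverse w ++ z ≈ []) (reverse-involutive w) (inverseʳ (reverse w))

    cancelˡ : ∀ w x → reverse w ++ w ++ x ≈ x
    cancelˡ w x = subst (_≈ x) (++-assoc (reverse w) w x) (++-congʳ x (inverseˡ w))

    cancelʳ : ∀ w x → w ++ reverse w ++ x ≈ x
    cancelʳ w x = subst (_≈ x) (++-assoc w (reverse w) x) (++-congʳ x (inverseʳ w))

    snoc² : ∀ w s → (w ++ [ s ]) ++ [ s ] ≈ w
    snoc² w s = begin
      (w ++ [ s ]) ++ [ s ]  ≡⟨ ++-assoc w [ s ] [ s ] ⟩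
      w ++ s ∷ [ s ]         ∼⟨ ++-congˡ w (ss≈ s []) ⟩
      w ++ []                ≡⟨ ++-identityʳ w ⟩
      w                      ∎
      where open ≈-Reasoning

    snoc-swap : ∀ {u v s} → u ++ [ s ] ≈ v → u ≈ v ++ [ s ]
    snoc-swap {u} {v} {s} p = ≈-trans (≈-sym (snoc² u s)) (++-congʳ [ s ] p)

    reverse-cong : ∀ {u v} → u ≈ v → reverse u ≈ reverse v
    reverse-cong {u} {v} p = begin
      reverse u                      ≡⟨ ++-identityʳ (reverse u) ⟨
      reverse u ++ []                ∼⟨ ++-congˡ (reverse u) (inverseʳ v) ⟨
      reverse u ++ v ++ reverse v    ∼⟨ ++-congˡ (reverse u) (++-congʳ (reverse v) p) ⟨
      reverse u ++ u ++ reverse v    ∼⟨ cancelˡ u (reverse v) ⟩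
      reverse v                      ∎
      where open ≈-Reasoning

    conj : Word n → Word n → Word n
    conj [] t = t
    conj (s ∷ u) t = conj u (s ∷ t ++ [ s ])

    conj-≡ : ∀ u t → conj u t ≡ reverse u ++ t ++ u
    conj-≡ [] t = sym (++-identityʳ t)
    conj-≡ (s ∷ u) t = begin
      conj u (s ∷ t ++ [ s ])               ≡⟨ conj-≡ u _ ⟩
      reverse u ++ s ∷ (t ++ [ s ]) ++ u    ≡⟨ cong (λ z → reverse u ++ s ∷ z) (++-assoc t [ s ] u) ⟩
      reverse u ++ s ∷ t ++ s ∷ u           ≡⟨ ++-assoc (reverse u) [ s ] _ ⟨
      (reverse u ++ [ s ]) ++ t ++ s ∷ u    ≡⟨ cong (_++ (t ++ s ∷ u)) (unfold-reverse s u) ⟨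
      reverse (s ∷ u) ++ t ++ s ∷ u         ∎
      where open ≡-Reasoning

    conj-≈ˡ : ∀ {u v} t → u ≈ v → conj u t ≈ conj v t
    conj-≈ˡ {u} {v} t p = subst₂ _≈_ (sym (conj-≡ u t)) (sym (conj-≡ v t)) (++-cong (reverse-cong p) (++-congˡ t p))

    ρ : Word n → Fin n → Word n
    ρ u a = u ++ a ∷ reverse u

    conj-ρ : ∀ u a → conj u (ρ u a) ≈ [ a ]
    conj-ρ u a = begin
      conj u (ρ u a)                         ≡⟨ conj-≡ u _ ⟩
      reverse u ++ (u ++ a ∷ reverse u) ++ u  ≡⟨ cong (reverse u ++_) (++-assoc u _ u) ⟩
      reverse u ++ u ++ a ∷ reverse u ++ u    ∼⟨ cancelˡ u _ ⟩
      a ∷ reverse u ++ u                      ∼⟨ ++-congˡ [ a ] (inverseˡ u) ⟩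
      [ a ]                                   ∎
      where open ≈-Reasoning

    ρ-cong : ∀ {u v} a → u ≈ v → ρ u a ≈ ρ v a
    ρ-cong a p = ++-cong p (++-congˡ [ a ] (reverse-cong p))

    ρ-++ : ∀ u a → ρ u a ++ u ≈ u ++ [ a ]
    ρ-++ u a = ≈-trans (≈-reflexive (++-assoc u _ u)) (++-congˡ u (++-congˡ [ a ] (inverseˡ u)))

    ρ≈ : ∀ u {a t} → [ a ] ≈ conj u t → ρ u a ≈ t
    ρ≈ u {a} {t} p = begin
      u ++ [ a ] ++ reverse u                        ∼⟨ ++-congˡ u (++-congʳ (reverse u) p) ⟩
      u ++ conj u t ++ reverse u                     ≡⟨ cong (λ z → u ++ z ++ reverse u) (conj-≡ u t) ⟩
      u ++ (reverse u ++ t ++ u) ++ reverse u        ≡⟨ cong (u ++_) (trans (++-assoc (reverse u) _ _) (cong (reverse u ++_) (++-assoc t u _))) ⟩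
      u ++ reverse u ++ t ++ u ++ reverse u          ∼⟨ cancelʳ u _ ⟩
      t ++ u ++ reverse u                            ∼⟨ ++-congˡ t (inverseʳ u) ⟩
      t ++ []                                        ≡⟨ ++-identityʳ t ⟩
      t                                              ∎
      where open ≈-Reasoning

    ρ-∷ : ∀ s u a → ρ (s ∷ u) a ≡ s ∷ ρ u a ++ [ s ]
    ρ-∷ s u a = cong (s ∷_) (trans (cong (λ z → u ++ a ∷ z) (unfold-reverse s u)) (sym (++-assoc u _ [ s ])))

    sts-inv : ∀ s t → s ∷ (s ∷ t ++ [ s ]) ++ [ s ] ≈ t
    sts-inv s t = ≈-trans (ss≈ s _) (snoc² t s)

    conj-move : ∀ s {t t'} → s ∷ t ++ [ s ] ≈ t' → t ≈ s ∷ t' ++ [ s ]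
    conj-move s {t} p = ≈-trans (≈-sym (sts-inv s t)) (++-congˡ [ s ] (++-congʳ [ s ] p))

    alt-snoc-odd : ∀ (s t : Fin n) k → alt s t (suc (k + k)) ≡ alt s t (k + k) ++ [ s ]
    alt-snoc-odd s t zero = refl
    alt-snoc-odd s t (suc k) rewrite +-suc k k = cong (λ z → s ∷ t ∷ z) (alt-snoc-odd s t k)

    alt-snoc-even : ∀ (s t : Fin n) k → alt s t (suc (suc (k + k))) ≡ alt s t (suc (k + k)) ++ [ t ]
    alt-snoc-even s t zero = refl
    alt-snoc-even s t (suc k) rewrite +-suc k k = cong (λ z → s ∷ t ∷ z) (alt-snoc-even s t k)

    alt-double : ∀ (s t : Fin n) k → alt s t (k + k) ≡ alt s t k ++ reverse (alt t s k)
    alt-double s t zero = refl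
    alt-double s t (suc k) rewrite +-suc k k = begin
      s ∷ alt t s (suc (k + k))                            ≡⟨ cong (s ∷_) (alt-snoc-odd t s k) ⟩
      s ∷ alt t s (k + k) ++ [ t ]                         ≡⟨ cong (λ z → s ∷ z ++ [ t ]) (alt-double t s k) ⟩
      s ∷ (alt t s k ++ reverse (alt s t k)) ++ [ t ]      ≡⟨ cong (s ∷_) (++-assoc (alt t s k) _ _) ⟩
      s ∷ alt t s k ++ reverse (alt s t k) ++ [ t ]        ≡⟨ cong (λ z → s ∷ alt t s k ++ z) (unfold-reverse t (alt s t k)) ⟨
      s ∷ alt t s k ++ reverse (t ∷ alt s t k)             ∎
      where open ≡-Reasoning

    alt-double-+ : ∀ (s t : Fin n) k j → alt s t ((k + k) + j) ≡ alt s t (k + k) ++ alt s t j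
    alt-double-+ s t zero j = refl
    alt-double-+ s t (suc k) j rewrite +-suc k k = cong (λ z → s ∷ t ∷ z) (alt-double-+ s t k j)

    alt-2m≈[] : ∀ s t → alt s t (m M s t + m M s t) ≈ []
    alt-2m≈[] s t = begin
      alt s t (k + k)                   ≡⟨ alt-double s t k ⟩
      alt s t k ++ reverse (alt t s k)  ∼⟨ ++-congʳ _ (braid≈ s t) ⟩
      alt t s k ++ reverse (alt t s k)  ∼⟨ inverseʳ (alt t s k) ⟩
      []                                ∎
      where
      open ≈-Reasoning
      k = m M s t

  -- Parity of inversions, strong exchange and the longest element

  xorsum : (ℕ → Bool) → ℕ → Bool
  xorsum f zero = false
  xorsum f (suc k) = f 0 xor xorsum (λ i → f (suc i)) k

  xorsum-cong : ∀ {f g} → (∀ i → f i ≡ g i) → ∀ k → xorsum f k ≡ xorsum g k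
  xorsum-cong p zero = refl
  xorsum-cong p (suc k) = cong₂ _xor_ (p 0) (xorsum-cong (λ i → p (suc i)) k)

  xorsum-+ : ∀ f j k → xorsum f (j + k) ≡ xorsum f j xor xorsum (λ i → f (j + i)) k
  xorsum-+ f zero k = refl
  xorsum-+ f (suc j) k = trans (cong (f 0 xor_) (xorsum-+ (λ i → f (suc i)) j k)) (sym (xor-assoc (f 0) _ _))

  xor-cancelʳ : ∀ a b {c} → a xor c ≡ b xor c → a ≡ b
  xor-cancelʳ false false p = refl
  xor-cancelʳ true true p = refl
  xor-cancelʳ false true {false} ()
  xor-cancelʳ false true {true} ()
  xor-cancelʳ true false {false} ()
  xor-cancelʳ true false {true} ()

  module Inversions {n : ℕ} (M : CoxeterMatrix n) (_≈?_ : ∀ u v → Dec (u ≈⟨ M ⟩ v)) where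
    open Words M

    -- the parity of the number of occurrences of t among the reflections s₁ ⋯ sᵢ ⋯ s₁ of the word u = s₁ ⋯ sₖ
    η : Word n → Word n → Bool
    η [] t = false
    η (s ∷ u) t = does ([ s ] ≈? t) xor η u (s ∷ t ++ [ s ])

    ≈?-⇔ : ∀ {u v u' v'} → (u ≈ v → u' ≈ v') → (u' ≈ v' → u ≈ v) → does (u ≈? v) ≡ does (u' ≈? v')
    ≈?-⇔ {u} {v} {u'} {v'} f g = does-⇔ (mk⇔ f g) (u ≈? v) (u' ≈? v')

    ≈?-true : ∀ {u v} → u ≈ v → does (u ≈? v) ≡ true
    ≈?-true {u} {v} = dec-true (u ≈? v)

    ≈?-false : ∀ {u v} → ¬ u ≈ v → does (u ≈? v) ≡ false
    ≈?-false {u} {v} = dec-false (u ≈? v)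

    η-congʳ : ∀ u {t t'} → t ≈ t' → η u t ≡ η u t'
    η-congʳ [] p = refl
    η-congʳ (s ∷ u) p = cong₂ _xor_ (≈?-⇔ (λ q → ≈-trans q p) (λ q → ≈-trans q (≈-sym p)))
      (η-congʳ u (++-congˡ [ s ] (++-congʳ [ s ] p)))

    η-++ : ∀ u v t → η (u ++ v) t ≡ η u t xor η v (conj u t)
    η-++ [] v t = refl
    η-++ (s ∷ u) v t = trans (cong (does ([ s ] ≈? t) xor_) (η-++ u v _)) (sym (xor-assoc (does ([ s ] ≈? t)) _ _))

    η-cancel : ∀ s v t → η (s ∷ s ∷ v) t ≡ η v t
    η-cancel s v t = begin
      b xor (does ([ s ] ≈? (s ∷ t ++ [ s ])) xor η v _)  ≡⟨ cong₂ (λ x y → b xor (x xor y)) same (η-congʳ v (sts-inv s t)) ⟩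
      b xor (b xor η v t)                                  ≡⟨ xor-assoc b b _ ⟨
      (b xor b) xor η v t                                  ≡⟨ cong (_xor η v t) (xor-same b) ⟩
      η v t                                                ∎
      where
      open ≡-Reasoning
      b = does ([ s ] ≈? t)
      same : does ([ s ] ≈? (s ∷ t ++ [ s ])) ≡ b
      same = ≈?-⇔ (λ q → ≈-trans (≈-sym (ss≈ s [ s ])) (≈-sym (≈-trans (conj-move s (≈-sym q)) ≈-refl)))
                  (λ q → ≈-trans (≈-sym (ss≈ s [ s ])) (++-congˡ [ s ] (++-congʳ [ s ] q)))

    η-inverse : ∀ w t → η (w ++ reverse w) t ≡ false
    η-inverse [] t = refl
    η-inverse (s ∷ w) t = begin
      η (s ∷ w ++ reverse (s ∷ w)) t
        ≡⟨ cong (λ z → η (s ∷ w ++ z) t) (unfold-reverse s w) ⟩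
      η (s ∷ w ++ reverse w ++ [ s ]) t
        ≡⟨ cong (λ z → η (s ∷ z) t) (++-assoc w (reverse w) [ s ]) ⟨
      η (s ∷ (w ++ reverse w) ++ [ s ]) t
        ≡⟨ cong (does ([ s ] ≈? t) xor_) (η-++ (w ++ reverse w) [ s ] t') ⟩
      does ([ s ] ≈? t) xor (η (w ++ reverse w) t' xor η [ s ] (conj (w ++ reverse w) t'))
        ≡⟨ cong₂ (λ x y → does ([ s ] ≈? t) xor (x xor y)) (η-inverse w t') (η-congʳ [ s ] (conj-≈ˡ t' (inverseʳ w))) ⟩
      η (s ∷ s ∷ []) t
        ≡⟨ η-cancel s [] t ⟩
      false ∎
      where
      open ≡-Reasoning
      t' = s ∷ t ++ [ s ]

    -- The reflections of an alternating word are odd alternating palindromes; conjugating one by a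
    -- new first letter lengthens it by two, which shifts the index.
    η-alt : ∀ s t k τ → η (alt s t k) τ ≡ xorsum (λ i → does (alt s t (suc (i + i)) ≈? τ)) k
    η-alt s t zero τ = refl
    η-alt s t (suc k) τ = cong (does ([ s ] ≈? τ) xor_) (trans (η-alt t s k _) (xorsum-cong same k))
      where
      word : ∀ i → s ∷ alt t s (suc (i + i)) ++ [ s ] ≡ alt s t (suc (suc i + suc i))
      word i rewrite +-suc i i = cong (s ∷_) (sym (alt-snoc-even t s i))
      same : ∀ i → does (alt t s (suc (i + i)) ≈? (s ∷ τ ++ [ s ])) ≡ does (alt s t (suc (suc i + suc i)) ≈? τ)
      same i = ≈?-⇔ (λ q → subst (_≈ τ) (word i) (≈-sym (conj-move s (≈-sym q))))
                    (λ q → conj-move s (subst (_≈ τ) (sym (word i)) q))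

    -- The reflections of the closed path alt s t (2m) run twice through the same m reflections.
    η-alt-2m : ∀ s t τ → η (alt s t (m M s t + m M s t)) τ ≡ false
    η-alt-2m s t τ = begin
      η (alt s t (k + k)) τ                       ≡⟨ η-alt s t (k + k) τ ⟩
      xorsum f (k + k)                            ≡⟨ xorsum-+ f k k ⟩
      xorsum f k xor xorsum (λ i → f (k + i)) k   ≡⟨ cong (xorsum f k xor_) (xorsum-cong periodic k) ⟩
      xorsum f k xor xorsum f k                   ≡⟨ xor-same (xorsum f k) ⟩
      false                                       ∎
      where
      open ≡-Reasoning
      k = m M s t
      f : ℕ → Bool
      f i = does (alt s t (suc (i + i)) ≈? τ)
      index : ∀ i → suc ((k + i) + (k + i)) ≡ (k + k) + suc (i + i)
      index i = trans (cong suc (trans (ℕₚ.+-assoc k i (k + i))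
        (trans (cong (k +_) (trans (sym (ℕₚ.+-assoc i k i)) (trans (cong (_+ i) (+-comm i k)) (ℕₚ.+-assoc k i i)))) (sym (ℕₚ.+-assoc k k (i + i)))))) (sym (+-suc (k + k) (i + i)))
      shift : ∀ i → alt s t (suc ((k + i) + (k + i))) ≈ alt s t (suc (i + i))
      shift i = ≈-trans (≈-reflexive (trans (cong (alt s t) (index i)) (alt-double-+ s t k (suc (i + i)))))
                        (++-congʳ _ (alt-2m≈[] s t))
      periodic : ∀ i → f (k + i) ≡ f i
      periodic i = ≈?-⇔ (≈-trans (≈-sym (shift i))) (≈-trans (shift i))

    -- Appending the inverse of `alt t s m` turns both sides into words with even counts: the
    -- alternating word of length 2m, and a word followed by its inverse. The tail contributes the
    -- same parity to both and cancels.
    η-braid : ∀ s t τ → η (alt s t (m M s t)) τ ≡ η (alt t s (m M s t)) τ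
    η-braid s t τ = xor-cancelʳ (η a τ) (η b τ) (trans one (sym two))
      where
      k = m M s t
      a = alt s t k
      b = alt t s k
      c = η (reverse b) (conj b τ)
      one : η a τ xor c ≡ false
      one = trans (cong (η a τ xor_) (η-congʳ (reverse b) (conj-≈ˡ τ (≈-sym (braid≈ s t)))))
           (trans (sym (η-++ a (reverse b) τ)) (trans (cong (λ z → η z τ) (sym (alt-double s t k))) (η-alt-2m s t τ)))
      two : η b τ xor c ≡ false
      two = trans (sym (η-++ b (reverse b) τ)) (η-inverse b τ)

    η-step : ∀ {u v} → Step M u v → ∀ t → η u t ≡ η v t
    η-step (cancel u v s) t = trans (η-++ u _ t) (trans (cong (η u t xor_) (η-cancel s v _)) (sym (η-++ u v t)))
    η-step (braid u v s t) τ = begin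
      η (u ++ a ++ v) τ                                       ≡⟨ split a ⟩
      η u τ xor (η a τ' xor η v (conj a τ'))                  ≡⟨ cong (η u τ xor_) (cong₂ _xor_ (η-braid s t τ') (η-congʳ v (conj-≈ˡ τ' (braid≈ s t)))) ⟩
      η u τ xor (η b τ' xor η v (conj b τ'))                  ≡⟨ split b ⟨
      η (u ++ b ++ v) τ                                       ∎
      where
      open ≡-Reasoning
      a = alt s t (m M s t)
      b = alt t s (m M s t)
      τ' = conj u τ
      split : ∀ z → η (u ++ z ++ v) τ ≡ η u τ xor (η z τ' xor η v (conj z τ'))
      split z = trans (η-++ u _ τ) (cong (η u τ xor_) (η-++ z v τ'))

    -- The parity thus depends on the group element alone, so that inversions and descents can be
    -- moved between words for the same element.
    η-congˡ : ∀ {u v} t → u ≈ v → η u t ≡ η v t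
    η-congˡ t = Eq.gfold {S = _≡_} (record { refl = refl ; sym = sym ; trans = trans }) (λ u → η u t) (λ p → η-step p t)

    -- a is a right descent of u when the reflection u a u⁻¹ is an inversion of u
    D : Word n → Fin n → Bool
    D u a = η u (ρ u a)

    D-cong : ∀ {u v} a → u ≈ v → D u a ≡ D v a
    D-cong {u} {v} a p = trans (η-congˡ (ρ u a) p) (η-congʳ v (ρ-cong a p))

    -- Prepending `s` adds one reflection and conjugates the others, so the status of `a` changes
    -- only if `s` is the reflection v a v⁻¹, that is, if s v = v a. The comparison of consecutive
    -- windows rests on this.
    D-∷ : ∀ s v a → D (s ∷ v) a ≡ does ([ s ] ≈? ρ v a) xor D v a
    D-∷ s v a = cong₂ _xor_
      (≈?-⇔ (λ q → ≈-trans (≈-sym (ss≈ s [ s ])) (≈-sym (conj-move s (≈-sym (subst ([ s ] ≈_) (ρ-∷ s v a) q)))))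
            (λ q → subst ([ s ] ≈_) (sym (ρ-∷ s v a)) (≈-trans (≈-sym (ss≈ s [ s ])) (++-congˡ [ s ] (++-congʳ [ s ] q)))))
      (η-congʳ v (subst (λ z → s ∷ z ++ [ s ] ≈ ρ v a) (sym (ρ-∷ s v a)) (sts-inv s (ρ v a))))

    D-snoc : ∀ u a → D (u ++ [ a ]) a ≡ not (D u a)
    D-snoc u a = begin
      η (u ++ [ a ]) (ρ (u ++ [ a ]) a)                    ≡⟨ η-congʳ (u ++ [ a ]) same ⟩
      η (u ++ [ a ]) (ρ u a)                               ≡⟨ η-++ u [ a ] (ρ u a) ⟩
      D u a xor (does ([ a ] ≈? conj u (ρ u a)) xor false) ≡⟨ cong (λ z → D u a xor (z xor false)) (≈?-true (≈-sym (conj-ρ u a))) ⟩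
      D u a xor true                                       ≡⟨ xor-comm (D u a) true ⟩
      not (D u a)                                          ∎
      where
      open ≡-Reasoning
      same : ρ (u ++ [ a ]) a ≈ ρ u a
      same = ≈-trans (≈-reflexive (trans (cong (λ z → (u ++ [ a ]) ++ a ∷ z) (reverse-++ u [ a ])) (++-assoc u [ a ] _)))
                     (++-congˡ u (ss≈ a _))

    -- Odd parity forces `t` to occur among the reflections of `u`; multiplying by `t` deletes the
    -- letter at the first occurrence. This is the strong exchange condition.
    exchange : ∀ u t → η u t ≡ true → ∃ λ u' → length u ≡ suc (length u') × t ++ u ≈ u'
    exchange (s ∷ u) t h with [ s ] ≈? t
    ... | yes p = u , refl , ≈-trans (++-congʳ (s ∷ u) (≈-sym p)) (ss≈ s u)
    ... | no _ with exchange u (s ∷ t ++ [ s ]) h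
    ...   | u' , l , q = s ∷ u' , cong suc l , (begin
        t ++ s ∷ u                   ≡⟨ ++-assoc t [ s ] u ⟨
        (t ++ [ s ]) ++ u            ∼⟨ ss≈ s _ ⟨
        s ∷ s ∷ (t ++ [ s ]) ++ u    ∼⟨ ++-congˡ [ s ] q ⟩
        s ∷ u'                       ∎)
      where open ≈-Reasoning

    descent : ∀ u a → D u a ≡ true → ∃ λ u' → length u ≡ suc (length u') × u ++ [ a ] ≈ u'
    descent u a h with exchange u (ρ u a) h
    ... | u' , l , q = u' , l , ≈-trans (≈-sym (ρ-++ u a)) q

    -- Any word `v` for u a has `a` as a descent, so v a shortens to a word for `u`, and `v` must be
    -- longer than `u`.
    reduced-snoc : ∀ u a → IsReduced M u → D u a ≡ false → IsReduced M (u ++ [ a ])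
    reduced-snoc u a red h v v≈ua = ℕₚ.≮⇒≥ λ lt → ℕₚ.<-irrefl refl (ℕₚ.≤-<-trans (bound lt) ℕₚ.≤-refl)
      where
      dv : D v a ≡ true
      dv = trans (D-cong a v≈ua) (trans (D-snoc u a) (cong not h))
      bound : length v < length (u ++ [ a ]) → length u < length u
      bound lt with descent v a dv
      ... | v' , l , va≈v' = ℕₚ.≤-<-trans (red v' (≈-sym (≈-trans (snoc-swap (≈-sym v≈ua)) va≈v')))
        (ℕₚ.≤-pred (subst₂ _<_ l (trans (length-++ u) (+-comm (length u) 1)) lt))

    reduced⇒D≡false : ∀ u a → IsReduced M (u ++ [ a ]) → D u a ≡ false
    reduced⇒D≡false u a red with D u a in h
    ... | false = refl
    ... | true with descent u a h
    ...   | u' , l , q = ⊥-elim (ℕₚ.<-irrefl refl (ℕₚ.<-≤-trans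
              (s≤s (ℕₚ.n≤1+n (length u'))) (subst (_≤ length u') (trans (length-++ u) (trans (+-comm (length u) 1) (cong suc l))) (red u' (≈-sym q)))))

    reduced-[] : IsReduced M []
    reduced-[] v _ = z≤n

    reduced-prefix : ∀ u v → IsReduced M (u ++ v) → IsReduced M u
    reduced-prefix u v red x x≈u = ℕₚ.+-cancelʳ-≤ (length v) (length u) (length x)
      (subst₂ _≤_ (length-++ u) (length-++ x) (red (x ++ v) (++-congʳ v x≈u)))

    reduced-length : ∀ {u v} → IsReduced M u → IsReduced M v → u ≈ v → length u ≡ length v
    reduced-length ru rv e = ℕₚ.≤-antisym (ru _ (≈-sym e)) (rv _ e)

    reduce-snoc : ∀ y a → IsReduced M y → ∃ λ z → IsReduced M z × z ≈ y ++ [ a ]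
    reduce-snoc y a red with D y a in h
    ... | false = y ++ [ a ] , reduced-snoc y a red h , ≈-refl
    ... | true with descent y a h
    ...   | y' , l , q = y' , red' , ≈-sym q
      where
      red' : IsReduced M y'
      red' v v≈y' = ℕₚ.≤-pred (subst₂ _≤_ l (trans (length-++ v) (+-comm (length v) 1))
        (red (v ++ [ a ]) (≈-sym (snoc-swap (≈-trans q (≈-sym v≈y'))))))

    reduce-++ : ∀ u y → IsReduced M y → ∃ λ z → IsReduced M z × z ≈ y ++ u
    reduce-++ [] y red = y , red , ≈-reflexive (sym (++-identityʳ y))
    reduce-++ (a ∷ u) y red with reduce-snoc y a red
    ... | z , rz , z≈ with reduce-++ u z rz
    ...   | z' , rz' , z'≈ = z' , rz' , ≈-trans z'≈ (≈-trans (++-congʳ u z≈) (≈-reflexive (++-assoc y [ a ] u)))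

    reduce : ∀ u → ∃ λ z → IsReduced M z × z ≈ u
    reduce u = reduce-++ u [] reduced-[]

    -- The palindrome y a y⁻¹ has the reflection itself in the middle, and its two halves contribute
    -- equal parities.
    η-refl-ρ : ∀ y a → η (ρ y a) (ρ y a) ≡ true
    η-refl-ρ y a = begin
      η (y ++ a ∷ reverse y) t
        ≡⟨ η-++ y _ t ⟩
      η y t xor (does ([ a ] ≈? conj y t) xor η (reverse y) (a ∷ conj y t ++ [ a ]))
        ≡⟨ cong₂ (λ p q → η y t xor (p xor q)) (≈?-true (≈-sym (conj-ρ y a)))
            (η-congʳ (reverse y) (≈-trans (++-congˡ [ a ] (++-congʳ [ a ] (conj-ρ y a))) (≈-trans (ss≈ a [ a ]) (≈-sym (conj-ρ y a))))) ⟩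
      η y t xor not (η (reverse y) (conj y t))
        ≡⟨ xor-not (η y t) _ (trans (sym (η-++ y (reverse y) t)) (η-inverse y t)) ⟩
      true ∎
      where
      open ≡-Reasoning
      t = ρ y a
      xor-not : ∀ p q → p xor q ≡ false → p xor not q ≡ true
      xor-not false false _ = refl
      xor-not true true _ = refl

    ρ-self-inverse : ∀ y a x → ρ y a ++ ρ y a ++ x ≈ x
    ρ-self-inverse y a x = begin
      (y ++ a ∷ reverse y) ++ (y ++ a ∷ reverse y) ++ x    ≡⟨ cong ((y ++ a ∷ reverse y) ++_) (++-assoc y _ x) ⟩
      (y ++ a ∷ reverse y) ++ y ++ a ∷ reverse y ++ x      ≡⟨ ++-assoc y _ _ ⟩
      y ++ a ∷ reverse y ++ y ++ a ∷ reverse y ++ x        ∼⟨ ++-congˡ y (++-congˡ [ a ] (cancelˡ y _)) ⟩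
      y ++ a ∷ a ∷ reverse y ++ x                          ∼⟨ ++-congˡ y (ss≈ a _) ⟩
      y ++ reverse y ++ x                                  ∼⟨ cancelʳ y x ⟩
      x                                                    ∎
      where open ≈-Reasoning

    module Longest (w : Word n) (longest : IsLongestWord M w) where

      D-longest : ∀ a → D w a ≡ true
      D-longest a with D w a in h
      ... | true = refl
      ... | false = ⊥-elim (ℕₚ.<-irrefl refl (subst (_≤ length w) (trans (length-++ w) (+-comm (length w) 1))
                      (proj₂ longest _ (reduced-snoc w a (proj₁ longest) h))))

      -- Otherwise the reflection t would be an inversion of t w. Exchange on a reduced word for t w
      -- then yields a word for `w` that is shorter by one, so that reduced word would be longer
      -- than `w`.
      η-longest : ∀ y a → η w (ρ y a) ≡ true
      η-longest y a with η w (ρ y a) in h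
      ... | true = refl
      ... | false with reduce (ρ y a ++ w)
      ...   | z , rz , z≈ with exchange z (ρ y a) (trans (η-congˡ (ρ y a) z≈) (trans (η-++ (ρ y a) w (ρ y a)) both))
        where
        fixed : conj (ρ y a) (ρ y a) ≈ ρ y a
        fixed = ≈-trans (≈-reflexive (conj-≡ (ρ y a) (ρ y a))) (cancelˡ (ρ y a) (ρ y a))
        both : η (ρ y a) (ρ y a) xor η w (conj (ρ y a) (ρ y a)) ≡ true
        both = cong₂ _xor_ (η-refl-ρ y a) (trans (η-congʳ w fixed) h)
      ...     | z' , l , q = ⊥-elim (ℕₚ.<-irrefl refl (ℕₚ.<-≤-trans (s≤s (proj₁ longest z' z'≈w)) (subst (_≤ length w) l (proj₂ longest z rz))))
        where
        z'≈w : z' ≈ w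
        z'≈w = ≈-trans (≈-sym q) (≈-trans (++-congˡ (ρ y a) z≈) (ρ-self-inverse y a w))

      -- Put x = v⁻¹ w. Since v a v⁻¹ is an inversion of both `v` and `w`, the cocycle rule `η-++`
      -- shows that `a` is not an inversion of x, for any `a`. But the first letter of a nonempty
      -- reduced word is an inversion of it, so x = 1.
      all-descents⇒≈ : ∀ v → (∀ a → D v a ≡ true) → v ≈ w
      all-descents⇒≈ v dv with reduce (reverse v ++ w)
      ... | [] , _ , x≈ = ≈-sym (≈-trans (≈-sym (cancelʳ v w)) (≈-trans (++-congˡ v (≈-sym x≈)) (≈-reflexive (++-identityʳ v))))
      ... | a ∷ y , red , x≈ = ⊥-elim (contra (η y (a ∷ [ a ] ++ [ a ])) refl)
        where
        x = reverse v ++ w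
        ηx : η x [ a ] ≡ false
        ηx = solve (trans (sym (η-++ v x (ρ v a))) (trans (η-congˡ (ρ v a) (cancelʳ v w)) (η-longest v a)))
          where
          solve : η v (ρ v a) xor η x (conj v (ρ v a)) ≡ true → η x [ a ] ≡ false
          solve h with trans (sym (cong₂ _xor_ (dv a) (η-congʳ x (conj-ρ v a)))) h
          ... | h' with η x [ a ]
          ...   | false = refl
          solve h | () | true
        contra : ∀ b → η y (a ∷ [ a ] ++ [ a ]) ≡ b → ⊥
        contra false e with trans (sym ηx) (trans (η-congˡ [ a ] (≈-sym x≈)) (cong₂ _xor_ (≈?-true (≈-refl {[ a ]})) e))
        ... | ()
        contra true e with exchange y [ a ] (trans (η-congʳ y (≈-sym (ss≈ a [ a ]))) e)
        ... | y' , l , q = ℕₚ.<-irrefl refl (ℕₚ.<-≤-trans (ℕₚ.≤-trans (s≤s (ℕₚ.n≤1+n _)) (ℕₚ.≤-reflexive (cong suc (sym l)))) (red y' (≈-sym q)))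

      all-descents-≈ : ∀ {v} → v ≈ w → ∀ a → D v a ≡ true
      all-descents-≈ p a = trans (D-cong a p) (D-longest a)

      -- The cocycle rule for w w⁻¹ = 1 turns the inversion `a` of `w` into a descent of w⁻¹, so w⁻¹
      -- has all descents.
      reverse-longest : reverse w ≈ w
      reverse-longest = all-descents⇒≈ (reverse w) λ a → flip-η (D (reverse w) a) (η-longest [] a) (rel a)
        where
        flip-η : ∀ {p} q → p ≡ true → p xor q ≡ false → q ≡ true
        flip-η true refl _ = refl
        rel : ∀ a → η w [ a ] xor D (reverse w) a ≡ false
        rel a = trans (cong (η w [ a ] xor_) (η-congʳ (reverse w)
                  (≈-reflexive (trans (cong (λ z → reverse w ++ a ∷ z) (reverse-involutive w)) (sym (conj-≡ w [ a ]))))))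
                (trans (sym (η-++ w (reverse w) [ a ])) (η-inverse w [ a ]))

    s≉[] : ∀ s → ¬ [ s ] ≈ []
    s≉[] s p with trans (sym (≈?-true (≈-refl {[ s ]}))) (trans (sym (xor-identityʳ _)) (η-congˡ [ s ] p))
    ... | ()

-- Chebyshev polynomials of path adjacency operators: nonnegativity and vanishing

module PathOperators where

  open import Data.Bool using (true; false; if_then_else_)
  open import Data.Nat as ℕ using (ℕ; zero; suc; s≤s; z≤n)
  import Data.Nat.Properties as ℕₚ
  open import Data.Nat.Divisibility as ℕᵈ using (_∣_; _∤_; _∣?_)
  open import Data.Nat.DivMod using (_/_; _%_; m≡m%n+[m/n]*n; m%n<n)
  open import Data.Integer using (ℤ; +_; _+_; _*_; _-_; -_; 0ℤ; 1ℤ; _≤_; +≤+)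
  import Data.Integer.Properties as ℤₚ
  open import Data.Integer.Tactic.RingSolver using (solve-∀)
  open import Data.Product using (_,_; _×_; ∃)
  open import Data.Sum using (inj₁; inj₂)
  open import Relation.Nullary using (does)
  open import Relation.Nullary.Decidable using (dec-true; dec-false)
  open import Relation.Binary.PropositionalEquality using (_≡_; refl; sym; trans; cong; cong₂; subst; module ≡-Reasoning)

  Fun : Set
  Fun = ℕ → ℤ

  infix 4 _≐_
  _≐_ : Fun → Fun → Set
  f ≐ g = ∀ i → f i ≡ g i

  NonNeg : Fun → Set
  NonNeg f = ∀ i → 0ℤ ≤ f i

  0≤-+ : ∀ {x y} → 0ℤ ≤ x → 0ℤ ≤ y → 0ℤ ≤ x + y
  0≤-+ = ℤₚ.+-mono-≤

  0≤-* : ∀ {x y} → 0ℤ ≤ x → 0ℤ ≤ y → 0ℤ ≤ x * y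
  0≤-* {+ x} {+ y} _ _ = subst (0ℤ ≤_) (ℤₚ.pos-* x y) (+≤+ z≤n)

  sum< : ℕ → Fun → ℤ
  sum< zero f = 0ℤ
  sum< (suc d) f = sum< d f + f d

  sum<-cong : ∀ d {f g} → f ≐ g → sum< d f ≡ sum< d g
  sum<-cong zero p = refl
  sum<-cong (suc d) p = cong₂ _+_ (sum<-cong d p) (p d)

  -- Disjoint paths with K vertices each, on the vertex set ℕ; the edge {i , i + 1} is missing when K divides i + 1.
  module Path (K : ℕ) where

    e : ℕ → ℤ
    e i = if does (K ∣? suc i) then 0ℤ else 1ℤ

    e-zero : ∀ {i} → K ∣ suc i → e i ≡ 0ℤ
    e-zero {i} p = cong (λ b → if b then 0ℤ else 1ℤ) (dec-true (K ∣? suc i) p)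

    e-one : ∀ {i} → K ∤ suc i → e i ≡ 1ℤ
    e-one {i} p = cong (λ b → if b then 0ℤ else 1ℤ) (dec-false (K ∣? suc i) p)

    0≤e : ∀ i → 0ℤ ≤ e i
    0≤e i with does (K ∣? suc i)
    ... | true = +≤+ z≤n
    ... | false = +≤+ z≤n

    -- The adjacency operator of the disjoint paths. For K = m - 1 it takes the place of 2cos(π/m).
    X : Fun → Fun
    X f zero = e 0 * f 1
    X f (suc i) = e i * f i + e (suc i) * f (suc (suc i))

    X-cong : ∀ {f g} → f ≐ g → X f ≐ X g
    X-cong p zero = cong (e 0 *_) (p 1)
    X-cong p (suc i) = cong₂ (λ x y → e i * x + e (suc i) * y) (p i) (p (suc (suc i)))

    X-0 : X (λ _ → 0ℤ) ≐ (λ _ → 0ℤ)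
    X-0 zero = ℤₚ.*-zeroʳ (e 0)
    X-0 (suc i) = cong₂ _+_ (ℤₚ.*-zeroʳ (e i)) (ℤₚ.*-zeroʳ (e (suc i)))

    X-+ : ∀ f g → X (λ i → f i + g i) ≐ λ i → X f i + X g i
    X-+ f g zero = ℤₚ.*-distribˡ-+ (e 0) _ _
    X-+ f g (suc i) = lem (e i) (e (suc i)) (f i) (g i) _ _
      where
      lem : ∀ p q a b c d → p * (a + b) + q * (c + d) ≡ (p * a + q * c) + (p * b + q * d)
      lem = solve-∀

    X-neg : ∀ f → X (λ i → - f i) ≐ λ i → - X f i
    X-neg f zero = sym (ℤₚ.neg-distribʳ-* (e 0) _)
    X-neg f (suc i) = lem (e i) (e (suc i)) (f i) _
      where
      lem : ∀ p q a c → p * (- a) + q * (- c) ≡ - (p * a + q * c)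
      lem = solve-∀

    X-- : ∀ f g → X (λ i → f i - g i) ≐ λ i → X f i - X g i
    X-- f g i = trans (X-+ f (λ j → - g j) i) (cong (λ z → X f i + z) (X-neg g i))

    X-nonneg : ∀ {f} → NonNeg f → NonNeg (X f)
    X-nonneg p zero = 0≤-* (0≤e 0) (p 1)
    X-nonneg p (suc i) = 0≤-+ (0≤-* (0≤e i) (p i)) (0≤-* (0≤e (suc i)) (p _))

    -- Chebyshev polynomials of the second kind in X, with U (suc k) of degree k
    U : ℕ → Fun → Fun
    U zero f i = 0ℤ
    U (suc zero) f i = f i
    U (suc (suc k)) f i = X (U (suc k) f) i - U k f i

    U-0 : ∀ k → U k (λ _ → 0ℤ) ≐ λ _ → 0ℤ
    U-0 zero i = refl
    U-0 (suc zero) i = refl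
    U-0 (suc (suc k)) i = cong₂ _-_ (trans (X-cong (U-0 (suc k)) i) (X-0 i)) (U-0 k i)

    U-- : ∀ k f g → U k (λ i → f i - g i) ≐ λ i → U k f i - U k g i
    U-- zero f g i = refl
    U-- (suc zero) f g i = refl
    U-- (suc (suc k)) f g i = trans
      (cong₂ _-_ (trans (X-cong (U-- (suc k) f g) i) (X-- (U (suc k) f) (U (suc k) g) i)) (U-- k f g i))
      (lem (X (U (suc k) f) i) _ _ _)
      where
      lem : ∀ a b c d → (a - b) - (c - d) ≡ (a - c) - (b - d)
      lem = solve-∀

    U-X : ∀ k f → U k (X f) ≐ X (U k f)
    U-X zero f i = sym (X-0 i)
    U-X (suc zero) f i = refl
    U-X (suc (suc k)) f i = trans (cong₂ _-_ (X-cong (U-X (suc k) f) i) (U-X k f i))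
      (sym (X-- (X (U (suc k) f)) (U k f) i))

    U-comm : ∀ a b f → U a (U b f) ≐ U b (U a f)
    U-comm zero b f i = sym (U-0 b i)
    U-comm (suc zero) b f i = refl
    U-comm (suc (suc a)) b f i = sym (begin
      U b (λ j → X (U (suc a) f) j - U a f j) i        ≡⟨ U-- b _ _ i ⟩
      U b (X (U (suc a) f)) i - U b (U a f) i          ≡⟨ cong₂ _-_ (U-X b _ i) (sym (U-comm a b f i)) ⟩
      X (U b (U (suc a) f)) i - U a (U b f) i          ≡⟨ cong (_- U a (U b f) i) (X-cong (λ j → sym (U-comm (suc a) b f j)) i) ⟩
      X (U (suc a) (U b f)) i - U a (U b f) i          ∎)
      where open ≡-Reasoning

    -- One step of the Clebsch-Gordan rule. Unrolled, it writes a product of two `U`s as a sum of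
    -- single ones without any minus sign.
    U-product : ∀ a b f i → U (suc a) (U (suc b) f) i ≡ U a (U b f) i + U (suc (a ℕ.+ b)) f i
    U-product zero b f i = sym (ℤₚ.+-identityˡ _)
    U-product (suc zero) b f i = lem (X (U (suc b) f) i) (U b f i)
      where
      lem : ∀ x y → x - 0ℤ ≡ y + (x - y)
      lem = solve-∀
    U-product (suc (suc a)) b f i = begin
      X (U (suc (suc a)) (U (suc b) f)) i - U (suc a) (U (suc b) f) i
        ≡⟨ cong₂ _-_ (trans (X-cong (U-product (suc a) b f) i) (X-+ (U (suc a) (U b f)) _ i)) (U-product a b f i) ⟩
      (X (U (suc a) (U b f)) i + X (U (suc (suc (a ℕ.+ b))) f) i) - (U a (U b f) i + U (suc (a ℕ.+ b)) f i)
        ≡⟨ lem (X (U (suc a) (U b f)) i) _ _ _ ⟩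
      (X (U (suc a) (U b f)) i - U a (U b f) i) + (X (U (suc (suc (a ℕ.+ b))) f) i - U (suc (a ℕ.+ b)) f i) ∎
      where
      open ≡-Reasoning
      lem : ∀ a b c d → (a + b) - (c + d) ≡ (a - c) + (b - d)
      lem = solve-∀

    -- Summation by edges: every edge inside the range contributes symmetrically, and the edge
    -- leaving the range leaves a boundary term.
    X-pairing : ∀ d (f g : Fun) → sum< (suc d) (λ i → X f i * g i)
      ≡ sum< d (λ i → e i * (f (suc i) * g i + f i * g (suc i))) + e d * (f (suc d) * g d)
    X-pairing zero f g = lem (e 0) (f 1) (g 0)
      where
      lem : ∀ p a b → 0ℤ + p * a * b ≡ 0ℤ + p * (a * b)
      lem = solve-∀
    X-pairing (suc d) f g = trans (cong (_+ X f (suc d) * g (suc d)) (X-pairing d f g))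
      (lem (sum< d _) (e d) (e (suc d)) (f d) (f (suc d)) (f (suc (suc d))) (g d) (g (suc d)))
      where
      lem : ∀ s p q a b c x y → (s + p * (b * x)) + (p * a + q * c) * y ≡ (s + p * (b * x + a * y)) + q * (c * y)
      lem = solve-∀

    -- When K divides d the edge leaving the range is missing, so only the symmetric part of
    -- `X-pairing` remains.
    X-selfadjoint : ∀ d → K ∣ d → ∀ f g → sum< d (λ i → X f i * g i) ≡ sum< d (λ i → f i * X g i)
    X-selfadjoint zero _ f g = refl
    X-selfadjoint (suc d) K∣ f g = begin
      sum< (suc d) (λ i → X f i * g i)                                       ≡⟨ X-pairing d f g ⟩
      sum< d (edge f g) + e d * (f (suc d) * g d)                            ≡⟨ cong₂ _+_ (sum<-cong d swap) (end f g) ⟩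
      sum< d (edge g f) + 0ℤ                                                 ≡⟨ cong (λ z → sum< d (edge g f) + z) (sym (end g f)) ⟩
      sum< d (edge g f) + e d * (g (suc d) * f d)                            ≡⟨ X-pairing d g f ⟨
      sum< (suc d) (λ i → X g i * f i)                                       ≡⟨ sum<-cong (suc d) (λ i → ℤₚ.*-comm (X g i) (f i)) ⟩
      sum< (suc d) (λ i → f i * X g i)                                       ∎
      where
      open ≡-Reasoning
      edge : Fun → Fun → Fun
      edge f g i = e i * (f (suc i) * g i + f i * g (suc i))
      swap : edge f g ≐ edge g f
      swap i = lem (e i) (f i) (f (suc i)) (g i) (g (suc i))
        where
        lem : ∀ p a b c d → p * (b * c + a * d) ≡ p * (d * a + c * b)
        lem = solve-∀
      end : ∀ f g → e d * (f (suc d) * g d) ≡ 0ℤ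
      end f g rewrite e-zero K∣ = refl

  module Block (K' B : ℕ) (K∣B : suc K' ∣ B) where
    K : ℕ
    K = suc K'
    open Path K

    -- The last vertex of the path that starts at `B`.
    C : ℕ
    C = B ℕ.+ K'

    inside : ∀ {j} → B ℕ.< j → j ℕ.< B ℕ.+ K → K ∤ j
    inside {j} B<j j<B+K K∣j with j ℕ.∸ B in eq
    ... | zero = ℕₚ.<⇒≱ B<j (ℕₚ.m∸n≡0⇒m≤n eq)
    ... | suc d = ℕᵈ.>⇒∤ (subst (ℕ._< K) eq (ℕₚ.+-cancelˡ-< B _ _ (subst (ℕ._< B ℕ.+ K) (sym (ℕₚ.m+[n∸m]≡n (ℕₚ.<⇒≤ B<j))) j<B+K)))
                   (ℕᵈ.∣m+n∣m⇒∣n (subst (K ∣_) (sym (trans (cong (B ℕ.+_) (sym eq)) (ℕₚ.m+[n∸m]≡n (ℕₚ.<⇒≤ B<j)))) K∣j) K∣B)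

    e-inside : ∀ {i} → B ℕ.≤ i → suc i ℕ.< B ℕ.+ K → e i ≡ 1ℤ
    e-inside p q = e-one (inside (s≤s p) q)

    K∣sucC : K ∣ suc C
    K∣sucC = subst (K ∣_) (ℕₚ.+-suc B K') (ℕᵈ.∣m∣n⇒∣m+n K∣B ℕᵈ.∣-refl)

    X-B : ∀ f → X f B ≡ e B * f (suc B)
    X-B f = helper B K∣B
      where
      helper : ∀ b → K ∣ b → X f b ≡ e b * f (suc b)
      helper zero _ = refl
      helper (suc b) p rewrite e-zero p = ℤₚ.+-identityˡ _

    U-shift : ∀ k f i → U (suc (suc k)) f i ≡ U (suc k) (X f) i - U k f i
    U-shift k f i = cong (_- U k f i) (sym (U-X (suc k) f i))

    X-inside : ∀ f i → B ℕ.≤ i → suc i ℕ.< B ℕ.+ K → X f (suc i) ≡ f i + e (suc i) * f (suc (suc i))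
    X-inside f i p q rewrite e-inside p q = cong (_+ e (suc i) * f (suc (suc i))) (ℤₚ.*-identityˡ (f i))

    -- The Chebyshev recursion is the recursion for walking along a path from its end: each `X`
    -- reaches one vertex further and the subtracted term removes the step back.
    left : ∀ r f → r ℕ.< K → U (suc r) f B ≡ f (B ℕ.+ r)
    left zero f _ = cong f (sym (ℕₚ.+-identityʳ B))
    left (suc zero) f lt rewrite ℕₚ.+-comm B 1 = trans (cong (_- 0ℤ) (trans (X-B f)
        (cong (_* f (suc B)) (e-inside ℕₚ.≤-refl (subst (ℕ._< B ℕ.+ K) (ℕₚ.+-comm B 1) (ℕₚ.+-monoʳ-< B lt)))))) (lem (f (suc B)))
      where
      lem : ∀ x → 1ℤ * x - 0ℤ ≡ x
      lem = solve-∀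
    left (suc (suc k)) f lt = begin
      U (suc (suc (suc k))) f B                           ≡⟨ U-shift (suc k) f B ⟩
      U (suc (suc k)) (X f) B - U (suc k) f B             ≡⟨ cong₂ _-_ (left (suc k) (X f) lt₁) (left k f (ℕₚ.<-trans (ℕₚ.n<1+n _) lt₁)) ⟩
      X f (B ℕ.+ suc k) - f (B ℕ.+ k)                     ≡⟨ cong (λ z → X f z - f (B ℕ.+ k)) (ℕₚ.+-suc B k) ⟩
      X f (suc j) - f j                                   ≡⟨ cong (_- f j) (X-inside f j (ℕₚ.m≤m+n B k) (subst (ℕ._< B ℕ.+ K) (ℕₚ.+-suc B k) (ℕₚ.+-monoʳ-< B lt₁))) ⟩
      (f j + e (suc j) * f (suc (suc j))) - f j           ≡⟨ cong (λ z → (f j + z * f (suc (suc j))) - f j) (e-inside (ℕₚ.m≤n⇒m≤1+n (ℕₚ.m≤m+n B k)) (subst (ℕ._< B ℕ.+ K) idx (ℕₚ.+-monoʳ-< B lt))) ⟩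
      (f j + 1ℤ * f (suc (suc j))) - f j                  ≡⟨ lem (f j) (f (suc (suc j))) ⟩
      f (suc (suc j))                                     ≡⟨ cong f (sym idx) ⟩
      f (B ℕ.+ suc (suc k))                               ∎
      where
      open ≡-Reasoning
      j = B ℕ.+ k
      lt₁ : suc k ℕ.< K
      lt₁ = ℕₚ.<-trans (ℕₚ.n<1+n _) lt
      idx : B ℕ.+ suc (suc k) ≡ suc (suc j)
      idx = trans (ℕₚ.+-suc B (suc k)) (cong suc (ℕₚ.+-suc B k))
      lem : ∀ x y → (x + 1ℤ * y) - x ≡ y
      lem = solve-∀

    -- The walk of `left` runs off the path, where the next edge is missing. This is the
    -- Cayley-Hamilton identity of the path, at its first vertex.
    U-end : ∀ f → U (suc K) f B ≡ 0ℤ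
    U-end f = go K' refl
      where
      go : ∀ k → K' ≡ k → U (suc (suc k)) f B ≡ 0ℤ
      go zero eq = trans (cong (_- 0ℤ) (trans (X-B f) (cong (_* f (suc B)) (e-zero (subst (λ z → K ∣ suc z) (trans (cong (B ℕ.+_) eq) (ℕₚ.+-identityʳ B)) K∣sucC))))) refl
      go (suc k) eq = begin
        U (suc (suc (suc k))) f B                           ≡⟨ U-shift (suc k) f B ⟩
        U (suc (suc k)) (X f) B - U (suc k) f B             ≡⟨ cong₂ _-_ (left (suc k) (X f) k<) (left k f (ℕₚ.<-trans (ℕₚ.n<1+n _) k<)) ⟩
        X f (B ℕ.+ suc k) - f (B ℕ.+ k)                     ≡⟨ cong (λ z → X f z - f (B ℕ.+ k)) (ℕₚ.+-suc B k) ⟩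
        X f (suc j) - f j                                   ≡⟨ cong (_- f j) (X-inside f j (ℕₚ.m≤m+n B k) (subst (ℕ._< B ℕ.+ K) (ℕₚ.+-suc B k) (ℕₚ.+-monoʳ-< B k<))) ⟩
        (f j + e (suc j) * f (suc (suc j))) - f j           ≡⟨ cong (λ z → (f j + z * f (suc (suc j))) - f j) (e-zero (subst (λ z → K ∣ suc z) (trans (cong (B ℕ.+_) eq) (ℕₚ.+-suc B k)) K∣sucC)) ⟩
        (f j + 0ℤ * f (suc (suc j))) - f j                  ≡⟨ lem (f j) (f (suc (suc j))) ⟩
        0ℤ                                                  ∎
        where
        open ≡-Reasoning
        j = B ℕ.+ k
        k< : suc k ℕ.< K
        k< = subst (λ z → suc k ℕ.< suc z) (sym eq) ℕₚ.≤-refl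
        lem : ∀ x y → (x + 0ℤ * y) - x ≡ 0ℤ
        lem = solve-∀

    right : ∀ d i f → i ℕ.+ d ≡ C → B ℕ.≤ i → U (suc d) f C ≡ f i
    right zero i f eq B≤i = cong f (sym (trans (sym (ℕₚ.+-identityʳ i)) eq))
    right (suc zero) i f eq B≤i = begin
      X f C - 0ℤ                                         ≡⟨ cong (λ z → X f z - 0ℤ) C≡ ⟩
      X f (suc i) - 0ℤ                                   ≡⟨ cong (_- 0ℤ) (X-inside f i B≤i (subst (ℕ._< B ℕ.+ K) C≡ C<)) ⟩
      (f i + e (suc i) * f (suc (suc i))) - 0ℤ           ≡⟨ cong (λ z → (f i + z * f (suc (suc i))) - 0ℤ) (e-zero (subst (λ z → K ∣ suc z) C≡ K∣sucC)) ⟩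
      (f i + 0ℤ * f (suc (suc i))) - 0ℤ                  ≡⟨ lem (f i) (f (suc (suc i))) ⟩
      f i                                                ∎
      where
      open ≡-Reasoning
      C≡ : C ≡ suc i
      C≡ = trans (sym eq) (ℕₚ.+-comm i 1)
      C< : C ℕ.< B ℕ.+ K
      C< = ℕₚ.+-monoʳ-< B ℕₚ.≤-refl
      lem : ∀ x y → (x + 0ℤ * y) - 0ℤ ≡ x
      lem = solve-∀
    right (suc (suc d)) i f eq B≤i = begin
      U (suc (suc (suc d))) f C                                   ≡⟨ U-shift (suc d) f C ⟩
      U (suc (suc d)) (X f) C - U (suc d) f C                     ≡⟨ cong₂ _-_ (right (suc d) (suc i) (X f) (trans (sym (ℕₚ.+-suc i (suc d))) eq) (ℕₚ.m≤n⇒m≤1+n B≤i)) (right d (suc (suc i)) f eq' (ℕₚ.m≤n⇒m≤1+n (ℕₚ.m≤n⇒m≤1+n B≤i))) ⟩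
      X f (suc i) - f (suc (suc i))                               ≡⟨ cong (_- f (suc (suc i))) (X-inside f i B≤i (ℕₚ.<-trans (ℕₚ.n<1+n _) i<)) ⟩
      (f i + e (suc i) * f (suc (suc i))) - f (suc (suc i))       ≡⟨ cong (λ z → (f i + z * f (suc (suc i))) - f (suc (suc i))) (e-inside (ℕₚ.m≤n⇒m≤1+n B≤i) i<) ⟩
      (f i + 1ℤ * f (suc (suc i))) - f (suc (suc i))              ≡⟨ lem (f i) (f (suc (suc i))) ⟩
      f i                                                         ∎
      where
      open ≡-Reasoning
      eq' : suc (suc i) ℕ.+ d ≡ C
      eq' = trans (sym (trans (ℕₚ.+-suc i (suc d)) (cong suc (ℕₚ.+-suc i d)))) eq
      i< : suc (suc i) ℕ.< B ℕ.+ K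
      i< = ℕₚ.≤-<-trans (ℕₚ.m+n≤o⇒m≤o (suc (suc i)) (ℕₚ.≤-reflexive eq')) (ℕₚ.+-monoʳ-< B ℕₚ.≤-refl)
      lem : ∀ x y → (x + 1ℤ * y) - y ≡ x
      lem = solve-∀

    -- By `U-product` the value is a sum of terms `U k f C` with k < a + b. The bound on a + b keeps
    -- each k at most K, where `right` evaluates the term as a value of `f`.
    U-U-nonneg : ∀ a b {f} → NonNeg f → a ℕ.+ b ℕ.≤ suc K → 0ℤ ≤ U a (U b f) C
    U-U-nonneg zero b p le = ℤₚ.≤-refl
    U-U-nonneg (suc a) zero p le = ℤₚ.≤-reflexive (sym (U-0 (suc a) C))
    U-U-nonneg (suc a) (suc b) {f} p le = subst (0ℤ ≤_) (sym (U-product a b f C))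
      (0≤-+ (U-U-nonneg a b p (ℕₚ.≤-trans ab≤ (ℕₚ.≤-trans (ℕₚ.n≤1+n _) (ℕₚ.n≤1+n _))))
        (subst (0ℤ ≤_) (sym (right (a ℕ.+ b) (C ℕ.∸ (a ℕ.+ b)) f (ℕₚ.m∸n+n≡m (ℕₚ.≤-trans ab≤ (ℕₚ.m≤n+m K' B)))
          (subst (B ℕ.≤_) (sym (ℕₚ.+-∸-assoc B ab≤)) (ℕₚ.m≤m+n B _)))) (p _)))
      where
      ab≤ : a ℕ.+ b ℕ.≤ K'
      ab≤ = ℕₚ.≤-pred (ℕₚ.≤-pred (subst (ℕ._≤ suc K) (ℕₚ.+-suc (suc a) b) le))

    -- `right` rewrites evaluation at B + r as a further `U (K' - r + 1)` evaluated at `C`; k ≤ r +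
    -- 1 is exactly the condition under which `U-U-nonneg` applies.
    U-nonneg-near : ∀ k r {f} → NonNeg f → r ℕ.≤ K' → k ℕ.≤ suc r → 0ℤ ≤ U k f (B ℕ.+ r)
    U-nonneg-near k r {f} p r≤ k≤ = subst (0ℤ ≤_) (right (K' ℕ.∸ r) (B ℕ.+ r) (U k f) (trans (ℕₚ.+-assoc B r _) (cong (B ℕ.+_) (ℕₚ.m+[n∸m]≡n r≤))) (ℕₚ.m≤m+n B r))
      (U-U-nonneg (suc (K' ℕ.∸ r)) k p (ℕₚ.≤-trans (ℕₚ.+-monoʳ-≤ (suc (K' ℕ.∸ r)) k≤) (ℕₚ.≤-reflexive (trans (ℕₚ.+-suc (suc (K' ℕ.∸ r)) r) (cong (λ z → suc (suc z)) (ℕₚ.m∸n+n≡m r≤))))))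

    -- U k f (B + r) is symmetric in k and r + 1, so that U-nonneg-near suffices.
    U-nonneg-block : ∀ k r {f} → NonNeg f → r ℕ.≤ K' → k ℕ.≤ K → 0ℤ ≤ U k f (B ℕ.+ r)
    U-nonneg-block k r {f} p r≤ k≤ with ℕₚ.≤-total k (suc r)
    ... | inj₁ k≤r = U-nonneg-near k r p r≤ k≤r
    U-nonneg-block (suc k) r {f} p r≤ k≤ | inj₂ r≤k = subst (0ℤ ≤_) eq (U-nonneg-near (suc r) k p (ℕₚ.≤-pred k≤) r≤k)
      where
      eq : U (suc r) f (B ℕ.+ k) ≡ U (suc k) f (B ℕ.+ r)
      eq = trans (sym (left k (U (suc r) f) k≤)) (trans (U-comm (suc k) (suc r) f B) (left r (U (suc k) f) (s≤s r≤)))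

    -- `left` moves the evaluation to `B` at the cost of a factor `U (r + 1)`, which commutes past
    -- `U (K + 1)`; then `U-end` applies.
    U-vanish-block : ∀ r f → r ℕ.≤ K' → U (suc K) f (B ℕ.+ r) ≡ 0ℤ
    U-vanish-block r f r≤ = trans (sym (left r (U (suc K) f) (s≤s r≤))) (trans (U-comm (suc r) (suc K) f B) (U-end (U (suc r) f)))

  module _ (K' : ℕ) where
    open Path (suc K')

    private
      block : ∀ i → ∃ λ B → ∃ λ r → suc K' ∣ B × r ℕ.≤ K' × i ≡ B ℕ.+ r
      block i = (i / suc K') ℕ.* suc K' , i % suc K' , ℕᵈ.n∣m*n (i / suc K') , ℕₚ.≤-pred (m%n<n i (suc K'))
              , trans (m≡m%n+[m/n]*n i (suc K')) (ℕₚ.+-comm (i % suc K') _)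

    U-nonneg : ∀ k {f} → NonNeg f → k ℕ.≤ suc (suc K') → NonNeg (U k f)
    U-vanish : ∀ f → U (suc (suc K')) f ≐ λ _ → 0ℤ

    U-nonneg k {f} p k≤ i with block i | ℕₚ.m≤n⇒m<n∨m≡n k≤
    ... | B , r , K∣B , r≤ , refl | inj₁ k< = Block.U-nonneg-block K' B K∣B k r p r≤ (ℕₚ.≤-pred k<)
    ... | _ | inj₂ refl = ℤₚ.≤-reflexive (sym (U-vanish f i))

    U-vanish f i with block i
    ... | B , r , K∣B , r≤ , refl = Block.U-vanish-block K' B K∣B r f r≤

-- The unfolded reflection representation over ℤ

module RootSystem where

  open CoxeterWords
  open PathOperators
  open import Data.Bool using (true; false; if_then_else_; not)
  open import Data.Nat as ℕ using (ℕ; zero; suc; s≤s; z≤n)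
  import Data.Nat.Properties as ℕₚ
  open import Data.Nat.Divisibility as ℕᵈ using (_∣_)
  open import Data.Nat.ListAction using (product)
  open import Data.Nat.ListAction.Properties using (∈⇒∣product; product≢0)
  open import Data.Integer using (ℤ; _+_; _*_; _-_; -_; 0ℤ; 1ℤ; -1ℤ; _≤_; +≤+)
  import Data.Integer.Properties as ℤₚ
  open import Data.Integer.Tactic.RingSolver using (solve-∀)
  open import Data.Fin using (Fin)
  open import Data.Fin.Properties using (_≟_)
  open import Data.List using (List; []; _∷_; _++_; [_]; length; reverse; allFin; cartesianProductWith; initLast; _∷ʳ′_)
  open import Data.List.Properties using (++-assoc; reverse-++; unfold-reverse; reverse-involutive; length-++; length-reverse)
  open import Data.List.Membership.Propositional using (_∈_; _∉_)
  open import Data.List.Membership.Propositional.Properties using (∈-allFin; ∈-cartesianProductWith⁺)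
  open import Data.List.Relation.Unary.Any using (here; there)
  open import Data.List.Relation.Unary.All as All using (All; []; _∷_)
  open import Data.List.Relation.Unary.AllPairs using ([]; _∷_)
  open import Data.List.Relation.Unary.Unique.Propositional using (Unique)
  open import Data.List.Relation.Unary.Unique.Propositional.Properties using (allFin⁺)
  open import Data.List.Relation.Binary.Permutation.Propositional as Perm using (_↭_)
  open import Data.Product using (_,_)
  open import Data.Sum using (inj₁; inj₂)
  open import Data.Empty using (⊥-elim)
  open import Function using (_∘_)
  open import Relation.Nullary using (¬_; Dec; yes; no; does)
  open import Relation.Nullary.Decidable using (dec-true; dec-false)
  open import Relation.Binary.PropositionalEquality using (_≡_; _≢_; refl; sym; trans; cong; cong₂; subst; module ≡-Reasoning)
  import Relation.Binary.Construct.Closure.Equivalence as Eq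

  module Representation {n : ℕ} (M : CoxeterMatrix n) where
    open Words M

    -- `v u i` is the coefficient of the i-th simple root over `u`. Infinite support is allowed:
    -- every `X` reads at most two neighbours of an index.
    V : Set
    V = Fin n → Fun

    infix 4 _≗_
    _≗_ : V → V → Set
    v ≗ w = ∀ u → v u ≐ w u

    ≗-refl : ∀ {v} → v ≗ v
    ≗-refl u i = refl

    ≗-sym : ∀ {v w} → v ≗ w → w ≗ v
    ≗-sym p u i = sym (p u i)

    ≗-trans : ∀ {v w x} → v ≗ w → w ≗ x → v ≗ x
    ≗-trans p q u i = trans (p u i) (q u i)

    -- m - 1 off the diagonal; on the diagonal truncated subtraction gives 1, so that X u u vanishes
    size : Fin n → Fin n → ℕ
    size u v = suc (m M u v ℕ.∸ 2)

    X : Fin n → Fin n → Fun → Fun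
    X u v = Path.X (size u v)

    X-cong : ∀ u v {f g} → f ≐ g → X u v f ≐ X u v g
    X-cong u v = Path.X-cong (size u v)

    X-sym : ∀ u v f → X u v f ≐ X v u f
    X-sym u v f i = cong (λ k → Path.X (suc (k ℕ.∸ 2)) f i) (m-sym M u v)

    X-0 : ∀ u v → X u v (λ _ → 0ℤ) ≐ λ _ → 0ℤ
    X-0 u v = Path.X-0 (size u v)

    X-size1 : ∀ u v f → size u v ≡ 1 → X u v f ≐ λ _ → 0ℤ
    X-size1 u v f eq i = trans (cong (λ k → Path.X k f i) eq) (go i)
      where
      go : ∀ i → Path.X 1 f i ≡ 0ℤ
      go zero = cong (_* f 1) (Path.e-zero 1 (ℕᵈ.1∣ 1))
      go (suc i) = cong₂ (λ x y → x * f i + y * f (suc (suc i))) (Path.e-zero 1 (ℕᵈ.1∣ suc i)) (Path.e-zero 1 (ℕᵈ.1∣ suc (suc i)))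

    X-self : ∀ u f → X u u f ≐ λ _ → 0ℤ
    X-self u f = X-size1 u u f (cong (λ k → suc (k ℕ.∸ 2)) (m-diag M u))

    X-commuting : ∀ u v f → ¬ 3 ℕ.≤ m M u v → X u v f ≐ λ _ → 0ℤ
    X-commuting u v f ¬3 = X-size1 u v f (cong suc (ℕₚ.m≤n⇒m∸n≡0 (ℕₚ.≤-pred (ℕₚ.≰⇒> ¬3))))

    lsum : List (Fin n) → V → Fun
    lsum [] h i = 0ℤ
    lsum (u ∷ us) h i = h u i + lsum us h i

    lsum-cong∈ : ∀ us {g h} → (∀ {u} → u ∈ us → g u ≐ h u) → lsum us g ≐ lsum us h
    lsum-cong∈ [] p i = refl
    lsum-cong∈ (u ∷ us) p i = cong₂ _+_ (p (here refl) i) (lsum-cong∈ us (p ∘ there) i)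

    lsum-cong : ∀ us {g h} → g ≗ h → lsum us g ≐ lsum us h
    lsum-cong us p = lsum-cong∈ us (λ {u} _ → p u)

    lsum-0 : ∀ us {h} → (∀ {u} → u ∈ us → h u ≐ λ _ → 0ℤ) → lsum us h ≐ λ _ → 0ℤ
    lsum-0 [] p i = refl
    lsum-0 (u ∷ us) p i = cong₂ _+_ (p (here refl) i) (lsum-0 us (p ∘ there) i)

    lsum-+ : ∀ us g h → lsum us (λ u i → g u i + h u i) ≐ λ i → lsum us g i + lsum us h i
    lsum-+ [] g h i = refl
    lsum-+ (u ∷ us) g h i = trans (cong ((g u i + h u i) +_) (lsum-+ us g h i)) (lem (g u i) (h u i) _ _)
      where
      lem : ∀ a b c d → (a + b) + (c + d) ≡ (a + c) + (b + d)
      lem = solve-∀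

    lsum-++ : ∀ us vs h → lsum (us ++ vs) h ≐ λ i → lsum us h i + lsum vs h i
    lsum-++ [] vs h i = sym (ℤₚ.+-identityˡ _)
    lsum-++ (u ∷ us) vs h i = trans (cong (h u i +_) (lsum-++ us vs h i)) (sym (ℤₚ.+-assoc (h u i) _ _))

    lsum-nonneg : ∀ us {h} → (∀ u → NonNeg (h u)) → NonNeg (lsum us h)
    lsum-nonneg [] p i = ℤₚ.≤-refl
    lsum-nonneg (u ∷ us) p i = 0≤-+ (p u i) (lsum-nonneg us p i)

    lsum-≥ : ∀ us {h t} → (∀ u → NonNeg (h u)) → t ∈ us → ∀ i → h t i ≤ lsum us h i
    lsum-≥ (u ∷ us) {h} p (here refl) i = subst (_≤ h u i + lsum us h i) (ℤₚ.+-identityʳ (h u i)) (ℤₚ.+-monoʳ-≤ (h u i) (lsum-nonneg us p i))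
    lsum-≥ (u ∷ us) {h} {t} p (there t∈) i = subst (_≤ h u i + lsum us h i) (ℤₚ.+-identityˡ (h t i)) (ℤₚ.+-mono-≤ (p u i) (lsum-≥ us p t∈ i))

    lsum-↭ : ∀ {us vs} h → us ↭ vs → lsum us h ≐ lsum vs h
    lsum-↭ h Perm.refl i = refl
    lsum-↭ h (Perm.prep u p) i = cong (h u i +_) (lsum-↭ h p i)
    lsum-↭ h (Perm.swap u v p) i = trans (cong (λ z → h u i + (h v i + z)) (lsum-↭ h p i)) (lem (h u i) (h v i) _)
      where
      lem : ∀ a b c → a + (b + c) ≡ b + (a + c)
      lem = solve-∀
    lsum-↭ h (Perm.trans p q) i = trans (lsum-↭ h p i) (lsum-↭ h q i)

    lsum-single : ∀ {us t} h → Unique us → t ∈ us → (∀ u → u ≢ t → h u ≐ λ _ → 0ℤ) → lsum us h ≐ h t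
    lsum-single {u ∷ us} h (u∉ ∷ _) (here refl) p i =
      trans (cong (h u i +_) (lsum-0 us (λ v∈ → p _ (λ eq → All.lookup u∉ v∈ (sym eq))) i)) (ℤₚ.+-identityʳ _)
    lsum-single {u ∷ us} h (u∉ ∷ uq) (there t∈) p i =
      trans (cong₂ _+_ (p u (All.lookup u∉ t∈) i) (lsum-single h uq t∈ p i)) (ℤₚ.+-identityˡ _)

    -- The contribution of the neighbours to the reflection in `s`; the summand at `s` itself
    -- vanishes by `X-self`.
    κ : Fin n → V → Fun
    κ s v = lsum (allFin n) (λ u → X s u (v u))

    κ-cong : ∀ s {v w} → (∀ u → u ≢ s → v u ≐ w u) → κ s v ≐ κ s w
    κ-cong s {v} {w} p = lsum-cong (allFin n) same
      where
      same : (λ u → X s u (v u)) ≗ (λ u → X s u (w u))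
      same u with u ≟ s
      ... | yes refl = λ i → trans (X-self u (v u) i) (sym (X-self u (w u) i))
      ... | no u≢s = X-cong s u (p u u≢s)

    κ-+ : ∀ s v w → κ s (λ u i → v u i + w u i) ≐ λ i → κ s v i + κ s w i
    κ-+ s v w i = trans (lsum-cong (allFin n) (λ u → Path.X-+ (size s u) (v u) (w u)) i)
      (lsum-+ (allFin n) (λ u → X s u (v u)) (λ u → X s u (w u)) i)

    κ-list : ∀ s c v → (s ∷ c) ↭ allFin n → lsum c (λ u → X s u (v u)) ≐ κ s v
    κ-list s c v p i = trans (sym (trans (cong (_+ lsum c (λ u → X s u (v u)) i) (X-self s (v s) i)) (ℤₚ.+-identityˡ _))) (lsum-↭ (λ u → X s u (v u)) p i)

    α : Fin n → Fun → V
    α s f u i = if does (u ≟ s) then f i else 0ℤ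

    α-same : ∀ s f → α s f s ≐ f
    α-same s f i = cong (λ b → if b then f i else 0ℤ) (dec-true (s ≟ s) refl)

    α-other : ∀ {s u} f → u ≢ s → α s f u ≐ λ _ → 0ℤ
    α-other {s} {u} f p i = cong (λ b → if b then f i else 0ℤ) (dec-false (u ≟ s) p)

    α-cong : ∀ s {f g} → f ≐ g → α s f ≗ α s g
    α-cong s p u i with does (u ≟ s)
    ... | true = p i
    ... | false = refl

    α-neg : ∀ s f → α s (λ i → - f i) ≗ λ u i → - α s f u i
    α-neg s f u i with does (u ≟ s)
    ... | true = refl
    ... | false = refl

    α-nonneg : ∀ s {f} → NonNeg f → ∀ u → NonNeg (α s f u)
    α-nonneg s p u i with does (u ≟ s)
    ... | true = p i
    ... | false = ℤₚ.≤-refl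

    κ-α : ∀ s t f → κ s (α t f) ≐ X s t f
    κ-α s t f i = trans (lsum-single (λ u → X s u (α t f u)) (allFin⁺ n) (∈-allFin t)
        (λ u u≢t j → trans (X-cong s u (α-other f u≢t) j) (X-0 s u j)) i)
      (X-cong s t (α-same t f) i)

    act₁ : Fin n → V → V
    act₁ s v u i = if does (u ≟ s) then - v s i + κ s v i else v u i

    act₁-same : ∀ s v i → act₁ s v s i ≡ - v s i + κ s v i
    act₁-same s v i = cong (λ b → if b then - v s i + κ s v i else v s i) (dec-true (s ≟ s) refl)

    act₁-other : ∀ {s u} v → u ≢ s → act₁ s v u ≐ v u
    act₁-other {s} {u} v p i = cong (λ b → if b then - v s i + κ s v i else v u i) (dec-false (u ≟ s) p)

    act₁-cong : ∀ s {v w} → v ≗ w → act₁ s v ≗ act₁ s w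
    act₁-cong s p u i with does (u ≟ s)
    ... | true = cong₂ (λ x y → - x + y) (p s i) (κ-cong s (λ u _ → p u) i)
    ... | false = p u i

    act₁-+ : ∀ s v w → act₁ s (λ u i → v u i + w u i) ≗ λ u i → act₁ s v u i + act₁ s w u i
    act₁-+ s v w u i with does (u ≟ s)
    ... | true = trans (cong (- (v s i + w s i) +_) (κ-+ s v w i)) (lem (v s i) (w s i) _ _)
      where
      lem : ∀ a b c d → - (a + b) + (c + d) ≡ (- a + c) + (- b + d)
      lem = solve-∀
    ... | false = refl

    κ-neg : ∀ s v → κ s (λ u i → - v u i) ≐ λ i → - κ s v i
    κ-neg s v i = trans (lsum-cong (allFin n) (λ u → Path.X-neg (size s u) (v u)) i) (lsum-neg (allFin n))
      where
      lsum-neg : ∀ us → lsum us (λ u i → - X s u (v u) i) i ≡ - lsum us (λ u → X s u (v u)) i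
      lsum-neg [] = refl
      lsum-neg (u ∷ us) = trans (cong (- X s u (v u) i +_) (lsum-neg us)) (sym (ℤₚ.neg-distrib-+ (X s u (v u) i) _))

    act₁-neg : ∀ s v → act₁ s (λ u i → - v u i) ≗ λ u i → - act₁ s v u i
    act₁-neg s v u i with does (u ≟ s)
    ... | true = trans (cong (- (- v s i) +_) (κ-neg s v i)) (sym (ℤₚ.neg-distrib-+ (- v s i) _))
    ... | false = refl

    act₁-involutive : ∀ s v → act₁ s (act₁ s v) ≗ v
    act₁-involutive s v u i with u ≟ s
    ... | yes refl = trans (cong₂ (λ x y → - x + y) (act₁-same s v i) (κ-cong s (λ u p → act₁-other v p) i)) (lem (v s i) (κ s v i))
      where
      lem : ∀ a b → - (- a + b) + b ≡ a
      lem = solve-∀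
    ... | no _ = refl

    act : Word n → V → V
    act [] v = v
    act (s ∷ w) v = act₁ s (act w v)

    act-cong : ∀ w {v v'} → v ≗ v' → act w v ≗ act w v'
    act-cong [] p = p
    act-cong (s ∷ w) p = act₁-cong s (act-cong w p)

    act-+ : ∀ w v v' → act w (λ u i → v u i + v' u i) ≗ λ u i → act w v u i + act w v' u i
    act-+ [] v v' = ≗-refl
    act-+ (s ∷ w) v v' = ≗-trans (act₁-cong s (act-+ w v v')) (act₁-+ s (act w v) (act w v'))

    act-neg : ∀ w v → act w (λ u i → - v u i) ≗ λ u i → - act w v u i
    act-neg [] v = ≗-refl
    act-neg (s ∷ w) v = ≗-trans (act₁-cong s (act-neg w v)) (act₁-neg s (act w v))

    act-++ : ∀ u w v → act (u ++ w) v ≡ act u (act w v)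
    act-++ [] w v = refl
    act-++ (s ∷ u) w v = cong (act₁ s) (act-++ u w v)

    act-++≗ : ∀ u w v → act (u ++ w) v ≗ act u (act w v)
    act-++≗ u w v u' i = cong (λ z → z u' i) (act-++ u w v)

    act-inverse : ∀ w v → act w (act (reverse w) v) ≗ v
    act-inverse [] v = ≗-refl
    act-inverse (s ∷ w) v = ≗-trans (act₁-cong s (≗-trans (act-cong w eq) (act-inverse w (act₁ s v)))) (act₁-involutive s v)
      where
      eq : act (reverse (s ∷ w)) v ≗ act (reverse w) (act₁ s v)
      eq u i = trans (cong (λ z → act z v u i) (unfold-reverse s w)) (act-++≗ (reverse w) [ s ] v u i)

    act-∉ : ∀ w v {a} → a ∉ w → act w v a ≐ v a
    act-∉ [] v a∉ i = refl
    act-∉ (s ∷ w) v a∉ i = trans (act₁-other (act w v) (λ eq → a∉ (here eq)) i) (act-∉ w v (a∉ ∘ there) i)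

    T : Fin n → Fin n → Fun → Fun → V
    T s t f g u i = α s f u i + α t g u i

    T-cong : ∀ s t {f f' g g'} → f ≐ f' → g ≐ g' → T s t f g ≗ T s t f' g'
    T-cong s t p q u i = cong₂ _+_ (α-cong s p u i) (α-cong t q u i)

    -- On the span of the simple roots over two generators, a reflection is one Chebyshev step: the
    -- pair (f , g) becomes (g , X g - f).
    act₁-T : ∀ {s t} f g → s ≢ t → act₁ s (T s t f g) ≗ T t s g (λ i → X s t g i - f i)
    act₁-T {s} {t} f g s≢t u i with u ≟ s
    ... | yes refl = trans (cong₂ (λ x y → - x + y)
            (cong₂ _+_ (α-same s f i) (α-other g s≢t i))
            (trans (κ-+ s (α s f) (α t g) i) (cong₂ _+_ (trans (κ-α s s f i) (X-self s f i)) (κ-α s t g i))))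
          (trans (lem (f i) (X s t g i)) (sym (cong (_+ (X s t g i - f i)) (α-other g s≢t i))))
      where
      lem : ∀ a b → - (a + 0ℤ) + (0ℤ + b) ≡ 0ℤ + (b - a)
      lem = solve-∀
    ... | no u≢s = trans (ℤₚ.+-identityˡ (α t g u i)) (sym (ℤₚ.+-identityʳ (α t g u i)))

    altLetter : Fin n → Fin n → ℕ → Fin n
    altLetter s t zero = s
    altLetter s t (suc k) = altLetter t s k

    alt-snoc : ∀ s t k → alt s t (suc k) ≡ alt s t k ++ [ altLetter s t k ]
    alt-snoc s t zero = refl
    alt-snoc s t (suc k) = cong (s ∷_) (alt-snoc t s k)

    reverse-alt-suc : ∀ s t k → reverse (alt s t (suc k)) ≡ altLetter s t k ∷ reverse (alt s t k)
    reverse-alt-suc s t k = trans (cong reverse (alt-snoc s t k)) (reverse-++ (alt s t k) [ altLetter s t k ])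

    lt-≢ : ∀ {s t} k → s ≢ t → altLetter s t k ≢ altLetter t s k
    lt-≢ zero p = p
    lt-≢ (suc k) p = lt-≢ k (p ∘ sym)

    module _ (s₀ t₀ : Fin n) where
      private
        U = Path.U (size s₀ t₀)

      -- The two generators swap roles at every letter, whereas `U` refers to a fixed pair and
      -- `X s t` agrees with `X t s` only pointwise. The record carries these agreements through the
      -- swaps.
      record SamePair (s t : Fin n) : Set where
        field
          distinct : s ≢ t
          X-st : ∀ f → X s t f ≐ X s₀ t₀ f
          X-ts : ∀ f → X t s f ≐ X s₀ t₀ f

      swapPair : ∀ {s t} → SamePair s t → SamePair t s
      swapPair p = record { distinct = distinct ∘ sym ; X-st = X-ts ; X-ts = X-st }
        where open SamePair p

      act-alt : ∀ {s t} → SamePair s t → ∀ k j d →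
        act (reverse (alt s t k)) (T s t (U j d) (U (suc j) d)) ≗ T (altLetter s t k) (altLetter t s k) (U (j ℕ.+ k) d) (U (suc (j ℕ.+ k)) d)
      act-alt {s} {t} p zero j d u i = cong (λ z → T s t (U z d) (U (suc z) d) u i) (sym (ℕₚ.+-identityʳ j))
      act-alt {s} {t} p (suc k) j d u i = begin
        act (reverse (s ∷ alt t s k)) (T s t (U j d) (U (suc j) d)) u i
          ≡⟨ cong (λ z → act z (T s t (U j d) (U (suc j) d)) u i) (unfold-reverse s (alt t s k)) ⟩
        act (reverse (alt t s k) ++ [ s ]) (T s t (U j d) (U (suc j) d)) u i
          ≡⟨ act-++≗ (reverse (alt t s k)) [ s ] _ u i ⟩
        act (reverse (alt t s k)) (act₁ s (T s t (U j d) (U (suc j) d))) u i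
          ≡⟨ act-cong (reverse (alt t s k)) (≗-trans (act₁-T (U j d) (U (suc j) d) distinct)
                (T-cong t s (λ _ → refl) (λ i → cong (_- U j d i) (X-st (U (suc j) d) i)))) u i ⟩
        act (reverse (alt t s k)) (T t s (U (suc j) d) (U (suc (suc j)) d)) u i
          ≡⟨ act-alt (swapPair p) k (suc j) d u i ⟩
        T (altLetter t s k) (altLetter s t k) (U (suc j ℕ.+ k) d) (U (suc (suc j ℕ.+ k)) d) u i
          ≡⟨ cong (λ z → T (altLetter t s k) (altLetter s t k) (U z d) (U (suc z) d) u i) (sym (ℕₚ.+-suc j k)) ⟩
        T (altLetter t s k) (altLetter s t k) (U (j ℕ.+ suc k) d) (U (suc (j ℕ.+ suc k)) d) u i ∎
        where
        open ≡-Reasoning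
        open SamePair p

    samePair : ∀ {s t} → s ≢ t → SamePair s t s t
    samePair {s} {t} p = record { distinct = p ; X-st = λ f i → refl ; X-ts = λ f → X-sym t s f }

    size-m : ∀ {s t} → s ≢ t → suc (size s t) ≡ m M s t
    size-m {s} {t} p = ℕₚ.m+[n∸m]≡n (m-off M s t p)

    U-m : ∀ {s t} → s ≢ t → ∀ d → Path.U (size s t) (m M s t) d ≐ λ _ → 0ℤ
    U-m {s} {t} p d i = trans (cong (λ z → Path.U (size s t) z d i) (sym (size-m p))) (U-vanish (m M s t ℕ.∸ 2) d i)

    act₁-shift : ∀ t v → act₁ t v ≗ λ u i → v u i + α t (λ i → (- v t i + κ t v i) - v t i) u i
    act₁-shift t v u i with u ≟ t
    ... | yes refl = lem (v t i) _
      where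
      lem : ∀ a b → b ≡ a + (b - a)
      lem = solve-∀
    ... | no _ = sym (ℤₚ.+-identityʳ (v u i))

    -- Both sides arise from reverse (alt t s (m + 1)), up to the letter applied last.
    braid-off : ∀ {s t} → s ≢ t → ∀ v u → u ≢ altLetter t s (m M s t) →
      act (reverse (alt t s (m M s t))) v u ≐ act (reverse (alt s t (m M s t))) v u
    braid-off {s} {t} p v u u≢ i = begin
      act (reverse (alt t s k)) v u i
        ≡⟨ act₁-other (act (reverse (alt t s k)) v) u≢ i ⟨
      act (altLetter t s k ∷ reverse (alt t s k)) v u i
        ≡⟨ cong (λ z → act z v u i) (reverse-alt-suc t s k) ⟨
      act (reverse (alt t s (suc k))) v u i
        ≡⟨ cong (λ z → act z v u i) (unfold-reverse t (alt s t k)) ⟩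
      act (R ++ [ t ]) v u i
        ≡⟨ act-++≗ R [ t ] v u i ⟩
      act R (act₁ t v) u i
        ≡⟨ ≗-trans (act-cong R (act₁-shift t v)) (act-+ R v (α t d)) u i ⟩
      act R v u i + act R (α t d) u i
        ≡⟨ cong (act R v u i +_) (≗-trans (act-cong R start) (act-alt s t (samePair p) k 0 d) u i) ⟩
      -- After m further letters the correction `α t d` has become a pair of Chebyshev terms. The
      -- first vanishes because it is the m-th one, and the second lives over the one generator that
      -- `u` avoids.
      act R v u i + T (altLetter s t k) (altLetter t s k) (U k d) (U (suc k) d) u i
        ≡⟨ cong (act R v u i +_) (cong₂ _+_ (trans (α-cong (altLetter s t k) (U-m p d) u i) (α-zero (altLetter s t k) u i)) (α-other (U (suc k) d) u≢ i)) ⟩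
      act R v u i + 0ℤ
        ≡⟨ ℤₚ.+-identityʳ _ ⟩
      act R v u i ∎
      where
      open ≡-Reasoning
      k = m M s t
      R = reverse (alt s t k)
      U = Path.U (size s t)
      d : Fun
      d i = (- v t i + κ t v i) - v t i
      α-zero : ∀ x → α x (λ _ → 0ℤ) ≗ λ _ _ → 0ℤ
      α-zero x u i with does (u ≟ x)
      ... | true = refl
      ... | false = refl
      start : α t d ≗ T s t (U 0 d) (U 1 d)
      start u i = sym (trans (cong (_+ α t d u i) (α-zero s u i)) (ℤₚ.+-identityˡ _))

    -- `braid-off` leaves open a single coordinate, and with `s` and `t` exchanged a different one,
    -- so the two instances together cover all coordinates.
    act-braid-reverse : ∀ s t v → act (reverse (alt s t (m M s t))) v ≗ act (reverse (alt t s (m M s t))) v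
    act-braid-reverse s t v u i with s ≟ t
    ... | yes refl = refl
    ... | no s≢t with u ≟ altLetter t s (m M s t)
    ...   | no u≢ = sym (braid-off s≢t v u u≢ i)
    ...   | yes refl = subst (λ k → act (reverse (alt s t k)) v u i ≡ act (reverse (alt t s k)) v u i) (m-sym M t s)
              (braid-off (s≢t ∘ sym) v u (λ eq → lt-≢ (m M s t) (s≢t ∘ sym) (trans eq (cong (altLetter s t) (m-sym M t s)))) i)

    act-braid : ∀ s t v → act (alt s t (m M s t)) v ≗ act (alt t s (m M s t)) v
    act-braid s t v = ≗-trans
      (act-cong a (≗-sym (subst (λ z → act (reverse b) (act z v) ≗ v) (reverse-involutive b) (act-inverse (reverse b) v))))
      (≗-trans (act-cong a (≗-sym (act-braid-reverse s t (act b v)))) (act-inverse a (act b v)))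
      where
      a = alt s t (m M s t)
      b = alt t s (m M s t)

    act-step : ∀ {u w} → Step M u w → ∀ v → act u v ≗ act w v
    act-step (cancel u w s) v = ≗-trans (act-++≗ u _ v) (≗-trans (act-cong u (act₁-involutive s (act w v))) (≗-sym (act-++≗ u w v)))
    act-step (braid u w s t) v = ≗-trans (expand a) (≗-trans (act-cong u (act-braid s t (act w v))) (≗-sym (expand b)))
      where
      a = alt s t (m M s t)
      b = alt t s (m M s t)
      expand : ∀ z → act (u ++ z ++ w) v ≗ act u (act z (act w v))
      expand z = ≗-trans (act-++≗ u (z ++ w) v) (act-cong u (act-++≗ z w v))

    act-≈ : ∀ {u w} → u ≈ w → ∀ v → act u v ≗ act w v
    act-≈ p v = Eq.gfold {S = _≗_} (record { refl = ≗-refl ; sym = ≗-sym ; trans = ≗-trans }) (λ u → act u v) (λ q → act-step q v) p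

    act₁-α-self : ∀ s f → act₁ s (α s f) ≗ α s (λ i → - f i)
    act₁-α-self s f u i with u ≟ s
    ... | yes refl = trans (cong₂ (λ x y → - x + y) (α-same s f i) (trans (κ-α s s f i) (X-self s f i))) (ℤₚ.+-identityʳ _)
    ... | no _ = refl

    act₁-α-commuting : ∀ {s t} f → s ≢ t → ¬ 3 ℕ.≤ m M s t → act₁ s (α t f) ≗ α t f
    act₁-α-commuting {s} {t} f s≢t ¬3 u i with u ≟ s
    ... | yes refl = trans (cong₂ (λ x y → - x + y) (α-other f s≢t i) (trans (κ-α s t f i) (X-commuting s t f ¬3 i))) (sym (α-other f s≢t i))
    ... | no u≢s = refl

    letter-injective : ∀ {s t} → [ s ] ≈ [ t ] → s ≡ t
    letter-injective {s} {t} p with s ≟ t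
    ... | yes eq = eq
    ... | no s≢t with trans (sym (trans (act₁-α-self s (λ _ → 1ℤ) s 0) (α-same s (λ _ → -1ℤ) 0))) (trans (act-≈ p (α s (λ _ → 1ℤ)) s 0) (trans (act₁-other (α s (λ _ → 1ℤ)) s≢t 0) (α-same s (λ _ → 1ℤ) 0)))
    ...   | ()

    commuting≈ : ∀ s t → ¬ 3 ℕ.≤ m M s t → s ∷ [ t ] ≈ t ∷ [ s ]
    commuting≈ s t ¬3 with s ≟ t
    ... | yes refl = ≈-refl
    ... | no s≢t = subst (λ k → alt s t k ≈ alt t s k) (ℕₚ.≤-antisym (ℕₚ.≤-pred (ℕₚ.≰⇒> ¬3)) (m-off M s t s≢t)) (braid≈ s t)

    -- Sign coherence: roots of ascents are nonnegative

    module SignCoherence (_≈?_ : ∀ u v → Dec (u ≈ v)) where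
      open Inversions M _≈?_

      Positive : V → Set
      Positive v = ∀ u → NonNeg (v u)

      Positive-≗ : ∀ {v w} → v ≗ w → Positive v → Positive w
      Positive-≗ e p u i = subst (0ℤ ≤_) (e u i) (p u i)

      -- Strip letters s, t alternately from the right end of w as long as they are descents. What is left has neither
      -- descent, and the stripped part, of length k < m, acts through the nonnegative operators U k and U (k + 1).
      positive-root : ∀ N w → length w ℕ.≤ N → ∀ s → D w s ≡ false → ∀ {f} → NonNeg f → Positive (act w (α s f))
      positive-root N w len s ds {f} p with initLast w
      positive-root N .[] len s ds {f} p | [] = α-nonneg s p
      positive-root zero .(w₀ ++ [ t ]) len s ds {f} p | w₀ ∷ʳ′ t
        with () ← ℕₚ.≤-trans (subst (1 ℕ.≤_) (sym (trans (length-++ w₀) (ℕₚ.+-comm (length w₀) 1))) (s≤s z≤n)) len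
      positive-root (suc N) .(w₀ ++ [ t ]) len s ds {f} p | w₀ ∷ʳ′ t with D (w₀ ++ [ t ]) t in dt
      -- The last letter is not a descent of the word, so the word is not reduced and induction
      -- applies to a shorter word for the same element.
      ... | false with descent w₀ t (D-true w₀ t dt)
        where
        D-true : ∀ x t → D (x ++ [ t ]) t ≡ false → D x t ≡ true
        D-true x t h with D x t | D-snoc x t
        ... | true | _ = refl
        ... | false | q with () ← trans (sym h) q
      ...   | w' , l , q = Positive-≗ (≗-sym (act-≈ q (α s f)))
                (positive-root N w' (ℕₚ.≤-pred (ℕₚ.≤-trans (ℕₚ.≤-reflexive (sym l)) (ℕₚ.≤-trans (ℕₚ.m≤m+n (length w₀) 1) (subst (ℕ._≤ suc N) (length-++ w₀) len)))) s (trans (D-cong s (≈-sym q)) ds) p)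
      positive-root (suc N) .(w₀ ++ [ t ]) len s ds {f} p | w₀ ∷ʳ′ t | true = start
        where
        w = w₀ ++ [ t ]
        t≢s : t ≢ s
        t≢s refl with () ← trans (sym ds) dt
        pair = samePair t≢s
        U = Path.U (size t s)
        k₀ = m M t s

        Goal : Set
        Goal = Positive (act w (α s f))

        shorter : ∀ w' → length w' ℕ.≤ N → w ≈ w' → Goal
        shorter w' l q = Positive-≗ (≗-sym (act-≈ q (α s f))) (positive-root N w' l s (trans (D-cong s (≈-sym q)) ds) p)

        D-after : ∀ {x y} z → x ++ [ z ] ≈ y → D x z ≡ true → D y z ≡ false
        D-after {x} {y} z q h = trans (D-cong z (≈-sym q)) (trans (D-snoc x z) (cong not h))

        -- With m letters stripped, the braid relation lets the stripped part end in `s` instead. As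
        -- `s` is not a descent of `w`, it must be one of the rest `y`, and y s has a shorter word.
        full : ∀ v → length v ℕ.+ k₀ ℕ.≤ suc N → w ≈ v ++ reverse (alt t s k₀) → Goal
        full v l q = go k₀ refl
          where
          go : ∀ k → k₀ ≡ k → Goal
          go zero eq with () ← subst (2 ℕ.≤_) eq (m-off M t s t≢s)
          go (suc k) eq = bySnoc (D y s) refl
            where
            y = v ++ reverse (alt t s k)
            w≈ : w ≈ y ++ [ s ]
            w≈ = ≈-trans q (≈-trans (++-congˡ v (reverse-cong (braid≈ t s)))
              (≈-reflexive (trans (cong (λ z → v ++ reverse (alt s t z)) eq) (trans (cong (v ++_) (unfold-reverse s (alt t s k))) (sym (++-assoc v _ [ s ]))))))
            leny : length y ℕ.≤ N
            leny = ℕₚ.≤-pred (ℕₚ.≤-trans (ℕₚ.≤-reflexive (trans (cong suc (trans (length-++ v) (cong (length v ℕ.+_) (trans (length-reverse (alt t s k)) (length-alt t s k))))) (trans (sym (ℕₚ.+-suc (length v) k)) (cong (length v ℕ.+_) (sym eq))))) l)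
              where
              length-alt : ∀ (a b : Fin n) k → length (alt a b k) ≡ k
              length-alt a b zero = refl
              length-alt a b (suc k) = cong suc (length-alt b a k)
            bySnoc : ∀ b → D y s ≡ b → Goal
            bySnoc false h with () ← trans (sym ds) (trans (D-cong s w≈) (trans (D-snoc y s) (cong not h)))
            bySnoc true h with descent y s h
            ... | y' , l' , q' = shorter y' (ℕₚ.≤-trans (ℕₚ.n≤1+n _) (ℕₚ.≤-trans (ℕₚ.≤-reflexive (sym l')) leny)) (≈-trans w≈ q')

        -- The letter stripped last is known not to be a descent of `v`, so only the other one is
        -- tested. If neither is a descent, induction applies to `v`, which is short enough as k ≥
        -- 1. The argument `fuel` bounds the length of `v`.
        strip : ∀ fuel v k → length v ℕ.≤ fuel → length v ℕ.+ k ℕ.≤ suc N → 1 ℕ.≤ k → k ℕ.≤ k₀ →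
          w ≈ v ++ reverse (alt t s k) → D v (altLetter s t k) ≡ false → Goal
        strip fuel v k lv lvk 1≤k k≤ q dv with ℕₚ.m≤n⇒m<n∨m≡n k≤
        ... | inj₂ refl = full v lvk q
        ... | inj₁ k< with D v (altLetter t s k) in dx
        ...   | false = Positive-≗ (≗-sym whole) λ u i → 0≤-+ (ih (altLetter t s k) dx (U-nonneg _ k p (ℕₚ.≤-trans k≤ (ℕₚ.≤-reflexive (sym (size-m t≢s))))) u i)
                                                               (ih (altLetter s t k) dv (U-nonneg _ (suc k) p (ℕₚ.≤-trans k< (ℕₚ.≤-reflexive (sym (size-m t≢s))))) u i)
          where
          ih : ∀ x → D v x ≡ false → ∀ {g} → NonNeg g → Positive (act v (α x g))
          ih x = positive-root N v (ℕₚ.≤-pred (ℕₚ.≤-trans (subst (ℕ._≤ length v ℕ.+ k) (ℕₚ.+-comm (length v) 1) (ℕₚ.+-monoʳ-≤ (length v) 1≤k)) lvk)) x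
          init : α s f ≗ T t s (U 0 f) (U 1 f)
          init u i with does (u ≟ t)
          ... | true = sym (ℤₚ.+-identityˡ _)
          ... | false = sym (ℤₚ.+-identityˡ _)
          whole : act w (α s f) ≗ λ u i → act v (α (altLetter t s k) (U k f)) u i + act v (α (altLetter s t k) (U (suc k) f)) u i
          whole = ≗-trans (act-≈ q (α s f)) (≗-trans (act-++≗ v _ (α s f))
            (≗-trans (act-cong v (≗-trans (act-cong (reverse (alt t s k)) init) (act-alt t s pair k 0 f))) (act-+ v _ _)))
        strip zero v k lv lvk 1≤k k≤ q dv | inj₁ k< | true with descent v (altLetter t s k) dx
        ... | v' , l' , q' with () ← subst (ℕ._≤ 0) l' lv
        strip (suc fuel) v k lv lvk 1≤k k≤ q dv | inj₁ k< | true with descent v (altLetter t s k) dx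
        ... | v' , l' , q' = strip fuel v' (suc k) (ℕₚ.≤-pred (subst (ℕ._≤ suc fuel) l' lv))
              (subst (ℕ._≤ suc N) (trans (cong (ℕ._+ k) l') (sym (ℕₚ.+-suc (length v') k))) lvk) (s≤s z≤n) k<
              (≈-trans q (≈-trans (++-congʳ _ (snoc-swap q')) (≈-reflexive (trans (++-assoc v' _ _) (cong (v' ++_) (sym (reverse-alt-suc t s k)))))))
              (D-after (altLetter t s k) q' dx)

        start : Goal
        start with descent w t dt
        ... | v , l , q = strip (length v) v 1 ℕₚ.≤-refl (ℕₚ.≤-trans (ℕₚ.≤-reflexive (trans (ℕₚ.+-comm (length v) 1) (sym l))) len)
              (s≤s z≤n) (ℕₚ.≤-trans (s≤s z≤n) (m-off M t s t≢s)) (snoc-swap q) (D-after t q dt)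

      positive : ∀ w s → D w s ≡ false → ∀ {f} → NonNeg f → Positive (act w (α s f))
      positive w s = positive-root (length w) w ℕₚ.≤-refl s

      -- If `a` were a descent of `u`, it would be an ascent of u a, whose root is then nonnegative.
      -- But no letter of `u` touches the coefficient over `a`, which the final `a` has made -1.
      ∉⇒ascent : ∀ u {a} → a ∉ u → D u a ≡ false
      ∉⇒ascent u {a} a∉ with D u a in h
      ... | false = refl
      ... | true = ⊥-elim (absurd (subst (0ℤ ≤_) value (positive (u ++ [ a ]) a (trans (D-snoc u a) (cong not h)) {λ _ → 1ℤ} (λ _ → +≤+ z≤n) a 0)))
        where
        absurd : ¬ 0ℤ ≤ -1ℤ
        absurd ()
        value : act (u ++ [ a ]) (α a (λ _ → 1ℤ)) a 0 ≡ -1ℤ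
        value = trans (act-++≗ u [ a ] _ a 0) (trans (act-cong u (act₁-α-self a (λ _ → 1ℤ)) a 0) (trans (act-∉ u _ a∉ 0) (α-same a (λ _ → -1ℤ) 0)))

    -- The pairing and the Euler form

    Supported : Fin n → V → Set
    Supported s x = ∀ u → u ≢ s → x u ≐ λ _ → 0ℤ

    Supported-α : ∀ s f → Supported s (α s f)
    Supported-α s f u p = α-other f p

    x≡-x⇒x≡0 : ∀ (x : ℤ) → x ≡ - x → x ≡ 0ℤ
    x≡-x⇒x≡0 (ℤ.pos zero) _ = refl
    x≡-x⇒x≡0 (ℤ.pos (suc _)) ()
    x≡-x⇒x≡0 (ℤ.negsuc _) ()

    -- The reflection fixes every coordinate outside `s`, so there x = - x in ℤ. This recognises
    -- multiples of simple roots without classifying roots.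
    negated⇒Supported : ∀ s {x} → act₁ s x ≗ (λ u i → - x u i) → Supported s x
    negated⇒Supported s {x} p u u≢s i = x≡-x⇒x≡0 (x u i) (trans (sym (act₁-other x u≢s i)) (p u i))

    δ : ℕ → Fun
    δ j i = if does (i ℕ.≟ j) then 1ℤ else 0ℤ

    δ-nonneg : ∀ j → NonNeg (δ j)
    δ-nonneg j i with does (i ℕ.≟ j)
    ... | true = +≤+ z≤n
    ... | false = ℤₚ.≤-refl

    -- For m ≥ 3 the first path has at least two vertices, so 0 and 1 are joined by an edge.
    X-δ : ∀ a b → 3 ℕ.≤ m M a b → X a b (δ 0) 1 ≡ 1ℤ
    X-δ a b 3≤ = cong₂ (λ y z → y * 1ℤ + z) (Path.e-one (size a b) (ℕᵈ.>⇒∤ (s≤s (ℕₚ.m<n⇒0<n∸m 3≤)))) (ℤₚ.*-zeroʳ (Path.e (size a b) 1))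

    opaque
      -- Truncating the pairing at a common multiple of all path sizes makes every X u v self-adjoint.
      bound : ℕ
      bound = product (cartesianProductWith size (allFin n) (allFin n))

      size∣bound : ∀ u v → size u v ∣ bound
      size∣bound u v = ∈⇒∣product (∈-cartesianProductWith⁺ size (∈-allFin u) (∈-allFin v))

      ⟨_,_⟩ : Fun → Fun → ℤ
      ⟨ f , g ⟩ = sum< bound (λ i → f i * g i)

      ⟨⟩-cong : ∀ {f f' g g'} → f ≐ f' → g ≐ g' → ⟨ f , g ⟩ ≡ ⟨ f' , g' ⟩
      ⟨⟩-cong p q = sum<-cong bound (λ i → cong₂ _*_ (p i) (q i))

      ⟨⟩-comm : ∀ f g → ⟨ f , g ⟩ ≡ ⟨ g , f ⟩
      ⟨⟩-comm f g = sum<-cong bound (λ i → ℤₚ.*-comm (f i) (g i))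

      ⟨⟩-+ʳ : ∀ f g h → ⟨ f , (λ i → g i + h i) ⟩ ≡ ⟨ f , g ⟩ + ⟨ f , h ⟩
      ⟨⟩-+ʳ f g h = go bound
        where
        lem : ∀ a b p x y → (a + b) + p * (x + y) ≡ (a + p * x) + (b + p * y)
        lem = solve-∀
        go : ∀ d → sum< d (λ i → f i * (g i + h i)) ≡ sum< d (λ i → f i * g i) + sum< d (λ i → f i * h i)
        go zero = refl
        go (suc d) = trans (cong (_+ f d * (g d + h d)) (go d)) (lem (sum< d (λ i → f i * g i)) (sum< d (λ i → f i * h i)) (f d) (g d) (h d))

      ⟨⟩-+ˡ : ∀ f g h → ⟨ (λ i → f i + g i) , h ⟩ ≡ ⟨ f , h ⟩ + ⟨ g , h ⟩
      ⟨⟩-+ˡ f g h = trans (⟨⟩-comm _ h) (trans (⟨⟩-+ʳ h f g) (cong₂ _+_ (⟨⟩-comm h f) (⟨⟩-comm h g)))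

      ⟨⟩-negʳ : ∀ f g → ⟨ f , (λ i → - g i) ⟩ ≡ - ⟨ f , g ⟩
      ⟨⟩-negʳ f g = go bound
        where
        lem : ∀ a p x → - a + p * (- x) ≡ - (a + p * x)
        lem = solve-∀
        go : ∀ d → sum< d (λ i → f i * (- g i)) ≡ - sum< d (λ i → f i * g i)
        go zero = refl
        go (suc d) = trans (cong (_+ f d * (- g d)) (go d)) (lem (sum< d (λ i → f i * g i)) (f d) (g d))

      ⟨⟩-negˡ : ∀ f g → ⟨ (λ i → - f i) , g ⟩ ≡ - ⟨ f , g ⟩
      ⟨⟩-negˡ f g = trans (⟨⟩-comm _ g) (trans (⟨⟩-negʳ g f) (cong -_ (⟨⟩-comm g f)))

      ⟨⟩-zeroˡ : ∀ {f} g → f ≐ (λ _ → 0ℤ) → ⟨ f , g ⟩ ≡ 0ℤ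
      ⟨⟩-zeroˡ {f} g p = go bound
        where
        go : ∀ d → sum< d (λ i → f i * g i) ≡ 0ℤ
        go zero = refl
        go (suc d) = cong₂ _+_ (go d) (cong (_* g d) (p d))

      ⟨⟩-zeroʳ : ∀ f {g} → g ≐ (λ _ → 0ℤ) → ⟨ f , g ⟩ ≡ 0ℤ
      ⟨⟩-zeroʳ f {g} p = trans (⟨⟩-comm f g) (⟨⟩-zeroˡ f p)

      ⟨⟩-nonneg : ∀ {f g} → NonNeg f → NonNeg g → 0ℤ ≤ ⟨ f , g ⟩
      ⟨⟩-nonneg {f} {g} p q = go bound
        where
        go : ∀ d → 0ℤ ≤ sum< d (λ i → f i * g i)
        go zero = ℤₚ.≤-refl
        go (suc d) = 0≤-+ (go d) (0≤-* (p d) (q d))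

      X-adjoint : ∀ u v f g → ⟨ X u v f , g ⟩ ≡ ⟨ f , X v u g ⟩
      X-adjoint u v f g = trans (Path.X-selfadjoint (size u v) bound (size∣bound u v) f g) (⟨⟩-cong {f} (λ _ → refl) (X-sym u v g))

      -- The Euler form of the order c on the simple roots.
      E : List (Fin n) → V → V → ℤ
      E [] x y = 0ℤ
      E (l ∷ c) x y = (⟨ x l , y l ⟩ - ⟨ lsum c (λ u → X l u (x u)) , y l ⟩) + E c x y

      E-cong∈ : ∀ c {x x' y y'} → (∀ {u} → u ∈ c → x u ≐ x' u) → (∀ {u} → u ∈ c → y u ≐ y' u) → E c x y ≡ E c x' y'
      E-cong∈ [] p q = refl
      E-cong∈ (l ∷ c) p q = cong₂ _+_ (cong₂ _-_ (⟨⟩-cong (p (here refl)) (q (here refl)))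
          (⟨⟩-cong (lsum-cong∈ c (λ {u} u∈ → X-cong l u (p (there u∈)))) (q (here refl))))
        (E-cong∈ c (p ∘ there) (q ∘ there))

      E-cong : ∀ c {x x' y y'} → x ≗ x' → y ≗ y' → E c x y ≡ E c x' y'
      E-cong c p q = E-cong∈ c (λ {u} _ → p u) (λ {u} _ → q u)

      E-zeroˡ : ∀ c {x} y → (∀ {u} → u ∈ c → x u ≐ λ _ → 0ℤ) → E c x y ≡ 0ℤ
      E-zeroˡ [] y p = refl
      E-zeroˡ (l ∷ c) y p = cong₂ _+_ (cong₂ _-_ (⟨⟩-zeroˡ (y l) (p (here refl)))
          (⟨⟩-zeroˡ (y l) (lsum-0 c (λ {u} u∈ i → trans (X-cong l u (p (there u∈)) i) (X-0 l u i)))))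
        (E-zeroˡ c y (p ∘ there))

      E-zeroʳ : ∀ c x {y} → (∀ {u} → u ∈ c → y u ≐ λ _ → 0ℤ) → E c x y ≡ 0ℤ
      E-zeroʳ [] x p = refl
      E-zeroʳ (l ∷ c) x p = cong₂ _+_ (cong₂ _-_ (⟨⟩-zeroʳ (x l) (p (here refl))) (⟨⟩-zeroʳ (lsum c (λ u → X l u (x u))) (p (here refl))))
        (E-zeroʳ c x (p ∘ there))

      E-snoc : ∀ c s x y → E (c ++ [ s ]) x y ≡ E c x y + (⟨ x s , y s ⟩ - ⟨ x s , lsum c (λ u → X s u (y u)) ⟩)
      E-snoc [] s x y = trans (cong (λ z → (⟨ x s , y s ⟩ - z) + 0ℤ) (trans (⟨⟩-zeroˡ (y s) (λ _ → refl)) (sym (⟨⟩-zeroʳ (x s) (λ _ → refl)))))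
        (ℤₚ.+-comm (⟨ x s , y s ⟩ - ⟨ x s , (λ _ → 0ℤ) ⟩) 0ℤ)
      E-snoc (l ∷ c) s x y = begin
        (⟨ x l , y l ⟩ - ⟨ lsum (c ++ [ s ]) Xx , y l ⟩) + E (c ++ [ s ]) x y
          ≡⟨ cong₂ (λ p q → (⟨ x l , y l ⟩ - p) + q) split (E-snoc c s x y) ⟩
        (⟨ x l , y l ⟩ - (⟨ lsum c Xx , y l ⟩ + ⟨ x s , X s l (y l) ⟩)) + (E c x y + (⟨ x s , y s ⟩ - ⟨ x s , lsum c Xy ⟩))
          ≡⟨ lem ⟨ x l , y l ⟩ _ _ _ ⟨ x s , y s ⟩ ⟨ x s , lsum c Xy ⟩ ⟩
        ((⟨ x l , y l ⟩ - ⟨ lsum c Xx , y l ⟩) + E c x y) + (⟨ x s , y s ⟩ - (⟨ x s , X s l (y l) ⟩ + ⟨ x s , lsum c Xy ⟩))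
          ≡⟨ cong (λ z → ((⟨ x l , y l ⟩ - ⟨ lsum c Xx , y l ⟩) + E c x y) + (⟨ x s , y s ⟩ - z)) (⟨⟩-+ʳ (x s) (X s l (y l)) (lsum c Xy)) ⟨
        ((⟨ x l , y l ⟩ - ⟨ lsum c Xx , y l ⟩) + E c x y) + (⟨ x s , y s ⟩ - ⟨ x s , lsum (l ∷ c) Xy ⟩) ∎
        where
        open ≡-Reasoning
        Xx : V
        Xx u = X l u (x u)
        Xy : V
        Xy u = X s u (y u)
        split : ⟨ lsum (c ++ [ s ]) Xx , y l ⟩ ≡ ⟨ lsum c Xx , y l ⟩ + ⟨ x s , X s l (y l) ⟩
        split = trans (⟨⟩-cong {g = y l} (λ i → trans (lsum-++ c [ s ] Xx i) (cong (lsum c Xx i +_) (ℤₚ.+-identityʳ (Xx s i)))) (λ _ → refl))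
          (trans (⟨⟩-+ˡ (lsum c Xx) (Xx s) (y l)) (cong (⟨ lsum c Xx , y l ⟩ +_) (X-adjoint l s (x s) (y l))))
        lem : ∀ a b d f g h → (a - (b + d)) + (f + (g - h)) ≡ ((a - b) + f) + (g - (d + h))
        lem = solve-∀

      -- Only terms with `s` change. The letters in `c` are all those other than `s`, so the mixed
      -- terms of the first letter add up to κ; this cancels the κ in the reflected left argument,
      -- and the κ in the reflected right argument supplies the mixed terms of `s` as last letter.
      E-rotate : ∀ s c x y → (s ∷ c) ↭ allFin n → s ∉ c → E (s ∷ c) (act₁ s x) (act₁ s y) ≡ E (c ++ [ s ]) x y
      E-rotate s c x y perm s∉ = begin
        (⟨ sx s , sy s ⟩ - ⟨ lsum c (λ u → X s u (sx u)) , sy s ⟩) + E c sx sy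
          ≡⟨ cong₂ (λ p q → (p - ⟨ lsum c (λ u → X s u (sx u)) , sy s ⟩) + q) one (E-cong∈ c (off x) (off y)) ⟩
        ((- ⟨ x s , sy s ⟩ + ⟨ κ s x , sy s ⟩) - ⟨ lsum c (λ u → X s u (sx u)) , sy s ⟩) + E c x y
          ≡⟨ cong (λ p → ((- ⟨ x s , sy s ⟩ + ⟨ κ s x , sy s ⟩) - p) + E c x y) (⟨⟩-cong {g = sy s} κx (λ _ → refl)) ⟩
        ((- ⟨ x s , sy s ⟩ + ⟨ κ s x , sy s ⟩) - ⟨ κ s x , sy s ⟩) + E c x y
          ≡⟨ cong (λ p → ((- p + ⟨ κ s x , sy s ⟩) - ⟨ κ s x , sy s ⟩) + E c x y) two ⟩
        ((- (- ⟨ x s , y s ⟩ + ⟨ x s , κ s y ⟩) + ⟨ κ s x , sy s ⟩) - ⟨ κ s x , sy s ⟩) + E c x y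
          ≡⟨ lem ⟨ x s , y s ⟩ ⟨ x s , κ s y ⟩ _ _ ⟩
        E c x y + (⟨ x s , y s ⟩ - ⟨ x s , κ s y ⟩)
          ≡⟨ cong (λ p → E c x y + (⟨ x s , y s ⟩ - p)) (⟨⟩-cong {x s} (λ _ → refl) (λ i → sym (κ-list s c y perm i))) ⟩
        E c x y + (⟨ x s , y s ⟩ - ⟨ x s , lsum c (λ u → X s u (y u)) ⟩)
          ≡⟨ E-snoc c s x y ⟨
        E (c ++ [ s ]) x y ∎
        where
        open ≡-Reasoning
        sx sy : V
        sx = act₁ s x
        sy = act₁ s y
        off : ∀ v {u} → u ∈ c → act₁ s v u ≐ v u
        off v u∈ = act₁-other v (λ eq → s∉ (subst (_∈ c) eq u∈))
        κx : lsum c (λ u → X s u (sx u)) ≐ κ s x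
        κx i = trans (lsum-cong∈ c (λ {u} u∈ → X-cong s u (off x u∈)) i) (κ-list s c x perm i)
        one : ⟨ sx s , sy s ⟩ ≡ - ⟨ x s , sy s ⟩ + ⟨ κ s x , sy s ⟩
        one = trans (⟨⟩-cong {g = sy s} (act₁-same s x) (λ _ → refl)) (trans (⟨⟩-+ˡ (λ i → - x s i) (κ s x) (sy s)) (cong (_+ ⟨ κ s x , sy s ⟩) (⟨⟩-negˡ (x s) (sy s))))
        two : ⟨ x s , sy s ⟩ ≡ - ⟨ x s , y s ⟩ + ⟨ x s , κ s y ⟩
        two = trans (⟨⟩-cong {x s} (λ _ → refl) (act₁-same s y)) (trans (⟨⟩-+ʳ (x s) (λ i → - y s i) (κ s y)) (cong (_+ ⟨ x s , κ s y ⟩) (⟨⟩-negʳ (x s) (y s))))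
        lem : ∀ a b d f → ((- (- a + b) + d) - d) + f ≡ f + (a - b)
        lem = solve-∀

      E-firstˡ : ∀ s c {x} y → s ∉ c → Supported s x → E (s ∷ c) x y ≡ ⟨ x s , y s ⟩
      E-firstˡ s c {x} y s∉ sup = trans (cong₂ _+_ (cong (λ z → ⟨ x s , y s ⟩ - z) (⟨⟩-zeroˡ (y s) (lsum-0 c (λ {u} u∈ i → trans (X-cong s u (zero∈ u∈) i) (X-0 s u i)))))
          (E-zeroˡ c y zero∈)) (lem ⟨ x s , y s ⟩)
        where
        zero∈ : ∀ {u} → u ∈ c → x u ≐ λ _ → 0ℤ
        zero∈ u∈ = sup _ (λ eq → s∉ (subst (_∈ c) eq u∈))
        lem : ∀ a → (a - 0ℤ) + 0ℤ ≡ a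
        lem = solve-∀

      -- In contrast to `E-firstˡ`, the mixed terms survive here and complete the coefficient to the
      -- negative of the reflected one. This asymmetry is the origin of the opposite signs.
      E-firstʳ : ∀ s c x {y} → (s ∷ c) ↭ allFin n → s ∉ c → Supported s y → E (s ∷ c) x y ≡ - ⟨ act₁ s x s , y s ⟩
      E-firstʳ s c x {y} perm s∉ sup = begin
        (⟨ x s , y s ⟩ - ⟨ lsum c (λ u → X s u (x u)) , y s ⟩) + E c x y
          ≡⟨ cong₂ (λ p q → (⟨ x s , y s ⟩ - p) + q) (⟨⟩-cong {g = y s} (κ-list s c x perm) (λ _ → refl))
               (E-zeroʳ c x (λ u∈ → sup _ (λ eq → s∉ (subst (_∈ c) eq u∈)))) ⟩
        (⟨ x s , y s ⟩ - ⟨ κ s x , y s ⟩) + 0ℤ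
          ≡⟨ lem ⟨ x s , y s ⟩ ⟨ κ s x , y s ⟩ ⟩
        - (- ⟨ x s , y s ⟩ + ⟨ κ s x , y s ⟩)
          ≡⟨ cong -_ (sym (trans (⟨⟩-cong {g = y s} (act₁-same s x) (λ _ → refl)) (trans (⟨⟩-+ˡ (λ i → - x s i) (κ s x) (y s)) (cong (_+ ⟨ κ s x , y s ⟩) (⟨⟩-negˡ (x s) (y s)))))) ⟩
        - ⟨ act₁ s x s , y s ⟩ ∎
        where
        open ≡-Reasoning
        lem : ∀ a b → (a - b) + 0ℤ ≡ - (- a + b)
        lem = solve-∀

      ⟨δ,⟩-≥ : ∀ {j g} → NonNeg g → j ℕ.< bound → g j ≤ ⟨ δ j , g ⟩
      ⟨δ,⟩-≥ {j} {g} p = go bound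
        where
        term : ∀ i → 0ℤ ≤ δ j i * g i
        term i = 0≤-* (δ-nonneg j i) (p i)
        sum≥0 : ∀ d → 0ℤ ≤ sum< d (λ i → δ j i * g i)
        sum≥0 zero = ℤₚ.≤-refl
        sum≥0 (suc d) = 0≤-+ (sum≥0 d) (term d)
        at : δ j j * g j ≡ g j
        at = trans (cong (λ b → (if b then 1ℤ else 0ℤ) * g j) (dec-true (j ℕ.≟ j) refl)) (ℤₚ.*-identityˡ (g j))
        go : ∀ d → j ℕ.< d → g j ≤ sum< d (λ i → δ j i * g i)
        go (suc d) j<d with ℕₚ.m≤n⇒m<n∨m≡n (ℕₚ.≤-pred j<d)
        ... | inj₁ j<d' = subst (_≤ sum< d (λ i → δ j i * g i) + δ j d * g d) (ℤₚ.+-identityʳ (g j)) (ℤₚ.+-mono-≤ (go d j<d') (term d))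
        ... | inj₂ refl = subst (_≤ sum< d (λ i → δ j i * g i) + δ j d * g d) (trans (ℤₚ.+-identityˡ _) at) (ℤₚ.+-monoˡ-≤ (δ j d * g d) (sum≥0 d))

      -- The test function `δ 1` must lie below the truncation of the pairing.
      1<bound : ∀ a b → 3 ℕ.≤ m M a b → 1 ℕ.< bound
      1<bound a b 3≤ = ℕₚ.≤-trans (s≤s (ℕₚ.m<n⇒0<n∸m 3≤)) (ℕᵈ.∣⇒≤ {{bound≢0}} (size∣bound a b))
        where
        bound≢0 : ℕ.NonZero bound
        bound≢0 = product≢0 (All.tabulate nz)
          where
          open import Data.List.Membership.Propositional.Properties using (∈-cartesianProductWith⁻)
          nz : ∀ {k} → k ∈ cartesianProductWith size (allFin n) (allFin n) → ℕ.NonZero k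
          nz k∈ with ∈-cartesianProductWith⁻ size (allFin n) (allFin n) k∈
          ... | _ , _ , _ , _ , refl = _

-- Greedy reduced words of windows

module Windows where

  open CoxeterWords
  open PathOperators using (Fun; NonNeg; _≐_; module Path)
  open RootSystem
  open import Data.Bool using (Bool; true; false; if_then_else_; not; _xor_; _∧_)
  open import Data.Bool.Properties using (xor-identityʳ)
  open import Data.Nat using (ℕ; zero; suc; _+_; _*_; _∸_; _≤_; _<_; s≤s; z≤n; _≤?_; _<?_; _≟_)
  open import Relation.Binary.Definitions using (tri<; tri≈; tri>)
  open import Data.Nat.Properties hiding (_≤?_; _<?_; _≟_)
  open import Data.Fin using (Fin)
  import Data.Fin.Properties as Finₚ
  open import Data.List using (List; []; _∷_; _++_; [_]; length; reverse; allFin; filter)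
  open import Data.List.Properties using (++-assoc; length-++; filter-++)
  open import Data.List.Membership.Propositional using (_∈_; _∉_)
  open import Data.List.Membership.Propositional.Properties using (∈-++⁻; ∈-allFin)
  open import Data.List.Relation.Unary.Any using (here; there)
  open import Data.List.Relation.Binary.Permutation.Propositional using (_↭_)
  open import Data.Product using (∃; _×_; _,_; proj₁; proj₂)
  open import Data.Sum using (_⊎_; inj₁; inj₂)
  open import Data.Empty using (⊥; ⊥-elim)
  open import Function using (_∘_)
  open import Function.Bundles using (mk⇔)
  open import Relation.Nullary using (¬_; Dec; yes; no; does)
  open import Relation.Nullary.Decidable using (dec-true; dec-false; does-⇔)
  open import Relation.Binary.PropositionalEquality using (_≡_; _≢_; refl; sym; trans; cong; cong₂; subst; subst₂; module ≡-Reasoning)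

  seg : ∀ {n} → (ℕ → Fin n) → ℕ → ℕ → Word n
  seg L j zero = []
  seg L j (suc k) = L j ∷ seg L (suc j) k

  seg-snoc : ∀ {n} (L : ℕ → Fin n) j k → seg L j (suc k) ≡ seg L j k ++ [ L (j + k) ]
  seg-snoc L j zero = cong (λ z → [ L z ]) (sym (+-identityʳ j))
  seg-snoc L j (suc k) = cong (L j ∷_) (trans (seg-snoc L (suc j) k) (cong (λ z → seg L (suc j) k ++ [ L z ]) (sym (+-suc j k))))

  ∈-seg : ∀ {n} (L : ℕ → Fin n) j k {a} → a ∈ seg L j k → ∃ λ i → j ≤ i × i < j + k × L i ≡ a
  ∈-seg L j (suc k) (here eq) = j , ≤-refl , m<m+n j (s≤s z≤n) , sym eq
  ∈-seg L j (suc k) (there a∈) with ∈-seg L (suc j) k a∈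
  ... | i , p , q , r = i , <⇒≤ p , subst (i <_) (sym (+-suc j k)) q , r

  φ-snoc : ∀ {n} (u : Word n) a s → φ (u ++ [ a ]) s ≡ φ u s + φ [ a ] s
  φ-snoc u a s = trans (cong length (filter-++ (Finₚ._≟ s) u [ a ])) (length-++ (filter (Finₚ._≟ s) u))

  φ-same : ∀ {n} {a s : Fin n} → a ≡ s → φ [ a ] s ≡ 1
  φ-same {a = a} {s} p with a Finₚ.≟ s
  ... | yes _ = refl
  ... | no a≢s = ⊥-elim (a≢s p)

  φ-other : ∀ {n} {a s : Fin n} → a ≢ s → φ [ a ] s ≡ 0
  φ-other {a = a} {s} p with a Finₚ.≟ s
  ... | yes a≡s = ⊥-elim (p a≡s)
  ... | no _ = refl

  -- This and `next-copy` turn the interleaving of values of `p` into the two cases of the theorem;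
  -- k and l will be numbers of occurrences.
  same-copies : ∀ {N i j k l} → j < N → i < j → i + k * N < j + l * N → j + l * N < i + k * N + N → k ≡ l
  same-copies {N} {i} {j} {k} {l} j<N i<j lt lt' with <-cmp k l
  ... | tri≈ _ eq _ = eq
  ... | tri< k<l _ _ = ⊥-elim (<⇒≱ lt' (≤-trans (≤-reflexive (trans (+-assoc i (k * N) N) (cong (i +_) (+-comm (k * N) N)))) (+-mono-≤ (<⇒≤ i<j) (*-monoˡ-≤ N k<l))))
  ... | tri> _ _ l<k = ⊥-elim (<⇒≱ lt (≤-trans (+-monoˡ-≤ (l * N) (<⇒≤ j<N)) (≤-trans (*-monoˡ-≤ N l<k) (m≤n+m (k * N) i))))

  next-copy : ∀ {N i j k l} → j < N → i < j → j + l * N < i + k * N → i + k * N < j + l * N + N → k ≡ suc l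
  next-copy {N} {i} {j} {k} {l} j<N i<j lt lt' with <-cmp k (suc l)
  ... | tri≈ _ eq _ = eq
  ... | tri< k≤l _ _ = ⊥-elim (<⇒≱ lt (+-mono-≤ (<⇒≤ i<j) (*-monoˡ-≤ N (≤-pred k≤l))))
  ... | tri> _ _ l<k = ⊥-elim (<⇒≱ lt' (≤-trans (≤-reflexive (trans (+-assoc j (l * N) N) (cong (j +_) (+-comm (l * N) N))))
          (≤-trans (+-monoˡ-≤ (suc l * N) (<⇒≤ j<N)) (≤-trans (*-monoˡ-≤ N l<k) (m≤n+m (k * N) i)))))

  -- L lists the letters of c c c ⋯, with N the length of c.
  module Greedy {n : ℕ} (M : CoxeterMatrix n) (_≈?_ : ∀ u v → Dec (u ≈⟨ M ⟩ v))
    (w : Word n) (longest : IsLongestWord M w)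
    (N₁ : ℕ) (L : ℕ → Fin n)
    (L-periodic : ∀ i → L (i + suc N₁) ≡ L i)
    (L-distinct : ∀ {i j} → i < j → j < i + suc N₁ → L i ≢ L j)
    (L-order : ∀ j → seg L j (suc N₁) ↭ allFin n)
    (L-all : ∀ j a → ∃ λ i → j ≤ i × i < j + suc N₁ × L i ≡ a)
    where

    N : ℕ
    N = suc N₁

    open Words M public
    open Inversions M _≈?_ public
    open Longest w longest public
    open Representation M public
    open SignCoherence _≈?_ public

    -- pr r i is the greedy reduced word formed by positions r , … , i - 1, and g r i tells whether it is extended at position i.
    pr : ℕ → ℕ → Word n
    pr r zero = []
    pr r (suc i) = if does (r ≤? i) ∧ not (D (pr r i) (L i)) then pr r i ++ [ L i ] else pr r i

    g : ℕ → ℕ → Bool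
    g r i = does (r ≤? i) ∧ not (D (pr r i) (L i))

    pr-take : ∀ r i → g r i ≡ true → pr r (suc i) ≡ pr r i ++ [ L i ]
    pr-take r i h = cong (λ b → if b then pr r i ++ [ L i ] else pr r i) h

    pr-skip : ∀ r i → g r i ≡ false → pr r (suc i) ≡ pr r i
    pr-skip r i h = cong (λ b → if b then pr r i ++ [ L i ] else pr r i) h

    g⇒≤ : ∀ r i → g r i ≡ true → r ≤ i
    g⇒≤ r i h = ≮⇒≥ λ i<r → contra (trans (sym h) (cong (_∧ not (D (pr r i) (L i))) (dec-false (r ≤? i) (<⇒≱ i<r))))
      where
      contra : true ≢ false
      contra ()

    g⇒ascent : ∀ r i → g r i ≡ true → D (pr r i) (L i) ≡ false
    g⇒ascent r i h with does (r ≤? i) | D (pr r i) (L i)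
    ... | true | false = refl
    g⇒ascent r i () | true | true
    g⇒ascent r i () | false | _

    g≡ : ∀ {r i} → r ≤ i → g r i ≡ not (D (pr r i) (L i))
    g≡ {r} {i} p = cong (_∧ not (D (pr r i) (L i))) (dec-true (r ≤? i) p)

    pr-start : ∀ r i → i ≤ r → pr r i ≡ []
    pr-start r zero _ = refl
    pr-start r (suc i) i<r = trans (pr-skip r i (cong (_∧ not (D (pr r i) (L i))) (dec-false (r ≤? i) (<⇒≱ i<r)))) (pr-start r i (<⇒≤ i<r))

    g-self : ∀ r → g r r ≡ true
    g-self r = trans (g≡ {r} ≤-refl) (cong (λ z → not (D z (L r))) (pr-start r r ≤-refl))

    pr-reduced : ∀ r i → IsReduced M (pr r i)
    pr-reduced r zero = reduced-[]
    pr-reduced r (suc i) with g r i in h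
    ... | true = reduced-snoc (pr r i) (L i) (pr-reduced r i) (g⇒ascent r i h)
    ... | false = pr-reduced r i

    pr-∈ : ∀ r i {a} → a ∈ pr r i → ∃ λ j → r ≤ j × j < i × L j ≡ a
    pr-∈ r (suc i) a∈ with g r i in h
    pr-∈ r (suc i) a∈ | false with pr-∈ r i a∈
    ... | j , p , q , e = j , p , m<n⇒m<1+n q , e
    pr-∈ r (suc i) a∈ | true with ∈-++⁻ (pr r i) a∈
    ... | inj₂ (here eq) = i , g⇒≤ r i h , ≤-refl , sym eq
    ... | inj₁ a∈' with pr-∈ r i a∈'
    ...   | j , p , q , e = j , p , m<n⇒m<1+n q , e

    fresh : ∀ r i → i < r + N → L i ∉ pr r i
    fresh r i i<r+N Li∈ with pr-∈ r i Li∈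
    ... | j , r≤j , j<i , e = L-distinct j<i (<-≤-trans i<r+N (+-monoˡ-≤ N r≤j)) e

    first-copy : ∀ {r i} → r ≤ i → i < r + N → g r i ≡ true
    first-copy {r} {i} r≤i i<r+N = trans (g≡ r≤i) (cong not (∉⇒ascent (pr r i) (fresh r i i<r+N)))

    length-pr-mono : ∀ r i k → length (pr r i) ≤ length (pr r (i + k))
    length-pr-mono r i zero = ≤-reflexive (cong (length ∘ pr r) (sym (+-identityʳ i)))
    length-pr-mono r i (suc k) rewrite +-suc i k = ≤-trans (length-pr-mono r i k) one
      where
      one : length (pr r (i + k)) ≤ length (pr r (suc (i + k)))
      one with g r (i + k)
      ... | true = ≤-trans (m≤m+n _ 1) (≤-reflexive (sym (length-++ (pr r (i + k)))))
      ... | false = ≤-refl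

    scan : ∀ r i k → r ≤ i → suc (length (pr r i)) ≤ length (pr r (i + k)) ⊎
      (pr r (i + k) ≡ pr r i × (∀ j → i ≤ j → j < i + k → D (pr r i) (L j) ≡ true))
    scan r i zero r≤i = inj₂ (cong (pr r) (+-identityʳ i) , λ j i≤j j< → ⊥-elim (<⇒≱ (subst (j <_) (+-identityʳ i) j<) i≤j))
    scan r i (suc k) r≤i with scan r i k r≤i
    ... | inj₁ long = inj₁ (≤-trans long (≤-trans (length-pr-mono r (i + k) 1) (≤-reflexive (cong (length ∘ pr r) (trans (+-assoc i k 1) (cong (i +_) (+-comm k 1)))))))
    ... | inj₂ (same , desc) with g r (i + k) in h
    ...   | true = inj₁ (≤-reflexive (sym (trans (cong (length ∘ pr r) (+-suc i k)) (trans (cong length (pr-take r (i + k) h))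
                    (trans (length-++ (pr r (i + k))) (trans (+-comm _ 1) (cong (suc ∘ length) same)))))))
    ...   | false = inj₂ (trans (cong (pr r) (+-suc i k)) (trans (pr-skip r (i + k) h) same) , desc')
      where
      last : D (pr r i) (L (i + k)) ≡ true
      last with D (pr r (i + k)) (L (i + k)) in e | trans (sym (g≡ (≤-trans r≤i (m≤m+n i k)))) h
      ... | true | _ = trans (cong (λ z → D z (L (i + k))) (sym same)) e
      ... | false | ()
      desc' : ∀ j → i ≤ j → j < i + suc k → D (pr r i) (L j) ≡ true
      desc' j i≤j j< with m≤n⇒m<n∨m≡n (≤-pred (subst (j <_) (+-suc i k) j<))
      ... | inj₁ j<' = desc j i≤j j<'
      ... | inj₂ refl = last

    -- A full copy of c that adds no letter shows that every generator is a descent, so the word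
    -- already represents `w`; otherwise each copy adds at least one letter.
    progress : ∀ r k → (∃ λ I → r ≤ I × pr r I ≈ w) ⊎ k ≤ length (pr r (r + k * N))
    progress r zero = inj₂ z≤n
    progress r (suc k) with progress r k
    ... | inj₁ done = inj₁ done
    ... | inj₂ long with scan r (r + k * N) N (m≤m+n r (k * N))
    ...   | inj₁ longer = inj₂ (≤-trans (s≤s long) (≤-trans longer (≤-reflexive (cong (length ∘ pr r) (trans (+-assoc r (k * N) N) (cong (r +_) (+-comm (k * N) N)))))))
    ...   | inj₂ (_ , desc) = inj₁ (r + k * N , m≤m+n r (k * N) , all-descents⇒≈ _ all)
      where
      all : ∀ a → D (pr r (r + k * N)) a ≡ true
      all a with L-all (r + k * N) a
      ... | j , p , q , refl = desc j p q

    complete : ∀ r → ∃ λ I → r ≤ I × pr r I ≈ w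
    complete r with progress r (suc (length w))
    ... | inj₁ done = done
    ... | inj₂ long = ⊥-elim (<⇒≱ long (proj₂ longest _ (pr-reduced r (r + suc (length w) * N))))

    complete-g : ∀ {r I} → r ≤ I → pr r I ≈ w → g r I ≡ false
    complete-g {r} {I} r≤I e = trans (g≡ r≤I) (cong not (all-descents-≈ e (L I)))

    complete-stable : ∀ {r I} → r ≤ I → pr r I ≈ w → ∀ k → pr r (k + I) ≡ pr r I
    complete-stable r≤I e zero = refl
    complete-stable {r} {I} r≤I e (suc k) = trans (pr-skip r (k + I) (complete-g (≤-trans r≤I (m≤n+m I k)) (subst (_≈ w) (sym ih) e))) ih
      where
      ih : pr r (k + I) ≡ pr r I
      ih = complete-stable r≤I e k

    -- Periodicity and the exchange between consecutive windows

    pr-periodic : ∀ r i → pr (r + N) (i + N) ≡ pr r i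
    g-periodic : ∀ r i → g (r + N) (i + N) ≡ g r i
    pr-periodic r zero = pr-start (r + N) N (m≤n+m N r)
    pr-periodic r (suc i) with g r i in h
    ... | true = trans (pr-take (r + N) (i + N) (trans (g-periodic r i) h)) (cong₂ (λ x y → x ++ [ y ]) (pr-periodic r i) (L-periodic i))
    ... | false = trans (pr-skip (r + N) (i + N) (trans (g-periodic r i) h)) (pr-periodic r i)
    g-periodic r i = cong₂ (λ x y → x ∧ not y) (does-⇔ (mk⇔ (+-cancelʳ-≤ N r i) (+-monoˡ-≤ N)) (r + N ≤? i + N) (r ≤? i))
      (cong₂ D (pr-periodic r i) (L-periodic i))

    -- The state before the exchange: the windows differ by the leading letter `L r`. The field
    -- `no-inv` guarantees that at the exchange window `r + 1` sees an ascent.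
    record Phase₁ (r i : ℕ) : Set where
      field
        extends : pr r i ≈ L r ∷ pr (suc r) i
        no-inv  : η (pr (suc r) i) [ L r ] ≡ false
    open Phase₁

    phase-start : ∀ r → Phase₁ r (suc r)
    phase-start r = record
      { extends = ≈-reflexive (trans (pr-take r r (g-self r)) (trans (cong (_++ [ L r ]) (pr-start r r ≤-refl)) (cong (L r ∷_) (sym (pr-start (suc r) (suc r) ≤-refl)))))
      ; no-inv = cong (λ z → η z [ L r ]) (pr-start (suc r) (suc r) ≤-refl) }

    pr-suc-cong : ∀ r r' i u → g r i ≡ g r' i → pr r i ≈ u ++ pr r' i → pr r (suc i) ≈ u ++ pr r' (suc i)
    pr-suc-cong r r' i u e p with g r i | g r' i
    pr-suc-cong r r' i u refl p | true | true = ≈-trans (++-congʳ [ L i ] p) (≈-reflexive (++-assoc u (pr r' i) [ L i ]))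
    pr-suc-cong r r' i u refl p | false | false = p

    -- By `D-∷` the two windows decide differently at `i` only if `L r` is the reflection of `L i`.
    -- Then `no-inv` makes `L i` an ascent for window `r + 1`, hence a descent for window `r`.
    phase-step : ∀ {r i} → r < i → Phase₁ r i →
      (g r i ≡ g (suc r) i × Phase₁ r (suc i)) ⊎
      (g r i ≡ false × g (suc r) i ≡ true × L r ∷ pr (suc r) i ≈ pr (suc r) i ++ [ L i ])
    phase-step {r} {i} r<i ph with [ L r ] ≈? ρ (pr (suc r) i) (L i) in eq
    ... | yes p = inj₂ (trans (g≡ (<⇒≤ r<i)) (cong not Du) , trans (g≡ r<i) (cong not Dv) , ≈-trans (++-congʳ v p) (ρ-++ v (L i)))
      where
      v = pr (suc r) i
      Dv : D v (L i) ≡ false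
      Dv = trans (η-congʳ v (≈-sym p)) (no-inv ph)
      Du : D (pr r i) (L i) ≡ true
      Du = trans (D-cong (L i) (extends ph)) (trans (D-∷ (L r) v (L i)) (cong₂ _xor_ (≈?-true p) Dv))
    ... | no ¬p = inj₁ (same , record { extends = pr-suc-cong r (suc r) i [ L r ] same (extends ph) ; no-inv = no-inv' })
      where
      v = pr (suc r) i
      Du : D (pr r i) (L i) ≡ D v (L i)
      Du = trans (D-cong (L i) (extends ph)) (trans (D-∷ (L r) v (L i)) (cong (_xor D v (L i)) (≈?-false ¬p)))
      same : g r i ≡ g (suc r) i
      same = trans (g≡ (<⇒≤ r<i)) (trans (cong not Du) (sym (g≡ r<i)))
      no-inv' : η (pr (suc r) (suc i)) [ L r ] ≡ false
      no-inv' with g (suc r) i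
      ... | false = no-inv ph
      ... | true = trans (η-++ v [ L i ] [ L r ]) (cong₂ _xor_ (no-inv ph) (trans (xor-identityʳ _) (≈?-false (λ q → ¬p (≈-sym (ρ≈ v q))))))

    phase₂-step : ∀ {r i} → r < i → pr r i ≈ pr (suc r) i → g r i ≡ g (suc r) i × pr r (suc i) ≈ pr (suc r) (suc i)
    phase₂-step {r} {i} r<i e = same , pr-suc-cong r (suc r) i [] same e
      where
      same : g r i ≡ g (suc r) i
      same = trans (g≡ (<⇒≤ r<i)) (trans (cong not (D-cong (L i) e)) (sym (g≡ r<i)))

    record Arc (r : ℕ) : Set where
      field
        p      : ℕ
        r<p    : r < p
        phase₁ : ∀ i → r < i → i ≤ p → Phase₁ r i
        same   : ∀ i → r < i → i ≢ p → g r i ≡ g (suc r) i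
        g-p    : g r p ≡ false
        g'-p   : g (suc r) p ≡ true
        commutes : L r ∷ pr (suc r) p ≈ pr (suc r) p ++ [ L p ]
        phase₂ : ∀ i → p < i → pr r i ≈ pr (suc r) i

    abstract
      arc : ∀ r → Arc r
      arc r = search (suc (I₀ + I₁)) (suc r) refl ≤-refl (λ j p q → subst (Phase₁ r) (≤-antisym p q) (phase-start r)) (λ j p q → ⊥-elim (<⇒≱ q p))
        where
        I₀ I₁ I : ℕ
        I₀ = proj₁ (complete r)
        I₁ = proj₁ (complete (suc r))
        I = suc r + suc (I₀ + I₁)
        at₀ : pr r I ≈ w
        at₀ = subst (λ z → pr r z ≈ w) idx (subst (_≈ w) (sym (complete-stable (proj₁ (proj₂ (complete r))) (proj₂ (proj₂ (complete r))) (I₁ + (suc r + 1)))) (proj₂ (proj₂ (complete r))))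
          where
          idx : (I₁ + (suc r + 1)) + I₀ ≡ I
          idx = trans (cong (_+ I₀) (+-comm I₁ (suc r + 1))) (trans (+-assoc (suc r + 1) I₁ I₀) (trans (+-assoc (suc r) 1 (I₁ + I₀)) (cong (λ z → suc r + suc z) (+-comm I₁ I₀))))
        at₁ : pr (suc r) I ≈ w
        at₁ = subst (λ z → pr (suc r) z ≈ w) idx (subst (_≈ w) (sym (complete-stable (proj₁ (proj₂ (complete (suc r)))) (proj₂ (proj₂ (complete (suc r)))) (suc r + suc I₀))) (proj₂ (proj₂ (complete (suc r)))))
          where
          idx : (suc r + suc I₀) + I₁ ≡ I
          idx = +-assoc (suc r) (suc I₀) I₁
        later : ∀ p → r < p → pr r (suc p) ≈ pr (suc r) (suc p) → ∀ k → pr r (k + suc p) ≈ pr (suc r) (k + suc p)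
        later p r<p e zero = e
        later p r<p e (suc k) = proj₂ (phase₂-step (≤-trans r<p (≤-trans (n≤1+n p) (m≤n+m (suc p) k))) (later p r<p e k))
        search : ∀ d i → i + d ≡ I → r < i → (∀ j → r < j → j ≤ i → Phase₁ r j) → (∀ j → r < j → j < i → g r j ≡ g (suc r) j) → Arc r
        -- At `I` both windows have reached `w`. Without an exchange they still differ by the
        -- leading letter, so `L r` would be the identity.
        search zero i eq r<i ph _ = ⊥-elim (s≉[] (L r) (≈-sym (≈-trans (≈-sym (inverseʳ w)) (≈-trans (++-congʳ (reverse w) w≈) (++-congˡ [ L r ] (inverseʳ w))))))
          where
          i≡I : i ≡ I
          i≡I = trans (sym (+-identityʳ i)) eq
          w≈ : w ≈ L r ∷ w
          w≈ = ≈-trans (≈-sym at₀) (≈-trans (extends (ph I (subst (r <_) i≡I r<i) (≤-reflexive (sym i≡I)))) (++-congˡ [ L r ] at₁))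
        search (suc d) i eq r<i ph same with phase-step r<i (ph i r<i ≤-refl)
        ... | inj₁ (e , ph') = search d (suc i) (trans (sym (+-suc i d)) eq) (m<n⇒m<1+n r<i) ph⁺ same⁺
          where
          ph⁺ : ∀ j → r < j → j ≤ suc i → Phase₁ r j
          ph⁺ j r<j j≤ with m≤n⇒m<n∨m≡n j≤
          ... | inj₁ j< = ph j r<j (≤-pred j<)
          ... | inj₂ refl = ph'
          same⁺ : ∀ j → r < j → j < suc i → g r j ≡ g (suc r) j
          same⁺ j r<j j< with m≤n⇒m<n∨m≡n (≤-pred j<)
          ... | inj₁ j<' = same j r<j j<'
          ... | inj₂ refl = e
        ... | inj₂ (gr , gr' , comm) = record
          { p = i ; r<p = r<i ; phase₁ = ph ; same = same⁺ ; g-p = gr ; g'-p = gr' ; commutes = comm ; phase₂ = after }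
          where
          first : pr r (suc i) ≈ pr (suc r) (suc i)
          first = ≈-trans (≈-reflexive (pr-skip r i gr)) (≈-trans (extends (ph i r<i ≤-refl)) (≈-trans comm (≈-reflexive (sym (pr-take (suc r) i gr')))))
          after : ∀ j → i < j → pr r j ≈ pr (suc r) j
          after j i<j = subst (λ z → pr r z ≈ pr (suc r) z) (m∸n+n≡m i<j) (later i r<i first (j ∸ suc i))
          same⁺ : ∀ j → r < j → j ≢ i → g r j ≡ g (suc r) j
          same⁺ j r<j j≢i with <-cmp j i
          ... | tri< j<i _ _ = same j r<j j<i
          ... | tri≈ _ eq _ = ⊥-elim (j≢i eq)
          ... | tri> _ _ i<j = proj₁ (phase₂-step r<j (after j i<j))

    p : ℕ → ℕ
    p r = Arc.p (arc r)

    g-suc : ∀ r i → g r i ≡ true → r < i → g (suc r) i ≡ true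
    g-suc r i h r<i with i ≟ p r
    ... | yes refl with () ← trans (sym h) (Arc.g-p (arc r))
    ... | no i≢p = trans (sym (Arc.same (arc r) i r<i i≢p)) h

    g-mono : ∀ {r i} k → g r i ≡ true → k + r ≤ i → g (k + r) i ≡ true
    g-mono zero h _ = h
    g-mono {r} {i} (suc k) h le = g-suc (k + r) i (g-mono k h (<⇒≤ le)) le

    g-mono-≤ : ∀ {r r' i} → g r i ≡ true → r ≤ r' → r' ≤ i → g r' i ≡ true
    g-mono-≤ {r} {r'} {i} h r≤r' r'≤i = subst (λ z → g z i ≡ true) (m∸n+n≡m r≤r') (g-mono (r' ∸ r) h (subst (_≤ i) (sym (m∸n+n≡m r≤r')) r'≤i))

    -- Window `r + N` also takes i + N by monotonicity, and periodicity shifts this back by one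
    -- copy.
    nested : ∀ {r i} → r ≤ i → g r (i + N) ≡ true → g r i ≡ true
    nested {r} {i} r≤i h = trans (sym (g-periodic r i)) (g-mono-≤ h (m≤m+n r N) (+-monoˡ-≤ N r≤i))

    r<p : ∀ r → r < p r
    r<p r = Arc.r<p (arc r)

    -- In its first period a window takes every position, since a letter not yet used is an ascent.
    p-far : ∀ r → r + N ≤ p r
    p-far r = ≮⇒≥ λ lt → false≢true (trans (sym (Arc.g-p (arc r))) (first-copy (<⇒≤ (r<p r)) lt))
      where
      false≢true : false ≢ true
      false≢true ()

    p-unique : ∀ {r i} → r < i → g r i ≡ false → g (suc r) i ≡ true → i ≡ p r
    p-unique {r} {i} r<i h h' with i ≟ p r
    ... | yes eq = eq
    ... | no neq with () ← trans (sym h) (trans (Arc.same (arc r) i r<i neq) h')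

    p-shift : ∀ r → p (r + N) ≡ p r + N
    p-shift r = sym (p-unique (+-monoˡ-< N (r<p r)) (trans (g-periodic r (p r)) (Arc.g-p (arc r))) (trans (g-periodic (suc r) (p r)) (Arc.g'-p (arc r))))

    -- Going back copy by copy, `nested` would make window `r` take `p r`, which it skips.
    row-end : ∀ r i → p r < i → g r i ≡ true → L i ≢ L (p r)
    row-end r i = go i i ≤-refl
      where
      go : ∀ b i → i ≤ b → p r < i → g r i ≡ true → L i ≢ L (p r)
      go zero i i≤ lt _ _ with () ← <-≤-trans lt i≤
      go (suc b) i i≤ lt h eq with i <? p r + N
      ... | yes i< = L-distinct lt i< (sym eq)
      ... | no i≮ = again (m≤n⇒m<n∨m≡n p≤i')
        where
        i' = i ∸ N
        i'+N : i' + N ≡ i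
        i'+N = m∸n+n≡m (≤-trans (m≤n+m N (p r)) (≮⇒≥ i≮))
        p≤i' : p r ≤ i'
        p≤i' = +-cancelʳ-≤ N (p r) i' (subst (p r + N ≤_) (sym i'+N) (≮⇒≥ i≮))
        h' : g r i' ≡ true
        h' = nested (≤-trans (<⇒≤ (r<p r)) p≤i') (subst (λ z → g r z ≡ true) (sym i'+N) h)
        again : p r < i' ⊎ p r ≡ i' → ⊥
        again (inj₁ lt') = go b i' (≤-pred (≤-trans (subst (suc i' ≤_) i'+N (subst (_≤ i' + N) (+-comm i' 1) (+-monoʳ-≤ i' (s≤s z≤n)))) i≤)) lt' h' (trans (sym (L-periodic i')) (trans (cong L i'+N) eq))
        again (inj₂ e) with () ← trans (sym (Arc.g-p (arc r))) (subst (λ z → g r z ≡ true) (sym e) h')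

    -- The exchange adds `L r` as an inversion of window `r + 1`. A later letter could remove it
    -- only by having `L r` as its own reflection, but then it would be a descent and would not be
    -- taken.
    after-inv : ∀ r k → η (pr (suc r) (k + suc (p r))) [ L r ] ≡ true
    after-inv r zero = trans (cong (λ z → η z [ L r ]) (pr-take (suc r) (p r) (Arc.g'-p A))) (trans (η-++ v [ L (p r) ] [ L r ])
        (cong₂ _xor_ (no-inv (Arc.phase₁ A (p r) (r<p r) ≤-refl)) (trans (xor-identityʳ _) (≈?-true conj≈))))
      where
      A = arc r
      v = pr (suc r) (p r)
      conj≈ : [ L (p r) ] ≈ conj v [ L r ]
      conj≈ = ≈-sym (≈-trans (≈-reflexive (conj-≡ v [ L r ])) (≈-trans (++-congˡ (reverse v) (Arc.commutes A)) (cancelˡ v [ L (p r) ])))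
    after-inv r (suc k) with g (suc r) (k + suc (p r)) in h
    ... | false = after-inv r k
    ... | true = trans (η-++ u [ b ] [ L r ]) (cong₂ _xor_ (after-inv r k) (trans (xor-identityʳ _) (≈?-false absurd)))
      where
      u = pr (suc r) (k + suc (p r))
      b = L (k + suc (p r))
      absurd : ¬ [ b ] ≈ conj u [ L r ]
      absurd q with () ← trans (sym (g⇒ascent (suc r) (k + suc (p r)) h)) (trans (η-congʳ u (ρ≈ u q)) (after-inv r k))

    after-inv-< : ∀ {r i} → p r < i → η (pr (suc r) i) [ L r ] ≡ true
    after-inv-< {r} {i} lt = subst (λ z → η (pr (suc r) z) [ L r ] ≡ true) (m∸n+n≡m lt) (after-inv r (i ∸ suc (p r)))

    -- Commutation behind the exchange position

    Apart : ℕ → ℕ → Set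
    Apart r i = g r i ≡ true → ¬ 3 ≤ m M (L (p r)) (L i)

    -- Once the exchange has happened, `L (p r)` slides to the right past the letters that window
    -- `r` still takes.
    commutes-after : ∀ r k → (∀ i → p r < i → i < k + suc (p r) → Apart r i) →
      L r ∷ pr r (k + suc (p r)) ≈ pr r (k + suc (p r)) ++ [ L (p r) ]
    commutes-after r zero _ = begin
      s ∷ pr r (suc (p r))        ≡⟨ cong (s ∷_) (pr-skip r (p r) (Arc.g-p A)) ⟩
      s ∷ pr r (p r)              ∼⟨ ++-congˡ [ s ] ext ⟩
      s ∷ s ∷ v                   ∼⟨ ss≈ s v ⟩
      v                           ∼⟨ snoc² v a ⟨
      (v ++ [ a ]) ++ [ a ]       ∼⟨ ++-congʳ [ a ] (Arc.commutes A) ⟨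
      (s ∷ v) ++ [ a ]            ∼⟨ ++-congʳ [ a ] ext ⟨
      pr r (p r) ++ [ a ]         ≡⟨ cong (_++ [ a ]) (pr-skip r (p r) (Arc.g-p A)) ⟨
      pr r (suc (p r)) ++ [ a ]   ∎
      where
      open ≈-Reasoning
      A = arc r
      s = L r
      a = L (p r)
      v = pr (suc r) (p r)
      ext : pr r (p r) ≈ s ∷ v
      ext = extends (Arc.phase₁ A (p r) (r<p r) ≤-refl)
    commutes-after r (suc k) H with g r (k + suc (p r)) in h
    ... | false = commutes-after r k (λ i p q → H i p (m<n⇒m<1+n q))
    ... | true = begin
      L r ∷ u ++ [ b ]              ∼⟨ ++-congʳ [ b ] (commutes-after r k (λ i p q → H i p (m<n⇒m<1+n q))) ⟩
      (u ++ [ a ]) ++ [ b ]         ≡⟨ ++-assoc u [ a ] [ b ] ⟩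
      u ++ a ∷ [ b ]                ∼⟨ ++-congˡ u (commuting≈ a b (H (k + suc (p r)) (m≤n+m (suc (p r)) k) ≤-refl h)) ⟩
      u ++ b ∷ [ a ]                ≡⟨ ++-assoc u [ b ] [ a ] ⟨
      (u ++ [ b ]) ++ [ a ]         ∎
      where
      open ≈-Reasoning
      u = pr r (k + suc (p r))
      a = L (p r)
      b = L (k + suc (p r))

    commutes-after-< : ∀ {r k} → p r < k → (∀ i → p r < i → i < k → Apart r i) → L r ∷ pr r k ≈ pr r k ++ [ L (p r) ]
    commutes-after-< {r} {k} lt H = subst (λ z → L r ∷ pr r z ≈ pr r z ++ [ L (p r) ]) eq
        (commutes-after r (k ∸ suc (p r)) (λ i q q' → H i q (subst (i <_) eq q')))
      where
      eq : (k ∸ suc (p r)) + suc (p r) ≡ k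
      eq = m∸n+n≡m lt

    -- the root of position i in window j, as a linear map
    β : ℕ → ℕ → Fun → V
    β j i f = act (pr j i) (α (L i) f)

    -- In front of `p j` the words differ by the leading letter `L j`. Behind it they represent the
    -- same element, and moving `L j` through the word gives `L (p j)`, which fixes the simple root
    -- over `L i` as the two letters are distinct and commute.
    β-step : ∀ {j i} → j < i → g j i ≡ true → (∀ i' → p j < i' → i' ≤ i → Apart j i') →
      ∀ f → β j i f ≗ act₁ (L j) (β (suc j) i f)
    β-step {j} {i} j<i h H f with <-cmp i (p j)
    ... | tri< i<p _ _ = act-≈ (extends (Arc.phase₁ (arc j) i j<i (<⇒≤ i<p))) (α (L i) f)
    ... | tri≈ _ refl _ with () ← trans (sym h) (Arc.g-p (arc j))
    β-step {j} {i} j<i h H f | tri> _ _ p<i = ≗-sym (≗-trans (act₁-cong (L j) (act-≈ (≈-sym (Arc.phase₂ (arc j) i p<i)) (α b f)))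
        (≗-trans (act-≈ (commutes-after-< p<i (λ i' q q' → H i' q (<⇒≤ q'))) (α b f))
        (≗-trans (act-++≗ (pr j i) [ a ] (α b f))
        (act-cong (pr j i) (act₁-α-commuting f (row-end j i p<i h ∘ sym) (H i p<i ≤-refl h))))))
      where
      a = L (p j)
      b = L i

    cyc : ℕ → List (Fin n)
    cyc j = seg L j N

    tail-cyc : ℕ → List (Fin n)
    tail-cyc j = seg L (suc j) N₁

    cyc-suc : ∀ j → cyc (suc j) ≡ tail-cyc j ++ [ L j ]
    cyc-suc j = trans (seg-snoc L (suc j) N₁) (cong (λ z → tail-cyc j ++ [ z ]) (trans (cong L (sym (+-suc j N₁))) (L-periodic j)))

    L∉tail : ∀ j → L j ∉ tail-cyc j
    L∉tail j L∈ with ∈-seg L (suc j) N₁ L∈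
    ... | i , j<i , i< , eq = L-distinct j<i (subst (i <_) (sym (+-suc j N₁)) i<) (sym eq)

    E-window : ∀ j x y → E (cyc (suc j)) x y ≡ E (cyc j) (act₁ (L j) x) (act₁ (L j) y)
    E-window j x y = trans (cong (λ c → E c x y) (cyc-suc j)) (sym (E-rotate (L j) (tail-cyc j) x y (L-order j) (L∉tail j)))

    E-chain : ∀ {i₁ i₂} j k (f₁ f₂ : Fun) →
      (∀ j' → j ≤ j' → j' < j + k → (∀ f → β j' i₁ f ≗ act₁ (L j') (β (suc j') i₁ f)) × (∀ f → β j' i₂ f ≗ act₁ (L j') (β (suc j') i₂ f))) →
      E (cyc j) (β j i₁ f₁) (β j i₂ f₂) ≡ E (cyc (j + k)) (β (j + k) i₁ f₁) (β (j + k) i₂ f₂)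
    E-chain {i₁} {i₂} j zero f₁ f₂ H = cong (λ z → E (cyc z) (β z i₁ f₁) (β z i₂ f₂)) (sym (+-identityʳ j))
    E-chain {i₁} {i₂} j (suc k) f₁ f₂ H = begin
      E (cyc j) (β j i₁ f₁) (β j i₂ f₂)
        ≡⟨ E-cong (cyc j) (proj₁ (H j ≤-refl j<) f₁) (proj₂ (H j ≤-refl j<) f₂) ⟩
      E (cyc j) (act₁ (L j) (β (suc j) i₁ f₁)) (act₁ (L j) (β (suc j) i₂ f₂))
        ≡⟨ E-window j _ _ ⟨
      E (cyc (suc j)) (β (suc j) i₁ f₁) (β (suc j) i₂ f₂)
        ≡⟨ E-chain {i₁} {i₂} (suc j) k f₁ f₂ (λ j' p q → H j' (<⇒≤ p) (subst (j' <_) (sym (+-suc j k)) q)) ⟩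
      E (cyc (suc j + k)) (β (suc j + k) i₁ f₁) (β (suc j + k) i₂ f₂)
        ≡⟨ cong (λ z → E (cyc z) (β z i₁ f₁) (β z i₂ f₂)) (sym (+-suc j k)) ⟩
      E (cyc (j + suc k)) (β (j + suc k) i₁ f₁) (β (j + suc k) i₂ f₂) ∎
      where
      open ≡-Reasoning
      j< : j < j + suc k
      j< = m<m+n j (s≤s z≤n)

    -- The Euler form of the roots x of q = p r and y of i is computed in window r + 1, where x is a multiple of the last
    -- simple root s, and in window q, where it is the first simple root a.
    module Contradiction {r i : ℕ} (p<i : p r < i) (i<p+N : i < p r + N) (gi : g r i ≡ true) (3≤ : 3 ≤ m M (L (p r)) (L i))
      (H : ∀ j → r < j → j < p r → ∀ i' → p j < i' → i' ≤ i → Apart j i') where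
      open import Data.Integer using (0ℤ; 1ℤ; +≤+) renaming (_+_ to _+ᶻ_; -_ to -ᶻ_; _≤_ to _≤ᶻ_)
      import Data.Integer.Properties as ℤₚ

      q = p r
      s = L r
      a = L q
      b = L i

      r<i : r < i
      r<i = <-trans (r<p r) p<i

      gi' : ∀ j → r ≤ j → j ≤ i → g j i ≡ true
      gi' j r≤j j≤i = g-mono-≤ gi r≤j j≤i

      gq : ∀ j → r < j → j ≤ q → g j q ≡ true
      gq j r<j j≤q = g-mono-≤ (Arc.g'-p (arc r)) r<j j≤q

      chain : ∀ {i₁ i₂} → (i₁ ≡ q × i₂ ≡ i) ⊎ (i₁ ≡ i × i₂ ≡ q) → ∀ f₁ f₂ →
        E (cyc (suc r)) (β (suc r) i₁ f₁) (β (suc r) i₂ f₂) ≡ E (cyc q) (β q i₁ f₁) (β q i₂ f₂)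
      chain {i₁} {i₂} which f₁ f₂ = trans (E-chain {i₁} {i₂} (suc r) (q ∸ suc r) f₁ f₂ (λ j p' q' → steps j p' (subst (j <_) eq q') which))
          (cong (λ z → E (cyc z) (β z i₁ f₁) (β z i₂ f₂)) eq)
        where
        eq : suc r + (q ∸ suc r) ≡ q
        eq = m+[n∸m]≡n (r<p r)
        steps : ∀ j → r < j → j < q → (i₁ ≡ q × i₂ ≡ i) ⊎ (i₁ ≡ i × i₂ ≡ q) →
          (∀ f → β j i₁ f ≗ act₁ (L j) (β (suc j) i₁ f)) × (∀ f → β j i₂ f ≗ act₁ (L j) (β (suc j) i₂ f))
        steps j r<j j<q which = choose which
          where
          atq : ∀ f → β j q f ≗ act₁ (L j) (β (suc j) q f)
          atq = β-step j<q (gq j r<j (<⇒≤ j<q)) (λ i' p' q' → H j r<j j<q i' p' (≤-trans q' (<⇒≤ p<i)))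
          ati : ∀ f → β j i f ≗ act₁ (L j) (β (suc j) i f)
          ati = β-step (<-trans j<q p<i) (gi' j (<⇒≤ r<j) (<⇒≤ (<-trans j<q p<i))) (H j r<j j<q)
          choose : (i₁ ≡ q × i₂ ≡ i) ⊎ (i₁ ≡ i × i₂ ≡ q) →
            (∀ f → β j i₁ f ≗ act₁ (L j) (β (suc j) i₁ f)) × (∀ f → β j i₂ f ≗ act₁ (L j) (β (suc j) i₂ f))
          choose (inj₁ (refl , refl)) = atq , ati
          choose (inj₂ (refl , refl)) = ati , atq

      -- Indices 0 and 1 are adjacent by `X-δ`, so `δ 0` over `b` is seen by `δ 1` over `a`.
      f : Fun
      f = δ 1

      x y γ : V
      x = β (suc r) q f
      y = β (suc r) i (δ 0)
      γ = β q i (δ 0)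

      βq : ∀ f → β q q f ≗ α a f
      βq f u k = cong (λ z → act z (α a f) u k) (pr-start q q ≤-refl)

      -- At the exchange s v = v a, and `a` negates its own simple roots. Hence `x` lives over `s`
      -- alone.
      sx : act₁ s x ≗ λ u k → -ᶻ x u k
      sx = ≗-trans (act-≈ (Arc.commutes (arc r)) (α a f)) (≗-trans (act-++≗ v [ a ] (α a f))
        (≗-trans (act-cong v (≗-trans (act₁-α-self a f) (α-neg a f))) (act-neg v (α a f))))
        where
        v = pr (suc r) q

      sup-sx : Supported s (act₁ s x)
      sup-sx u u≢s k = trans (act₁-other x u≢s k) (negated⇒Supported s sx u u≢s k)

      x≥0 : Positive x
      x≥0 = positive (pr (suc r) q) a (g⇒ascent (suc r) q (Arc.g'-p (arc r))) (δ-nonneg 1)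

      ascent-i : D (pr (suc r) i) b ≡ false
      ascent-i = g⇒ascent (suc r) i (gi' (suc r) (n≤1+n r) r<i)

      y≥0 : Positive y
      y≥0 = positive (pr (suc r) i) b ascent-i (δ-nonneg 0)

      -- Since i lies behind the exchange, `s` is already an inversion of the word of window
      -- `r + 1`, so it is not the reflection of the ascent `b`, and prepending `s` keeps `b` an
      -- ascent.
      sy≥0 : Positive (act₁ s y)
      sy≥0 = positive (s ∷ pr (suc r) i) b (trans (D-∷ s (pr (suc r) i) b) (cong₂ _xor_ (≈?-false absurd) ascent-i)) (δ-nonneg 0)
        where
        absurd : ¬ [ s ] ≈ ρ (pr (suc r) i) b
        absurd e with () ← trans (sym ascent-i) (trans (η-congʳ (pr (suc r) i) (≈-sym e)) (after-inv-< p<i))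

      γ≥0 : Positive γ
      γ≥0 = positive (pr q i) b (g⇒ascent q i (gi' q (<⇒≤ (r<p r)) (<⇒≤ p<i))) (δ-nonneg 0)

      -- Within its first period window `q` has not met the letter `b` before `i`; this is where i <
      -- q + N is used.
      γ-b : γ b ≐ δ 0
      γ-b k = trans (act-∉ (pr q i) (α b (δ 0)) (fresh q i i<p+N) k) (α-same b (δ 0) k)

      neg≤0 : ∀ {z} → 0ℤ ≤ᶻ z → -ᶻ z ≤ᶻ 0ℤ
      neg≤0 h = ℤₚ.neg-mono-≤ h

      -- `E-firstˡ` applies at both ends of the chain: to the simple root over `a` in window `q`,
      -- and to `act₁ s x` in window `r`. The sign comes from `sx`.
      first : ⟨ f , γ a ⟩ ≤ᶻ 0ℤ
      first = subst (_≤ᶻ 0ℤ) (sym eq) (neg≤0 (⟨⟩-nonneg (x≥0 s) (sy≥0 s)))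
        where
        open ≡-Reasoning
        eq : ⟨ f , γ a ⟩ ≡ -ᶻ ⟨ x s , act₁ s y s ⟩
        eq = begin
          ⟨ f , γ a ⟩                                  ≡⟨ ⟨⟩-cong {g = γ a} (λ k → sym (α-same a f k)) (λ _ → refl) ⟩
          ⟨ α a f a , γ a ⟩                            ≡⟨ E-firstˡ a (tail-cyc q) γ (L∉tail q) (Supported-α a f) ⟨
          E (cyc q) (α a f) γ                          ≡⟨ E-cong (cyc q) {y = γ} (≗-sym (βq f)) ≗-refl ⟩
          E (cyc q) (β q q f) γ                        ≡⟨ chain (inj₁ (refl , refl)) f (δ 0) ⟨
          E (cyc (suc r)) x y                          ≡⟨ E-window r x y ⟩
          E (cyc r) (act₁ s x) (act₁ s y)              ≡⟨ E-firstˡ s (tail-cyc r) (act₁ s y) (L∉tail r) sup-sx ⟩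
          ⟨ act₁ s x s , act₁ s y s ⟩                  ≡⟨ ⟨⟩-cong {g = act₁ s y s} (sx s) (λ _ → refl) ⟩
          ⟨ (λ k → -ᶻ x s k) , act₁ s y s ⟩            ≡⟨ ⟨⟩-negˡ (x s) (act₁ s y s) ⟩
          -ᶻ ⟨ x s , act₁ s y s ⟩                      ∎

      -- With the arguments exchanged, `E-firstʳ` brings in a reflection at either end: it undoes
      -- the one on `y` and replaces `γ` by `act₁ a γ`.
      second : ⟨ act₁ a γ a , f ⟩ ≤ᶻ 0ℤ
      second = subst (_≤ᶻ 0ℤ) (sym (trans (sym (ℤₚ.neg-involutive _)) (cong -ᶻ_ eq))) (neg≤0 (⟨⟩-nonneg (y≥0 s) (x≥0 s)))
        where
        open ≡-Reasoning
        eq : -ᶻ ⟨ act₁ a γ a , f ⟩ ≡ ⟨ y s , x s ⟩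
        eq = begin
          -ᶻ ⟨ act₁ a γ a , f ⟩                        ≡⟨ cong -ᶻ_ (⟨⟩-cong {f = act₁ a γ a} (λ _ → refl) (λ k → sym (α-same a f k))) ⟩
          -ᶻ ⟨ act₁ a γ a , α a f a ⟩                  ≡⟨ E-firstʳ a (tail-cyc q) γ (L-order q) (L∉tail q) (Supported-α a f) ⟨
          E (cyc q) γ (α a f)                          ≡⟨ E-cong (cyc q) {x = γ} ≗-refl (≗-sym (βq f)) ⟩
          E (cyc q) γ (β q q f)                        ≡⟨ chain (inj₂ (refl , refl)) (δ 0) f ⟨
          E (cyc (suc r)) y x                          ≡⟨ E-window r y x ⟩
          E (cyc r) (act₁ s y) (act₁ s x)              ≡⟨ E-firstʳ s (tail-cyc r) (act₁ s y) (L-order r) (L∉tail r) sup-sx ⟩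
          -ᶻ ⟨ act₁ s (act₁ s y) s , act₁ s x s ⟩      ≡⟨ cong -ᶻ_ (⟨⟩-cong (act₁-involutive s y s) (sx s)) ⟩
          -ᶻ ⟨ y s , (λ k → -ᶻ x s k) ⟩                ≡⟨ cong -ᶻ_ (⟨⟩-negʳ (y s) (x s)) ⟩
          -ᶻ (-ᶻ ⟨ y s , x s ⟩)                        ≡⟨ ℤₚ.neg-involutive _ ⟩
          ⟨ y s , x s ⟩                                ∎

      sum : ⟨ f , κ a γ ⟩ ≡ ⟨ act₁ a γ a , f ⟩ +ᶻ ⟨ f , γ a ⟩
      sum = begin
        ⟨ f , κ a γ ⟩                                  ≡⟨ ⟨⟩-cong {f = f} (λ _ → refl) (λ k → split k) ⟩
        ⟨ f , (λ k → act₁ a γ a k +ᶻ γ a k) ⟩          ≡⟨ ⟨⟩-+ʳ f (act₁ a γ a) (γ a) ⟩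
        ⟨ f , act₁ a γ a ⟩ +ᶻ ⟨ f , γ a ⟩              ≡⟨ cong (_+ᶻ ⟨ f , γ a ⟩) (⟨⟩-comm f (act₁ a γ a)) ⟩
        ⟨ act₁ a γ a , f ⟩ +ᶻ ⟨ f , γ a ⟩              ∎
        where
        open ≡-Reasoning
        open import Data.Integer.Tactic.RingSolver using (solve-∀)
        lem : ∀ u v → v ≡ (-ᶻ u +ᶻ v) +ᶻ u
        lem = solve-∀
        split : ∀ k → κ a γ k ≡ act₁ a γ a k +ᶻ γ a k
        split k = trans (lem (γ a k) (κ a γ k)) (cong (_+ᶻ γ a k) (sym (act₁-same a γ k)))

      contradiction : ⊥
      contradiction = absurd (ℤₚ.≤-trans lower (subst (_≤ᶻ 0ℤ) (sym sum) (ℤₚ.+-mono-≤ second first)))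
        where
        Xγ≥0 : ∀ u → NonNeg (X a u (γ u))
        Xγ≥0 u = Path.X-nonneg (size a u) (γ≥0 u)
        -- All generators contribute nonnegatively, and `b` alone contributes 1 at index 1.
        lower : 1ℤ ≤ᶻ ⟨ f , κ a γ ⟩
        lower = ℤₚ.≤-trans (ℤₚ.≤-reflexive (sym (trans (X-cong a b γ-b 1) (X-δ a b 3≤))))
          (ℤₚ.≤-trans (lsum-≥ (allFin n) Xγ≥0 (∈-allFin b) 1) (⟨δ,⟩-≥ (lsum-nonneg (allFin n) Xγ≥0) (1<bound a b 3≤)))
        absurd : ¬ 1ℤ ≤ᶻ 0ℤ
        absurd (+≤+ ())

    -- Induction on the distance from `r` to `i`. The windows that `Contradiction` asks about start
    -- after `r`, so the same positions are closer to them. A position beyond the first period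
    -- behind `p r` is moved back by `N`, which also shortens the distance; should it land on `p r`,
    -- the two letters are equal.
    apart-within : ∀ d r i → i ≤ r + d → p r < i → Apart r i
    apart-within zero r i i≤ p<i _ _ = <⇒≱ (<-trans (r<p r) p<i) (subst (i ≤_) (+-identityʳ r) i≤)
    apart-within (suc d) r i i≤ p<i gi 3≤ with i <? p r + N
    ... | yes i< = Contradiction.contradiction p<i i< gi 3≤ (λ j r<j j<q i' p' q' → apart-within d j i'
                     (≤-trans q' (≤-trans i≤ (≤-trans (≤-reflexive (+-suc r d)) (+-monoˡ-≤ d r<j)))) p')
    ... | no i≮ = earlier (m≤n⇒m<n∨m≡n p≤i')
      where
      i' = i ∸ N
      i'+N : i' + N ≡ i
      i'+N = m∸n+n≡m (≤-trans (m≤n+m N (p r)) (≮⇒≥ i≮))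
      p≤i' : p r ≤ i'
      p≤i' = +-cancelʳ-≤ N (p r) i' (subst (p r + N ≤_) (sym i'+N) (≮⇒≥ i≮))
      Li : L i ≡ L i'
      Li = trans (cong L (sym i'+N)) (L-periodic i')
      i'≤ : i' ≤ r + d
      i'≤ = ≤-pred (≤-trans (subst (suc i' ≤_) i'+N (subst (_≤ i' + N) (+-comm i' 1) (+-monoʳ-≤ i' (s≤s z≤n)))) (subst (i ≤_) (+-suc r d) i≤))
      earlier : p r < i' ⊎ p r ≡ i' → ⊥
      earlier (inj₁ lt) = apart-within d r i' i'≤ lt (nested (≤-trans (<⇒≤ (r<p r)) p≤i') (subst (λ z → g r z ≡ true) (sym i'+N) gi)) (subst (λ z → 3 ≤ m M (L (p r)) z) Li 3≤)
      earlier (inj₂ e) with s≤s () ← subst (3 ≤_) (m-diag M (L (p r))) (subst (λ z → 3 ≤ m M (L (p r)) z) (trans Li (cong L (sym e))) 3≤)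

    apart : ∀ {r i} → p r < i → Apart r i
    apart {r} {i} = apart-within i r i (m≤n+m i r)

    -- The action of `p` on letters and on order

    ψ-letter : ∀ r → L r ∷ w ≈ w ++ [ L (p r) ]
    ψ-letter r = ≈-trans (++-congˡ [ L r ] (≈-sym full)) (≈-trans (commutes-after r I (λ i lt _ → apart lt)) (++-congʳ [ L (p r) ] full))
      where
      C = complete r
      I = proj₁ C
      full : pr r (I + suc (p r)) ≈ w
      full = subst (_≈ w) (sym (trans (cong (pr r) (+-comm I (suc (p r)))) (complete-stable (proj₁ (proj₂ C)) (proj₂ (proj₂ C)) (suc (p r))))) (proj₂ (proj₂ C))

    -- Window `r + 1` takes `p r`, hence so does window `q`. If `p r` were behind `p q`, its letter
    -- would commute with that of `p q`.
    p-order : ∀ {r q} → r < q → L (p r) ≢ L (p q) → q ≤ p r → 3 ≤ m M (L (p q)) (L (p r)) → p r < p q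
    p-order {r} {q} r<q L≢ q≤p 3≤ with <-cmp (p r) (p q)
    ... | tri< lt _ _ = lt
    ... | tri≈ _ e _ = ⊥-elim (L≢ (cong L e))
    ... | tri> _ _ gt = ⊥-elim (apart gt (g-mono-≤ (Arc.g'-p (arc r)) r<q q≤p) 3≤)

    -- Counting the copies in which a letter is taken

    L-multiple : ∀ i k → L (i + k * N) ≡ L i
    L-multiple i zero = cong L (+-identityʳ i)
    L-multiple i (suc k) = trans (cong L (trans (cong (i +_) (+-comm N (k * N))) (sym (+-assoc i (k * N) N)))) (trans (L-periodic (i + k * N)) (L-multiple i k))

    L-same : ∀ x {i} → i < N → L x ≡ L i → ∃ λ k → x ≡ i + k * N
    L-same x {i} i<N = go x x ≤-refl
      where
      go : ∀ b x → x ≤ b → L x ≡ L i → ∃ λ k → x ≡ i + k * N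
      go b x x≤b eq with <-cmp x i
      ... | tri≈ _ x≡i _ = 0 , trans x≡i (sym (+-identityʳ i))
      ... | tri< x<i _ _ = ⊥-elim (L-distinct x<i (<-≤-trans i<N (m≤n+m N x)) eq)
      go zero x x≤b eq | tri> _ _ i<x with () ← <-≤-trans i<x x≤b
      go (suc b) x x≤b eq | tri> _ _ i<x with x <? i + N
      ... | yes x< = ⊥-elim (L-distinct i<x x< (sym eq))
      ... | no x≮ = suc (proj₁ rest) , trans (sym x'+N) (trans (cong (_+ N) (proj₂ rest)) (trans (+-assoc i _ N) (cong (i +_) (+-comm (proj₁ rest * N) N))))
        where
        x' = x ∸ N
        x'+N : x' + N ≡ x
        x'+N = m∸n+n≡m (≤-trans (m≤n+m N i) (≮⇒≥ x≮))
        rest : ∃ λ k → x' ≡ i + k * N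
        rest = go b x' (≤-pred (≤-trans (subst (suc x' ≤_) x'+N (subst (_≤ x' + N) (+-comm x' 1) (+-monoʳ-≤ x' (s≤s z≤n)))) x≤b)) (trans (sym (L-periodic x')) (trans (cong L x'+N) eq))

    nested-* : ∀ i k → g 0 (i + k * N) ≡ true → g 0 i ≡ true
    nested-* i zero h = subst (λ z → g 0 z ≡ true) (+-identityʳ i) h
    nested-* i (suc k) h = nested-* i k (nested {0} {i + k * N} z≤n (subst (λ z → g 0 z ≡ true) (trans (cong (i +_) (+-comm N (k * N))) (sym (+-assoc i (k * N) N))) h))

    module Count (i₀ : ℕ) (i₀<N : i₀ < N) (k : ℕ) (inside : ∀ j → j < k → g 0 (i₀ + j * N) ≡ true) (outside : g 0 (i₀ + k * N) ≡ false) where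

      s : Fin n
      s = L i₀

      count-skip : ∀ i → L i ≢ s → φ (pr 0 (suc i)) s ≡ φ (pr 0 i) s
      count-skip i Li≢s with g 0 i
      ... | false = refl
      ... | true = trans (φ-snoc (pr 0 i) (L i) s) (trans (cong (φ (pr 0 i) s +_) (φ-other Li≢s)) (+-identityʳ _))

      count-take : ∀ i → L i ≡ s → g 0 i ≡ true → φ (pr 0 (suc i)) s ≡ suc (φ (pr 0 i) s)
      count-take i Li≡s h = trans (cong (λ z → φ z s) (pr-take 0 i h)) (trans (φ-snoc (pr 0 i) (L i) s) (trans (cong (φ (pr 0 i) s +_) (φ-same Li≡s)) (+-comm _ 1)))

      -- The position i₀ + j N is the first occurrence of `s` at or after `i`, so j occurrences lie
      -- before `i`, all of them taken since j ≤ k.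
      count-before : ∀ i j → j ≤ k → i ≤ i₀ + j * N → i₀ + j * N < i + N → φ (pr 0 i) s ≡ j
      count-before zero zero _ _ _ = refl
      count-before zero (suc j) _ _ lt = ⊥-elim (<⇒≱ lt (≤-trans (m≤m+n N (j * N)) (m≤n+m (suc j * N) i₀)))
      count-before (suc i) j j≤k i≤ lt with m≤n⇒m<n∨m≡n (≤-pred lt)
      ... | inj₁ lt' = trans (count-skip i (λ eq → L-distinct i≤ lt' (trans eq (sym (L-multiple i₀ j))))) (count-before i j j≤k (<⇒≤ i≤) lt')
      count-before (suc i) zero j≤k i≤ lt | inj₂ eq = ⊥-elim (<⇒≱ (subst (_< N) (sym (+-identityʳ i₀)) i₀<N) (subst (N ≤_) (sym eq) (m≤n+m N i)))
      count-before (suc i) (suc j) j≤k i≤ lt | inj₂ eq = trans (count-take i (trans (cong L i≡) (L-multiple i₀ j)) (subst (λ z → g 0 z ≡ true) (sym i≡) (inside j j≤k)))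
          (cong suc (count-before i j (<⇒≤ j≤k) (≤-reflexive i≡) (subst (_< i + N) i≡ (m<m+n i (s≤s z≤n)))))
        where
        i≡ : i ≡ i₀ + j * N
        i≡ = +-cancelʳ-≡ N i (i₀ + j * N) (trans (sym eq) (trans (cong (i₀ +_) (+-comm N (j * N))) (sym (+-assoc i₀ (j * N) N))))

      late : ∀ x → i₀ + k * N ≤ x → L x ≡ s → g 0 x ≡ false
      late x le Lx≡s with g 0 x in h
      ... | false = refl
      ... | true = ⊥-elim (contra (trans (sym outside) (nested-* (i₀ + k * N) (l ∸ k) (subst (λ z → g 0 z ≡ true) x≡ h))))
        where
        contra : false ≢ true
        contra ()
        l = proj₁ (L-same x i₀<N Lx≡s)
        x% : x ≡ i₀ + l * N
        x% = proj₂ (L-same x i₀<N Lx≡s)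
        k≤ : k ≤ l
        k≤ = *-cancelʳ-≤ k l N (+-cancelˡ-≤ i₀ _ _ (subst (i₀ + k * N ≤_) x% le))
        x≡ : x ≡ (i₀ + k * N) + (l ∸ k) * N
        x≡ = trans x% (trans (cong (λ z → i₀ + z * N) (sym (m+[n∸m]≡n k≤))) (trans (cong (i₀ +_) (*-distribʳ-+ N k (l ∸ k))) (sym (+-assoc i₀ (k * N) _))))

      count-after : ∀ d → φ (pr 0 (d + (i₀ + k * N))) s ≡ k
      count-after zero = count-before (i₀ + k * N) k ≤-refl ≤-refl (m<m+n _ (s≤s z≤n))
      count-after (suc d) = extend (d + (i₀ + k * N)) (m≤n+m (i₀ + k * N) d) (count-after d)
        where
        extend : ∀ x → i₀ + k * N ≤ x → φ (pr 0 x) s ≡ k → φ (pr 0 (suc x)) s ≡ k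
        extend x le ih with L x Finₚ.≟ s
        ... | no Lx≢s = trans (count-skip x Lx≢s) ih
        ... | yes Lx≡s = trans (cong (λ z → φ z s) (pr-skip 0 x (late x le Lx≡s))) ih

      count : (∃ λ I → ∀ d → w ≡ pr 0 (d + I)) → φ w s ≡ k
      count (I , w≡) = trans (cong (λ z → φ z s) (trans (w≡ (i₀ + k * N)) (cong (pr 0) (+-comm (i₀ + k * N) I)))) (count-after I)

    -- Window `r` skips `p r`, so window 0 does too. Window `r + 1` takes it, hence window `N` does
    -- because r < N, and by periodicity window 0 takes the position one copy earlier. So `p r` is
    -- the first copy of its letter that window 0 skips.
    p-copy : (∃ λ I → ∀ d → w ≡ pr 0 (d + I)) → ∀ r i₀ → r < N → i₀ < N → L (p r) ≡ L i₀ → p r ≡ i₀ + φ w (L i₀) * N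
    p-copy w≡ r i₀ r<N i₀<N eq = trans p≡ (cong (λ z → i₀ + z * N) (sym (Count.count i₀ i₀<N k inside outside w≡)))
      where
      k = proj₁ (L-same (p r) i₀<N eq)
      p≡ : p r ≡ i₀ + k * N
      p≡ = proj₂ (L-same (p r) i₀<N eq)
      N≤p : N ≤ p r
      N≤p = ≤-trans (m≤n+m N r) (p-far r)
      outside : g 0 (i₀ + k * N) ≡ false
      outside with g 0 (i₀ + k * N) in h
      ... | false = refl
      ... | true with () ← trans (sym (Arc.g-p (arc r))) (g-mono-≤ (subst (λ z → g 0 z ≡ true) (sym p≡) h) z≤n (<⇒≤ (r<p r)))
      previous : g 0 (p r ∸ N) ≡ true
      previous = trans (sym (g-periodic 0 (p r ∸ N))) (subst (λ z → g N z ≡ true) (sym (m∸n+n≡m N≤p)) (g-mono-≤ (Arc.g'-p (arc r)) r<N N≤p))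
      inside : ∀ j → j < k → g 0 (i₀ + j * N) ≡ true
      inside j j<k = nested-* (i₀ + j * N) (k ∸ suc j) (subst (λ z → g 0 z ≡ true) eq' previous)
        where
        eq' : p r ∸ N ≡ (i₀ + j * N) + (k ∸ suc j) * N
        eq' = +-cancelʳ-≡ N _ _ (begin
          p r ∸ N + N                              ≡⟨ m∸n+n≡m N≤p ⟩
          p r                                      ≡⟨ p≡ ⟩
          i₀ + k * N                               ≡⟨ cong (λ z → i₀ + z * N) (m+[n∸m]≡n j<k) ⟨
          i₀ + (suc j + (k ∸ suc j)) * N           ≡⟨ cong (λ z → i₀ + z * N) (+-comm 1 (j + (k ∸ suc j))) ⟩
          i₀ + ((j + (k ∸ suc j)) + 1) * N         ≡⟨ cong (i₀ +_) (*-distribʳ-+ N (j + (k ∸ suc j)) 1) ⟩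
          i₀ + ((j + (k ∸ suc j)) * N + (N + 0))   ≡⟨ cong₂ (λ y z → i₀ + (y + z)) (*-distribʳ-+ N j (k ∸ suc j)) (+-identityʳ N) ⟩
          i₀ + ((j * N + (k ∸ suc j) * N) + N)     ≡⟨ +-assoc i₀ _ N ⟨
          (i₀ + (j * N + (k ∸ suc j) * N)) + N     ≡⟨ cong (_+ N) (+-assoc i₀ (j * N) _) ⟨
          ((i₀ + j * N) + (k ∸ suc j) * N) + N     ∎)
          where open ≡-Reasoning

    -- By `ψ-letter` the letter at `p r` is ψ(ψ(s)), which is `s` since `w` is an involution.
    ψ-inverse : ∀ {s ψs} r → L r ≡ ψs → [ ψs ] ≈ reverse w ++ s ∷ w → L (p r) ≡ s
    ψ-inverse {s} {ψs} r refl e = letter-injective (begin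
      [ L (p r) ]                                      ∼⟨ cancelˡ w [ L (p r) ] ⟨
      reverse w ++ w ++ [ L (p r) ]                    ∼⟨ ++-congˡ (reverse w) (ψ-letter r) ⟨
      reverse w ++ [ L r ] ++ w                        ∼⟨ ++-congˡ (reverse w) (++-congʳ w e) ⟩
      reverse w ++ (reverse w ++ s ∷ w) ++ w           ∼⟨ ++-congˡ (reverse w) (++-congʳ w (++-congʳ (s ∷ w) reverse-longest)) ⟩
      reverse w ++ (w ++ s ∷ w) ++ w                   ≡⟨ cong (reverse w ++_) (++-assoc w (s ∷ w) w) ⟩
      reverse w ++ w ++ s ∷ w ++ w                     ∼⟨ cancelˡ w _ ⟩
      s ∷ w ++ w                                       ∼⟨ ++-congˡ (s ∷ w) reverse-longest ⟨
      s ∷ w ++ reverse w                               ∼⟨ ++-congˡ [ s ] (inverseʳ w) ⟩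
      [ s ]                                            ∎)
      where open ≈-Reasoning

    -- `p-order` is used for r < q and again for q < r + N, where `p-shift` identifies p (r + N).
    interleaving : ∀ {r q} → r < q → q < N → L (p r) ≢ L (p q) → 3 ≤ m M (L (p q)) (L (p r)) → p r < p q × p q < p r + N
    interleaving {r} {q} r<q q<N L≢ 3≤' =
        p-order r<q L≢ (≤-trans (<⇒≤ q<N) (≤-trans (m≤n+m N r) (p-far r))) 3≤'
      , subst (p q <_) (p-shift r) (p-order (<-≤-trans q<N (m≤n+m N r)) (λ e → L≢ (sym (trans e Lp))) (≤-trans (+-monoˡ-≤ N (<⇒≤ r<q)) (p-far q))
          (subst (3 ≤_) (trans (m-sym M (L (p q)) (L (p r))) (cong (λ z → m M z (L (p q))) (sym Lp))) 3≤'))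
      where
      Lp : L (p (r + N)) ≡ L (p r)
      Lp = trans (cong L (p-shift r)) (L-periodic (p r))

    module _ (w≡ : ∃ λ I → ∀ d → w ≡ pr 0 (d + I)) {s t ψs ψt : Fin n} (3≤ : 3 ≤ m M s t)
      (es : [ ψs ] ≈ reverse w ++ s ∷ w) (et : [ ψt ] ≈ reverse w ++ t ∷ w)
      {i j : ℕ} (i<j : i < j) (j<N : j < N) (Li : L i ≡ s) (Lj : L j ≡ t) {r q : ℕ} (r<q : r < q) (q<N : q < N) where

      private
        s≢t : s ≢ t
        s≢t refl with s≤s () ← subst (3 ≤_) (m-diag M s) 3≤

        at-s : ∀ {x} → x < N → L x ≡ ψs → p x ≡ i + φ w s * N
        at-s {x} x<N e = trans (p-copy w≡ x i x<N (<-trans i<j j<N) (trans (ψ-inverse x e es) (sym Li))) (cong (λ z → i + φ w z * N) Li)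

        at-t : ∀ {x} → x < N → L x ≡ ψt → p x ≡ j + φ w t * N
        at-t {x} x<N e = trans (p-copy w≡ x j x<N j<N (trans (ψ-inverse x e et) (sym Lj))) (cong (λ z → j + φ w z * N) Lj)

      equal-copies : L r ≡ ψs → L q ≡ ψt → φ w s ≡ φ w t
      equal-copies Lr Lq with interleaving r<q q<N (λ e → s≢t (trans (sym (ψ-inverse r Lr es)) (trans e (ψ-inverse q Lq et))))
                                (subst₂ (λ x y → 3 ≤ m M x y) (sym (ψ-inverse q Lq et)) (sym (ψ-inverse r Lr es)) (subst (3 ≤_) (m-sym M s t) 3≤))
      ... | lt , lt' = same-copies j<N i<j (subst₂ _<_ ps pt lt) (subst₂ (λ x y → x < y + N) pt ps lt')
        where
        ps = at-s (<-trans r<q q<N) Lr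
        pt = at-t q<N Lq

      next-copies : L r ≡ ψt → L q ≡ ψs → φ w s ≡ suc (φ w t)
      next-copies Lr Lq with interleaving r<q q<N (λ e → s≢t (trans (sym (ψ-inverse q Lq es)) (trans (sym e) (ψ-inverse r Lr et))))
                               (subst₂ (λ x y → 3 ≤ m M x y) (sym (ψ-inverse q Lq es)) (sym (ψ-inverse r Lr et)) 3≤)
      ... | lt , lt' = next-copy j<N i<j (subst₂ _<_ pt ps lt) (subst₂ (λ x y → x < y + N) ps pt lt')
        where
        pt = at-t (<-trans r<q q<N) Lr
        ps = at-s q<N Lq

-- The sorting word is the greedy word of window 0

module SortingWord where

  open CoxeterWords
  open Windows
  open import Data.Bool using (true; false; if_then_else_; not)
  open import Data.Nat using (ℕ; zero; suc; _+_; _*_; _∸_; _≤_; _<_; s≤s; z≤n)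
  open import Data.Nat.Properties
  open import Data.Nat.DivMod using (_/_; _%_; _mod_; m≡m%n+[m/n]*n; m%n<n; m<n⇒m%n≡m; [m+n]%n≡m%n; [m+kn]%n≡m%n; /-monoˡ-≤)
  open import Data.Fin as Fin using (Fin; toℕ)
  import Data.Fin.Properties as Finₚ
  open import Data.List using (List; []; _∷_; _++_; [_]; length; reverse; allFin; lookup; map)
  open import Data.List.Properties using (++-assoc; ++-identityʳ; map-++; ++-cancelˡ; ∷-injectiveˡ; ∷-injectiveʳ)
  open import Data.List.Membership.Propositional using (_∈_)
  open import Data.List.Membership.Propositional.Properties using (∈-allFin; ∈-++⁻; ∈-map⁻; ∈-++⁺ʳ; ∈-lookup)
  open import Data.List.Relation.Unary.Any.Properties using (lookup-index)
  open import Data.List.Relation.Unary.Any as Any using (Any; here; there)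
  open import Data.List.Relation.Unary.All as All using (All; []; _∷_)
  open import Data.List.Relation.Unary.AllPairs using ([]; _∷_)
  open import Data.List.Relation.Unary.Unique.Propositional using (Unique)
  open import Data.List.Relation.Unary.Unique.Propositional.Properties using (allFin⁺)
  open import Data.List.Relation.Binary.Permutation.Propositional using (_↭_; ↭-sym; ↭-trans; ↭-reflexive)
  open import Data.List.Relation.Binary.Permutation.Propositional.Properties using (∈-resp-↭; ++-comm)
  import Data.List.Relation.Binary.Permutation.Setoid.Properties as PermSetoid
  open import Data.Product using (∃; ∃₂; _×_; _,_; proj₁; proj₂)
  open import Data.Sum using (inj₁; inj₂)
  open import Data.Empty using (⊥-elim)
  open import Function using (_∘_)
  open import Relation.Nullary using (¬_; Dec)
  open import Relation.Nullary.Decidable using (map′; ¬¬-excluded-middle)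
  open import Relation.Nullary.Negation using (¬¬-map)
  open import Relation.Binary.PropositionalEquality using (_≡_; _≢_; refl; sym; trans; cong; cong₂; subst; subst₂; setoid)

  lookup-injective : ∀ {A : Set} {xs : List A} → Unique xs → ∀ {i j} → lookup xs i ≡ lookup xs j → i ≡ j
  lookup-injective {xs = x ∷ xs} (x∉ ∷ uq) {Fin.zero} {Fin.zero} eq = refl
  lookup-injective {xs = x ∷ xs} (x∉ ∷ uq) {Fin.zero} {Fin.suc j} eq = ⊥-elim (All.lookup x∉ (∈-lookup {xs = xs} j) eq)
  lookup-injective {xs = x ∷ xs} (x∉ ∷ uq) {Fin.suc i} {Fin.zero} eq = ⊥-elim (All.lookup x∉ (∈-lookup {xs = xs} i) (sym eq))
  lookup-injective {xs = x ∷ xs} (x∉ ∷ uq) {Fin.suc i} {Fin.suc j} eq = cong Fin.suc (lookup-injective uq eq)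

  before-indices : ∀ {n} {c : Word n} {s t} → Before c s t → ∃₂ λ i j → toℕ i < toℕ j × lookup c i ≡ s × lookup c j ≡ t
  before-indices {n} (u , v , refl , t∈) = go u
    where
    go : ∀ u → ∃₂ λ i j → toℕ i < toℕ j × lookup (u ++ _ ∷ v) i ≡ _ × lookup (u ++ _ ∷ v) j ≡ _
    go [] = Fin.zero , Fin.suc (Any.index t∈) , s≤s z≤n , refl , sym (lookup-index t∈)
    go (x ∷ u) with go u
    ... | i , j , lt , p , q = Fin.suc i , Fin.suc j , s≤s lt , p , q

  seg-lookup : ∀ {n} (L : ℕ → Fin n) j (xs : Word n) → (∀ i → L (j + toℕ i) ≡ lookup xs i) → seg L j (length xs) ≡ xs
  seg-lookup L j [] p = refl
  seg-lookup L j (x ∷ xs) p = cong₂ _∷_ (trans (cong L (sym (+-identityʳ j))) (p Fin.zero))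
    (seg-lookup L (suc j) xs (λ i → trans (cong L (sym (+-suc j (toℕ i)))) (p (Fin.suc i))))

  ¬¬-All : ∀ {A : Set} {P : A → Set} → (∀ x → ¬ ¬ P x) → ∀ xs → ¬ ¬ All P xs
  ¬¬-All p [] k = k []
  ¬¬-All p (x ∷ xs) k = p x λ px → ¬¬-All p xs λ pxs → k (px ∷ pxs)

  -- Double negation passes through finitely many instances of excluded middle only. Finiteness of
  -- the group supplies a list of representatives, and a table of decisions for its pairs settles
  -- all words.
  ¬¬-decidable-≈ : ∀ {n} (M : CoxeterMatrix n) → IsFinite M → ¬ ¬ (∀ u v → Dec (u ≈⟨ M ⟩ v))
  ¬¬-decidable-≈ M (reps , rep) = ¬¬-map decide (¬¬-All (λ x → ¬¬-All (λ y → ¬¬-excluded-middle) reps) reps)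
    where
    open Words M
    decide : All (λ x → All (λ y → Dec (x ≈ y)) reps) reps → ∀ u v → Dec (u ≈ v)
    decide table u v with All.lookupAny table (rep u) | rep v
    ... | row , x≈u | v∈ with All.lookupAny row v∈
    ...   | d , y≈v = map′ (λ p → ≈-trans (≈-sym x≈u) (≈-trans p y≈v)) (λ p → ≈-trans x≈u (≈-trans p (≈-sym y≈v))) d

  module Main {n : ℕ} (M : CoxeterMatrix n) (_≈?_ : ∀ u v → Dec (u ≈⟨ M ⟩ v))
    (x₀ : Fin n) (c' : Word n) (cox : IsCoxeterWord (x₀ ∷ c'))
    (P : List (Pos (x₀ ∷ c'))) (sorting : IsSortingWordW₀ M (x₀ ∷ c') P) where

    c : Word n
    c = x₀ ∷ c'

    N₁ : ℕ
    N₁ = length c'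

    unique : Unique c
    unique = PermSetoid.Unique-resp-↭ (setoid (Fin n)) (↭⇒↭ₛ (↭-sym cox)) (allFin⁺ n)
      where open import Data.List.Relation.Binary.Permutation.Propositional using (↭⇒↭ₛ)

    opaque
      L : ℕ → Fin n
      L i = lookup c (i mod suc N₁)

      L-lookup : ∀ i → L i ≡ lookup c (i mod suc N₁)
      L-lookup i = refl

    toℕ-mod : ∀ i → toℕ (i mod suc N₁) ≡ i % suc N₁
    toℕ-mod i = Finₚ.toℕ-fromℕ< (m%n<n i (suc N₁))

    L-% : ∀ {i j} → i % suc N₁ ≡ j % suc N₁ → L i ≡ L j
    L-% {i} {j} eq = trans (L-lookup i) (trans (cong (lookup c) (Finₚ.toℕ-injective (trans (toℕ-mod i) (trans eq (sym (toℕ-mod j)))))) (sym (L-lookup j)))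

    L-%⁻ : ∀ {i j} → L i ≡ L j → i % suc N₁ ≡ j % suc N₁
    L-%⁻ {i} {j} eq = trans (sym (toℕ-mod i)) (trans (cong toℕ (lookup-injective unique (trans (sym (L-lookup i)) (trans eq (L-lookup j))))) (toℕ-mod j))

    L-periodic : ∀ i → L (i + suc N₁) ≡ L i
    L-periodic i = L-% {i + suc N₁} {i} ([m+n]%n≡m%n i (suc N₁))

    L-distinct : ∀ {i j} → i < j → j < i + suc N₁ → L i ≢ L j
    L-distinct {i} {j} i<j j< eq = <⇒≱ j< (subst₂ _≤_ (sym i≡) (sym (m≡m%n+[m/n]*n j N)) bound)
      where
      N = suc N₁
      i≡ : i + N ≡ j % N + suc (i / N) * N
      i≡ = trans (cong (_+ N) (trans (m≡m%n+[m/n]*n i N) (cong (_+ (i / N) * N) (L-%⁻ {i} {j} eq)))) (trans (+-assoc (j % N) _ N) (cong (j % N +_) (+-comm _ N)))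
      quot : i / N < j / N
      quot = ≰⇒> λ le → <⇒≱ i<j (subst₂ _≤_ (sym (m≡m%n+[m/n]*n j N)) (sym (trans (m≡m%n+[m/n]*n i N) (cong (_+ (i / N) * N) (L-%⁻ {i} {j} eq)))) (+-monoʳ-≤ (j % N) (*-monoˡ-≤ N le)))
      bound : j % N + suc (i / N) * N ≤ j % N + (j / N) * N
      bound = +-monoʳ-≤ (j % N) (*-monoˡ-≤ N quot)

    L-toℕ : ∀ i → L (toℕ i) ≡ lookup c i
    L-toℕ i = trans (L-lookup (toℕ i)) (cong (lookup c) (Finₚ.toℕ-injective (trans (toℕ-mod (toℕ i)) (m<n⇒m%n≡m (Finₚ.toℕ<n i)))))

    L-order : ∀ j → seg L j (suc N₁) ↭ allFin n
    L-order zero = ↭-trans (↭-reflexive (seg-lookup L 0 c L-toℕ)) cox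
    L-order (suc j) = ↭-trans (↭-reflexive (trans (seg-snoc L (suc j) N₁) (cong (λ z → seg L (suc j) N₁ ++ [ z ]) (trans (cong L (sym (+-suc j N₁))) (L-periodic j)))))
      (↭-trans (++-comm (seg L (suc j) N₁) [ L j ]) (L-order j))

    L-all : ∀ j a → ∃ λ i → j ≤ i × i < j + suc N₁ × L i ≡ a
    L-all j a = ∈-seg L j (suc N₁) (∈-resp-↭ (↭-sym (L-order j)) (∈-allFin a))

    w : Word n
    w = letters c P

    open Greedy M _≈?_ w (proj₁ (proj₂ sorting)) N₁ L L-periodic L-distinct L-order L-all

    pos : ℕ → Pos c
    pos i = i / N , i mod N

    code : Pos c → ℕ
    code (k , j) = toℕ j + k * N

    code-pos : ∀ i → code (pos i) ≡ i
    code-pos i = trans (cong (_+ (i / N) * N) (toℕ-mod i)) (sym (m≡m%n+[m/n]*n i N))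

    L-code : ∀ x → L (code x) ≡ lookup c (proj₂ x)
    L-code (k , j) = trans (L-% {toℕ j + k * N} {toℕ j} ([m+kn]%n≡m%n (toℕ j) k N)) (L-toℕ j)

    pos-mono : ∀ {i j} → i < j → PosLt c (pos i) (pos j)
    pos-mono {i} {j} i<j with m≤n⇒m<n∨m≡n (/-monoˡ-≤ N (<⇒≤ i<j))
    ... | inj₁ lt = inj₁ lt
    ... | inj₂ eq = inj₂ (eq , +-cancelʳ-< ((i / N) * N) _ _ (subst₂ _<_ (sym (code-pos i)) (sym (trans (cong (λ z → toℕ (j mod N) + z * N) eq) (code-pos j))) i<j))

    code-mono : ∀ {x y} → PosLt c x y → code x < code y
    code-mono {k , i} {k' , j} (inj₁ lt) = <-≤-trans (+-monoˡ-< (k * N) (Finₚ.toℕ<n i)) (≤-trans (*-monoˡ-≤ N lt) (m≤n+m (k' * N) (toℕ j)))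
    code-mono {k , i} {k' , j} (inj₂ (refl , lt)) = +-monoˡ-< (k * N) lt

    taken : ℕ → List ℕ
    taken zero = []
    taken (suc i) = if g 0 i then taken i ++ [ i ] else taken i

    taken-< : ∀ i {x} → x ∈ taken i → x < i
    taken-< (suc i) x∈ with g 0 i
    ... | false = m<n⇒m<1+n (taken-< i x∈)
    ... | true with ∈-++⁻ (taken i) x∈
    ...   | inj₁ x∈' = m<n⇒m<1+n (taken-< i x∈')
    ...   | inj₂ (here refl) = ≤-refl

    taken-split : ∀ i k → ∃ λ R → taken (k + i) ≡ taken i ++ R × (∀ {x} → x ∈ R → i ≤ x)
    taken-split i zero = [] , sym (++-identityʳ _) , λ ()
    taken-split i (suc k) with taken-split i k
    ... | R , eq , ge with g 0 (k + i)
    ...   | false = R , eq , ge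
    ...   | true = R ++ [ k + i ] , trans (cong (_++ [ k + i ]) eq) (++-assoc (taken i) R _) , ge'
      where
      ge' : ∀ {x} → x ∈ R ++ [ k + i ] → i ≤ x
      ge' x∈ with ∈-++⁻ R x∈
      ... | inj₁ x∈R = ge x∈R
      ... | inj₂ (here refl) = m≤n+m i k

    Q : ℕ → List (Pos c)
    Q i = map pos (taken i)

    letters-Q : ∀ i → letters c (Q i) ≡ pr 0 i
    letters-Q zero = refl
    letters-Q (suc i) with g 0 i
    ... | false = letters-Q i
    ... | true = trans (cong (letters c) (map-++ pos (taken i) [ i ])) (trans (map-++ (λ x → lookup c (proj₂ x)) (Q i) [ pos i ]) (cong₂ (λ x y → x ++ [ y ]) (letters-Q i) (sym (L-lookup i))))

    Increasing-snoc : ∀ {xs y} → Increasing c xs → (∀ {x} → x ∈ xs → PosLt c x y) → Increasing c (xs ++ [ y ])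
    Increasing-snoc inc-nil lt = inc-one _
    Increasing-snoc (inc-one x) lt = inc-cons (lt (here refl)) (inc-one _)
    Increasing-snoc (inc-cons x<y inc) lt = inc-cons x<y (Increasing-snoc inc (lt ∘ there))

    Increasing-Q : ∀ i → Increasing c (Q i)
    Increasing-Q zero = inc-nil
    Increasing-Q (suc i) with g 0 i
    ... | false = Increasing-Q i
    ... | true = subst (Increasing c) (sym (map-++ pos (taken i) [ i ])) (Increasing-snoc (Increasing-Q i) lt)
      where
      lt : ∀ {x} → x ∈ Q i → PosLt c x (pos i)
      lt x∈ with ∈-map⁻ pos x∈
      ... | y , y∈ , refl = pos-mono (taken-< i y∈)

    Increasing-prefix : ∀ u {x v} → Increasing c (u ++ x ∷ v) → ∀ {y} → y ∈ u → code y < code x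
    Increasing-prefix (y ∷ []) (inc-cons lt _) (here refl) = code-mono lt
    Increasing-prefix (y ∷ z ∷ u) (inc-cons lt inc) (here refl) = <-trans (code-mono lt) (Increasing-prefix (z ∷ u) inc (here refl))
    Increasing-prefix (y ∷ z ∷ u) (inc-cons lt inc) (there y∈) = Increasing-prefix (z ∷ u) inc y∈

    -- Used to show that the common prefix of `P` and the greedy subword consists of all greedy
    -- positions below the first place where they differ.
    threshold-unique : ∀ b u₁ {y v₁} u₂ v₂ → u₁ ++ y ∷ v₁ ≡ u₂ ++ v₂ → b < code y →
      (∀ {x} → x ∈ u₁ → code x < b) → (∀ {x} → x ∈ u₂ → code x < b) → (∀ {x} → x ∈ v₂ → b ≤ code x) → u₁ ≡ u₂
    threshold-unique b [] [] v₂ eq _ _ _ _ = refl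
    threshold-unique b [] (x ∷ u₂) v₂ eq b<y _ lt₂ _ = ⊥-elim (<-asym b<y (subst (λ z → code z < b) (sym (∷-injectiveˡ eq)) (lt₂ (here refl))))
    threshold-unique b (x ∷ u₁) [] v₂ eq _ lt₁ _ ge = ⊥-elim (<⇒≱ (lt₁ (here refl)) (ge (subst (x ∈_) eq (here refl))))
    threshold-unique b (x ∷ u₁) (x' ∷ u₂) v₂ eq b<y lt₁ lt₂ ge =
      cong₂ _∷_ (∷-injectiveˡ eq) (threshold-unique b u₁ u₂ v₂ (∷-injectiveʳ eq) b<y (lt₁ ∘ there) (lt₂ ∘ there) ge)

    I : ℕ
    I = proj₁ (complete 0)

    pr-I : pr 0 I ≈ w
    pr-I = proj₂ (proj₂ (complete 0))

    longest-Q : IsLongestWord M (letters c (Q I))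
    longest-Q = subst (IsLongestWord M) (sym (letters-Q I)) (pr-reduced 0 I , λ v red →
      subst (length v ≤_) (reduced-length (proj₁ longest-w) (pr-reduced 0 I) (≈-sym pr-I)) (proj₂ longest-w v red))
      where
      longest-w : IsLongestWord M w
      longest-w = proj₁ (proj₂ sorting)

    -- Suppose `P` first differs by an earlier position, of code b. The letters chosen before are
    -- those of `pr 0 b`, and adding `L b` gives a prefix of the reduced word `w`. So `L b` is an
    -- ascent and the greedy word takes b as well.
    ¬LexLess : ¬ LexLess c P (Q I)
    ¬LexLess (u , x , y , P' , Q' , x<y , eqP , eqQ) = <-irrefl refl (subst (b <_) code-y b<y)
      where
      b : ℕ
      b = code x
      b<y : b < code y
      b<y = code-mono x<y
      y-taken : ∃ λ z → z ∈ taken I × y ≡ pos z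
      y-taken = ∈-map⁻ pos (subst (y ∈_) (sym eqQ) (∈-++⁺ʳ u (here refl)))
      b<I : b < I
      b<I = <-trans (subst (b <_) (trans (cong code (proj₂ (proj₂ y-taken))) (code-pos _)) b<y) (taken-< I (proj₁ (proj₂ y-taken)))
      split₀ = taken-split b (I ∸ b)
      R₀ = proj₁ split₀
      eq₀ : Q I ≡ Q b ++ map pos R₀
      eq₀ = trans (cong Q (sym (m∸n+n≡m (<⇒≤ b<I)))) (trans (cong (map pos) (proj₁ (proj₂ split₀))) (map-++ pos (taken b) R₀))
      code-map : ∀ {zs : List ℕ} {z} → z ∈ map pos zs → ∃ λ k → k ∈ zs × code z ≡ k
      code-map z∈ with ∈-map⁻ pos z∈
      ... | k , k∈ , refl = k , k∈ , code-pos k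
      u≡ : u ≡ Q b
      u≡ = threshold-unique b u (Q b) (map pos R₀) (trans (sym eqQ) eq₀) b<y
        (Increasing-prefix u (subst (Increasing c) eqP (proj₁ sorting)))
        (λ z∈ → let k , k∈ , e = code-map z∈ in subst (_< b) (sym e) (taken-< b k∈))
        (λ z∈ → let k , k∈ , e = code-map z∈ in subst (b ≤_) (sym e) (proj₂ (proj₂ split₀) k∈))
      w≡ : w ≡ (pr 0 b ++ [ L b ]) ++ letters c P'
      w≡ = trans (cong (letters c) eqP) (trans (map-++ _ u (x ∷ P')) (trans (cong₂ (λ p q → p ++ q ∷ letters c P') (trans (cong (letters c) u≡) (letters-Q b)) (sym (L-code x))) (sym (++-assoc (pr 0 b) [ L b ] _))))
      gb : g 0 b ≡ true
      gb = trans (g≡ {0} {b} z≤n) (cong not (reduced⇒D≡false (pr 0 b) (L b) (reduced-prefix _ (letters c P') (subst (IsReduced M) w≡ (proj₁ (proj₁ (proj₂ sorting)))))))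
      split₁ = taken-split (suc b) (I ∸ suc b)
      R₁ = proj₁ split₁
      eq₁ : Q I ≡ Q b ++ pos b ∷ map pos R₁
      eq₁ = trans (cong Q (sym (m∸n+n≡m b<I))) (trans (cong (map pos) (trans (proj₁ (proj₂ split₁)) (cong (_++ R₁) (cong (λ z → if z then taken b ++ [ b ] else taken b) gb))))
        (trans (map-++ pos (taken b ++ [ b ]) R₁) (trans (cong (_++ map pos R₁) (map-++ pos (taken b) [ b ])) (++-assoc (Q b) [ pos b ] _))))
      y≡ : y ≡ pos b
      y≡ = ∷-injectiveˡ (++-cancelˡ (Q b) _ _ (trans (cong (_++ y ∷ Q') (sym u≡)) (trans (sym eqQ) eq₁)))
      code-y : code y ≡ b
      code-y = trans (cong code y≡) (code-pos b)

    -- The greedy subword competes with `P`, and `P` cannot be strictly smaller, so minimality of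
    -- `P` makes them equal as lists of positions.
    w≡pr : w ≡ pr 0 I
    w≡pr with proj₂ (proj₂ sorting) (Q I) (Increasing-Q I) longest-Q
    ... | inj₁ P≡Q = trans (cong (letters c) P≡Q) (letters-Q I)
    ... | inj₂ less = ⊥-elim (¬LexLess less)

    w≡pr-late : ∀ k → w ≡ pr 0 (k + I)
    w≡pr-late k = trans w≡pr (sym (complete-stable {0} {I} z≤n pr-I k))

    before-positions : ∀ {s t} → Before c s t → ∃₂ λ i j → i < j × j < N × L i ≡ s × L j ≡ t
    before-positions b with before-indices b
    ... | i , j , lt , e , e' = toℕ i , toℕ j , lt , Finₚ.toℕ<n j , trans (L-toℕ i) e , trans (L-toℕ j) e'

    equal : ∀ {s t ψs ψt} → 3 ≤ m M s t → Before c s t → [ ψs ] ≈ reverse w ++ s ∷ w → [ ψt ] ≈ reverse w ++ t ∷ w →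
      Before c ψs ψt → φ w s ≡ φ w t
    equal 3≤ before es et b with before-positions before | before-positions b
    ... | i , j , i<j , j<N , Li , Lj | r , q , r<q , q<N , Lr , Lq = equal-copies (I , w≡pr-late) 3≤ es et i<j j<N Li Lj r<q q<N Lr Lq

    successor : ∀ {s t ψs ψt} → 3 ≤ m M s t → Before c s t → [ ψs ] ≈ reverse w ++ s ∷ w → [ ψt ] ≈ reverse w ++ t ∷ w →
      Before c ψt ψs → φ w s ≡ suc (φ w t)
    successor 3≤ before es et b with before-positions before | before-positions b
    ... | i , j , i<j , j<N , Li , Lj | r , q , r<q , q<N , Lr , Lq = next-copies (I , w≡pr-late) 3≤ es et i<j j<N Li Lj r<q q<N Lr Lq

open import Data.Nat using (ℕ; _≤_; suc)
open import Data.Nat.Properties using (_≟_)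
open import Data.Product using (_×_; _,_)
open import Data.Fin using (Fin)
open import Data.List using (List; _∷_; []; _++_; reverse)
open import Data.List.Membership.Propositional.Properties using (∈-allFin)
open import Data.List.Relation.Binary.Permutation.Propositional using (↭-sym)
open import Data.List.Relation.Binary.Permutation.Propositional.Properties using (∈-resp-↭)
open import Relation.Binary.PropositionalEquality using (_≡_)
open import Relation.Nullary.Decidable using (decidable-stable)
open SortingWord

theorem7p2 : ∀ {n} (M : CoxeterMatrix n) → IsFinite M →
    (c : Word n) → IsCoxeterWord c →
    (P : List (Pos c)) → IsSortingWordW₀ M c P →
    (s t : Fin n) → 3 ≤ m M s t → Before c s t →
    (ψs ψt : Fin n) →
    (ψs ∷ []) ≈⟨ M ⟩ (reverse (letters c P) ++ s ∷ letters c P) →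
    (ψt ∷ []) ≈⟨ M ⟩ (reverse (letters c P) ++ t ∷ letters c P) →
    (Before c ψs ψt → φ (letters c P) s ≡ φ (letters c P) t) ×
    (Before c ψt ψs → φ (letters c P) s ≡ suc (φ (letters c P) t))
theorem7p2 M fin [] cox P sorting s t 3≤ before ψs ψt es et with ∈-resp-↭ (↭-sym cox) (∈-allFin s)
... | ()
theorem7p2 M fin (x₀ ∷ c') cox P sorting s t 3≤ before ψs ψt es et =
    (λ b → decidable-stable (_ ≟ _) λ ¬eq → ¬¬-decidable-≈ M fin λ dec → ¬eq (Main.equal M dec x₀ c' cox P sorting 3≤ before es et b))
  , (λ b → decidable-stable (_ ≟ _) λ ¬eq → ¬¬-decidable-≈ M fin λ dec → ¬eq (Main.successor M dec x₀ c' cox P sorting 3≤ before es et b))
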